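{- Let $G$ be a $4$-edge-connected graph (multigraph; parallel edges and loops allowed) and let $r\in V(G)$. Then there exists a set of four spanning trees of $G$ that are pairwise edge-independent with root $r$.
   Context: Graphs are multigraphs: parallel edges and loops are allowed; a loop contributes $2$ to the degree of its vertex. Paths and cycles are simple. Two subtrees $T_1,T_2$ of $G$ are edge-independent with root $r$ if both contain $r$ and for every $v\in V(T_1)\cap V(T_2)$ the unique $r$–$v$ path in $T_1$ is edge-disjoint from the unique $r$–$v$ path in $T_2$. A larger set of trees is edge-independent with root $r$ if its members are pairwise edge-independent with root $r$. -}

module Defs where

open import Data.Nat using (ℕ; suc; _<_)
open import Data.Fin using (Fin)
open import Data.Fin.Subset using (Subset; ∁; ∣_∣) renaming (_∈_ to _∈ₛ_)
open import Data.Product using (_×_; _,_)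
open import Data.Sum using (_⊎_)
open import Data.List using (List; []; _∷_)
open import Data.List.Relation.Unary.Unique.Propositional using (Unique)
open import Data.List.Membership.Propositional using (_∈_)
open import Data.Empty using (⊥)
open import Relation.Binary.PropositionalEquality using (_≡_; _≢_)

-- A finite multigraph: vertices Fin n, edges Fin m, each edge has an
-- (unordered) pair of endpoints; parallel edges and loops (both ends equal)
-- are allowed.
record Multigraph : Set where
  field
    n m  : ℕ
    ends : Fin m → Fin n × Fin n

module _ (G : Multigraph) where
  open Multigraph G

  Joins : Fin m → Fin n → Fin n → Set
  Joins e u w = (ends e ≡ (u , w)) ⊎ (ends e ≡ (w , u))

  data Walk (S : Subset m) : Fin n → Fin n → Set where
    []  : ∀ {v} → Walk S v v
    _∷⟨_,_⟩_ : ∀ {u w v} (e : Fin m) → e ∈ₛ S → Joins e u w →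
               Walk S w v → Walk S u v

  edgesW : ∀ {S u v} → Walk S u v → List (Fin m)
  edgesW []              = []
  edgesW (e ∷⟨ _ , _ ⟩ p) = e ∷ edgesW p

  laterVertices : ∀ {S u v} → Walk S u v → List (Fin n)
  laterVertices []                    = []
  laterVertices (_∷⟨_,_⟩_ {w = w} _ _ _ p) = w ∷ laterVertices p

  vertices : ∀ {S u v} → Walk S u v → List (Fin n)
  vertices {u = u} p = u ∷ laterVertices p

  IsPath : ∀ {S u v} → Walk S u v → Set
  IsPath p = Unique (vertices p)

  -- a cycle: a closed walk of length ≥ 1 with distinct edges whose
  -- vertices v₁ … v_k (= v₀) are pairwise distinct.  Loops are cycles of
  -- length 1, two parallel edges form a cycle of length 2.
  IsCycle : ∀ {S u} → Walk S u u → Set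
  IsCycle []                = ⊥
  IsCycle p@(_ ∷⟨ _ , _ ⟩ _) = Unique (edgesW p) × Unique (laterVertices p)

  Connected : Subset m → Set
  Connected S = ∀ u v → Walk S u v

  Acyclic : Subset m → Set
  Acyclic S = ∀ u (c : Walk S u u) → IsCycle c → ⊥

  IsSpanningTree : Subset m → Set
  IsSpanningTree T = Connected T × Acyclic T

  -- k-edge-connected (Diestel): |G| > 1 and G - F connected for |F| < k
  EdgeConnected : ℕ → Set
  EdgeConnected k = (1 < n) × (∀ (F : Subset m) → ∣ F ∣ < k → Connected (∁ F))

  EdgeIndependent : Fin n → Subset m → Subset m → Set
  EdgeIndependent r T₁ T₂ =
    ∀ v (P : Walk T₁ r v) (Q : Walk T₂ r v) → IsPath P → IsPath Q →
    ∀ e → e ∈ edgesW P → e ∈ edgesW Q → ⊥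

{-# OPTIONS --safe #-}

-- If deleting an edge keeps every cut at size at least 4, induct on the smaller graph; its trees
-- remain good.  Otherwise every edge lies in a 4-cut, and uncrossing yields a vertex v ≠ r of
-- degree 4.  Of the pairings 12|34 and 13|24 of the four edges at v at most one is obstructed by
-- a small cut, so v can be split off, and G arises from a smaller graph by pinching two edges at v.
--
-- The invariant carried through the induction is a pair of times α x < β x for each vertex
-- together with a division of the edges into forward, backward and one-way ones.  It asks that
-- every set of vertices of equal α be joined to the rest of its α-past by two usable edges, and
-- symmetrically for β; so the vertices can be added by ears, each attached to the α-past, or to
-- the β-future.  As in an st-numbering, the ears can be ordered so that one tree descends and a
-- second one ascends in the order, which makes these two edge-disjoint.  A forward and a backward
-- tree path from x are edge-disjoint because one stays before α x and the other after β x.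

module Submission where

open import Defs
open import Data.Fin using (Fin; zero; suc; toℕ; fromℕ<)
open import Data.Fin.Subset using (Subset; ∁; ∣_∣) renaming (_∈_ to _∈ₛ_; ⊥ to ⊥ₛ)
open import Data.Product using (Σ; ∃; _×_; _,_; proj₁; proj₂)
open import Relation.Binary.PropositionalEquality
open import Data.Bool using (Bool; true; false; if_then_else_; _∨_; _∧_; not; _xor_)
import Data.Bool.Properties as Bool
open import Data.Empty using (⊥; ⊥-elim)
open import Data.Fin.Patterns using (0F; 1F; 2F; 3F)
import Data.Fin.Properties as Fin
open import Data.Fin.Subset.Properties using (anySubset?; ∣⊥∣≡0)
open import Data.Integer as ℤ using (ℤ)
import Data.Integer.Properties as ℤ
open import Data.List.Membership.Propositional using (_∈_; _∉_)
open import Data.List.Relation.Unary.All as All using (_∷_)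
open import Data.List.Relation.Unary.AllPairs using (_∷_)
open import Data.List.Relation.Unary.Any using (here; there)
open import Data.List.Relation.Unary.Unique.Propositional using (Unique)
open import Data.Nat as ℕ using (ℕ; zero; suc; _+_; _*_; _∸_; z≤n; s≤s)
import Data.Nat.Properties as ℕ
open import Data.Sum using (_⊎_; inj₁; inj₂; [_,_]′)
import Data.Vec as Vec
import Data.Vec.Properties as Vec
open import Function using (_∘_; case_of_)
open import Relation.Binary using (tri<; tri≈; tri>)
open import Relation.Nullary using (¬_; Dec; yes; no; does; contradiction)
open import Relation.Nullary.Decidable using (dec-true; dec-false; _×-dec_; _→-dec_; ¬?; map′; from-yes)
open import Algebra.Properties.CommutativeMonoid.Sum ℕ.+-0-commutativeMonoid
  using (sum; sum-cong-≗; sum-replicate-zero; ∑-distrib-+)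

-- An edge with `β x < α y` can be climbed by forward trees only from `y` and by backward trees only
-- from `x`, so it may serve both. This is the one-way label, given out whenever the times allow. It
-- is needed because a pinch leaves `v` four spokes, two for the forward and two for the backward
-- trees, while each pinched edge must go on serving every set that used it as an exit: a spoke
-- handed to the other direction can do so by being one-way. The obstacle is a tie: if the later
-- ends of two pinched forward edges lie on one level, a suitable time for `v` need not exist with
-- the old times kept. The level itself is then split in two, and ear growth, otherwise needed only
-- for the final trees, decides which vertices stay. The refinement by eight is the room this takes:
-- old values of `α` go to slot 0 and old values of `β` to slot 4, so that ties between them count
-- as overlap, `v` uses slots 0 to 2 or 4 to 6, and slot 3 is for the upper half of a split level.

-- Booleans, updates, finite sums and minima

true≢false : true ≢ false
true≢false ()

split : ∀ b → b ≡ true ⊎ b ≡ false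
split true  = inj₁ refl
split false = inj₂ refl

clash : ∀ {A : Set} {b} → b ≡ true → b ≡ false → A
clash p q = contradiction (trans (sym p) q) true≢false

if-true : ∀ {A : Set} {b} {x y : A} → b ≡ true → (if b then x else y) ≡ x
if-true refl = refl

if-false : ∀ {A : Set} {b} {x y : A} → b ≡ false → (if b then x else y) ≡ y
if-false refl = refl

∨-introˡ : ∀ {a b} → a ≡ true → a ∨ b ≡ true
∨-introˡ refl = refl

∨-introʳ : ∀ {a b} → b ≡ true → a ∨ b ≡ true
∨-introʳ {true}  _ = refl
∨-introʳ {false} p = p

∨-elim : ∀ {a b} → a ∨ b ≡ true → a ≡ true ⊎ (a ≡ false × b ≡ true)
∨-elim {true}  _ = inj₁ refl
∨-elim {false} p = inj₂ (refl , p)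

∨-false : ∀ {a b} → a ∨ b ≡ false → a ≡ false × b ≡ false
∨-false {false} p = refl , p

∧-intro : ∀ {a b} → a ≡ true → b ≡ true → a ∧ b ≡ true
∧-intro refl refl = refl

∧-elim : ∀ {a b} → a ∧ b ≡ true → a ≡ true × b ≡ true
∧-elim {true} p = refl , p

not-true : ∀ {a} → not a ≡ true → a ≡ false
not-true {false} _ = refl

from-does : ∀ {A : Set} (d : Dec A) → does d ≡ true → A
from-does (yes p) _ = p

_==_ : ∀ {n} → Fin n → Fin n → Bool
i == j = does (i Fin.≟ j)

==-refl : ∀ {n} (i : Fin n) → (i == i) ≡ true
==-refl i = dec-true (i Fin.≟ i) refl

==-≢ : ∀ {n} {i j : Fin n} → i ≢ j → (i == j) ≡ false
==-≢ {i = i} {j} = dec-false (i Fin.≟ j)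

==⇒≡ : ∀ {n} (i j : Fin n) → (i == j) ≡ true → i ≡ j
==⇒≡ i j p with i Fin.≟ j
... | yes q = q

_[_↦_] : ∀ {n} {A : Set} → (Fin n → A) → Fin n → A → Fin n → A
(f [ i ↦ a ]) j = if j == i then a else f j

updated : ∀ {n} {A : Set} (f : Fin n → A) i a → (f [ i ↦ a ]) i ≡ a
updated f i a = if-true (==-refl i)

kept : ∀ {n} {A : Set} (f : Fin n → A) {i} a {j} → j ≢ i → (f [ i ↦ a ]) j ≡ f j
kept f a j≢i = if-false (==-≢ j≢i)

sum-mono : ∀ {n} {f g : Fin n → ℕ} → (∀ i → f i ℕ.≤ g i) → sum f ℕ.≤ sum g
sum-mono {zero}  p = z≤n
sum-mono {suc n} p = ℕ.+-mono-≤ (p zero) (sum-mono (p ∘ suc))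

sum-strict : ∀ {n} {f g : Fin n → ℕ} → (∀ i → f i ℕ.≤ g i) → ∀ i → f i ℕ.< g i → sum f ℕ.< sum g
sum-strict p zero    q = ℕ.+-mono-<-≤ q (sum-mono (p ∘ suc))
sum-strict p (suc i) q = ℕ.+-mono-≤-< (p zero) (sum-strict (p ∘ suc) i q)

sum-extract : ∀ {n} (f : Fin n → ℕ) i → sum f ≡ f i + sum (f [ i ↦ 0 ])
sum-extract {suc n} f zero    = refl
sum-extract {suc n} f (suc i) = begin
  f zero + sum (f ∘ suc)                                ≡⟨ cong (f zero +_) (sum-extract (f ∘ suc) i) ⟩
  f zero + (f (suc i) + sum ((f ∘ suc) [ i ↦ 0 ]))      ≡⟨ ℕ.+-assoc (f zero) _ _ ⟨
  f zero + f (suc i) + sum ((f ∘ suc) [ i ↦ 0 ])        ≡⟨ cong (_+ sum ((f ∘ suc) [ i ↦ 0 ])) (ℕ.+-comm (f zero) _) ⟩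
  f (suc i) + f zero + sum ((f ∘ suc) [ i ↦ 0 ])        ≡⟨ ℕ.+-assoc (f (suc i)) _ _ ⟩
  f (suc i) + (f zero + sum ((f ∘ suc) [ i ↦ 0 ]))      ∎
  where open ≡-Reasoning

sum-+ : ∀ {n} (f g : Fin n → ℕ) {h : Fin n → ℕ} → (∀ i → f i + g i ℕ.≤ h i) → sum f + sum g ℕ.≤ sum h
sum-+ f g p = subst (ℕ._≤ _) (∑-distrib-+ f g) (sum-mono p)

sum-+-+ : ∀ {n} (f g h k : Fin n → ℕ) → (∀ i → f i + g i ℕ.≤ h i + k i) → sum f + sum g ℕ.≤ sum h + sum k
sum-+-+ f g h k p = subst (sum f + sum g ℕ.≤_) (∑-distrib-+ h k) (sum-+ f g p)

bit : Bool → ℕ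
bit true  = 1
bit false = 0

size : ∀ {n} → (Fin n → Bool) → ℕ
size Y = sum (bit ∘ Y)

bit-mono : ∀ {a b} → (a ≡ true → b ≡ true) → bit a ℕ.≤ bit b
bit-mono {false}         p = z≤n
bit-mono {true}  {true}  p = s≤s z≤n
bit-mono {true}  {false} p = contradiction (sym (p refl)) true≢false

size-mono : ∀ {n} {X Y : Fin n → Bool} → (∀ i → X i ≡ true → Y i ≡ true) → size X ℕ.≤ size Y
size-mono p = sum-mono (bit-mono ∘ p)

size-strict : ∀ {n} {X Y : Fin n → Bool} → (∀ i → X i ≡ true → Y i ≡ true) →
  ∀ i → X i ≡ false → Y i ≡ true → size X ℕ.< size Y
size-strict {X = X} {Y} p i Xi Yi = sum-strict (bit-mono ∘ p) i below
  where
  below : bit (X i) ℕ.< bit (Y i)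
  below rewrite Xi | Yi = s≤s z≤n

argmin : ∀ {n} (P : Fin n → Bool) (κ : Fin n → ℤ) →
  (∀ i → P i ≡ false) ⊎ ∃ λ i → P i ≡ true × (∀ j → P j ≡ true → κ i ℤ.≤ κ j)
argmin {zero}  P κ = inj₁ λ ()
argmin {suc n} P κ with split (P zero) | argmin (P ∘ suc) (κ ∘ suc)
... | inj₂ z | inj₁ none = inj₁ λ { zero → z ; (suc j) → none j }
... | inj₁ z | inj₁ none = inj₂ (zero , z , λ { zero _ → ℤ.≤-refl ; (suc j) p → clash p (none j) })
... | inj₂ z | inj₂ (i , Pi , least) =
  inj₂ (suc i , Pi , λ { zero p → clash p z ; (suc j) p → least j p })
... | inj₁ z | inj₂ (i , Pi , least) with ℤ.≤-total (κ zero) (κ (suc i))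
... | inj₁ le = inj₂ (zero , z , λ { zero _ → ℤ.≤-refl ; (suc j) p → ℤ.≤-trans le (least j p) })
... | inj₂ ge = inj₂ (suc i , Pi , λ { zero _ → ge ; (suc j) p → least j p })

find : ∀ {n} (P : Fin n → Bool) → (∀ i → P i ≡ false) ⊎ ∃ λ i → P i ≡ true
find P with argmin P (λ _ → ℤ.+ 0)
... | inj₁ none        = inj₁ none
... | inj₂ (i , p , _) = inj₂ (i , p)

-- Refinement of the time axis

abstract
  -- at a k is the k-th of eight instants refining the instant a.
  at : ℤ → ℕ → ℤ
  at a k = a ℤ.* ℤ.+ 8 ℤ.+ ℤ.+ k

  at-<ʳ : ∀ a {j k} → j ℕ.< k → at a j ℤ.< at a k
  at-<ʳ a p = ℤ.+-monoʳ-< (a ℤ.* ℤ.+ 8) (ℤ.+<+ p)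

  at-≤ʳ : ∀ a {j k} → j ℕ.≤ k → at a j ℤ.≤ at a k
  at-≤ʳ a p = ℤ.+-monoʳ-≤ (a ℤ.* ℤ.+ 8) (ℤ.+≤+ p)

  at-≤ˡ : ∀ {a b} k → a ℤ.≤ b → at a k ℤ.≤ at b k
  at-≤ˡ k p = ℤ.+-monoˡ-≤ (ℤ.+ k) (ℤ.*-monoʳ-≤-nonNeg (ℤ.+ 8) p)

  at-< : ∀ {a b j} k → a ℤ.< b → j ℕ.< 8 → at a j ℤ.< at b k
  at-< {a} {b} {j} k a<b j<8 = begin-strict
    a ℤ.* ℤ.+ 8 ℤ.+ ℤ.+ j       <⟨ ℤ.+-monoʳ-< (a ℤ.* ℤ.+ 8) (ℤ.+<+ j<8) ⟩
    a ℤ.* ℤ.+ 8 ℤ.+ ℤ.+ 8       ≡⟨ ℤ.+-comm (a ℤ.* ℤ.+ 8) (ℤ.+ 8) ⟩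
    ℤ.+ 8 ℤ.+ a ℤ.* ℤ.+ 8       ≡⟨ ℤ.suc-* a (ℤ.+ 8) ⟨
    ℤ.suc a ℤ.* ℤ.+ 8         ≤⟨ ℤ.*-monoʳ-≤-nonNeg (ℤ.+ 8) (ℤ.i<j⇒suc[i]≤j a<b) ⟩
    b ℤ.* ℤ.+ 8               ≤⟨ ℤ.i≤i+j (b ℤ.* ℤ.+ 8) (ℤ.+ k) ⟩
    b ℤ.* ℤ.+ 8 ℤ.+ ℤ.+ k       ∎
    where open ℤ.≤-Reasoning

  at-≤< : ∀ {a b j k} → a ℤ.≤ b → j ℕ.< k → at a j ℤ.< at b k
  at-≤< {a} {b} {j} {k} a≤b j<k = ℤ.≤-<-trans (at-≤ˡ j a≤b) (at-<ʳ b j<k)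

  at-injective : ∀ {a b j} → at a j ≡ at b j → a ≡ b
  at-injective {a} {b} {j} eq with ℤ.<-cmp a b
  ... | tri≈ _ a≡b _ = a≡b
  ... | tri< a<b _ _ = contradiction eq (ℤ.<⇒≢ (ℤ.+-monoˡ-< (ℤ.+ j) (ℤ.*-monoʳ-<-pos (ℤ.+ 8) a<b)))
  ... | tri> _ _ b<a = contradiction (sym eq) (ℤ.<⇒≢ (ℤ.+-monoˡ-< (ℤ.+ j) (ℤ.*-monoʳ-<-pos (ℤ.+ 8) b<a)))

-- Growth by ears

Link : ℕ → ℕ → Set₁
Link n m = Fin m → Fin n → Fin n → Set

record Exit {n m} (κ : Fin n → ℤ) (L : Link n m) (Y : Fin n → Bool) (t : ℤ) (g₀ : Fin m) : Set where
  constructor exit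
  field
    {edge}    : Fin m
    {from to} : Fin n
    edge≢     : edge ≢ g₀
    link      : L edge from to
    from∈     : Y from ≡ true
    to∉       : Y to ≡ false
    level     : κ to ℤ.≤ t

-- Every nonempty set Y of vertices of the same level t has two edges to vertices outside Y of
-- level at most t: whichever edge g₀ is forbidden, another one is left.
TwoExits : ∀ {n m} → (Fin n → Bool) → Fin n → (Fin n → ℤ) → Link n m → Set
TwoExits W r κ L = ∀ Y t y → Y y ≡ true →
  (∀ y → Y y ≡ true → W y ≡ true × y ≢ r × κ y ≡ t) →
  ∀ g₀ → Exit κ L Y t g₀

-- A graph as seen by the growth of ears: each edge has one unordered pair of ends, possibly equal.
-- Edges can be switched off or filtered by label without being renamed.
record IsLink {n m} (W : Fin n → Bool) (L : Link n m) : Set where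
  field
    flip : ∀ {g a b} → L g a b → L g b a
    ends : ∀ {g a b c d} → L g a b → L g c d → (a ≡ c × b ≡ d) ⊎ (a ≡ d × b ≡ c)
    live : ∀ {g a b} → L g a b → W b ≡ true

-- `R` plays the part of the root. It is `r` alone for the final trees; when a level is split it
-- consists of `r` and everything before that level.
module Growth {n m : ℕ} (W : Fin n → Bool) (r : Fin n) (κ : Fin n → ℤ) (L : Link n m)
  (isLink : IsLink W L) (exits : TwoExits W r κ L)
  (R : Fin n → Bool) (r∈R : R r ≡ true) where

  open IsLink isLink

  private
    V E : Set
    V = Fin n
    E = Fin m

  -- Two trees on S with R contracted to the root, x having the parents p₁ x and p₂ x.  The walk
  -- from x to R in the first tree runs below F₁ x, the one in the second tree above F₂ x.
  record Structure (S : V → Bool) : Set where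
    field
      t₁ t₂  : V → E
      p₁ p₂  : V → V
      F₁ F₂  : V → ℕ
      R⊆     : ∀ {x} → R x ≡ true → S x ≡ true
      lower  : ∀ {x} → S x ≡ true → F₁ x ℕ.< F₂ x
      node₁  : ∀ {x} → S x ≡ true → R x ≡ false →
               L (t₁ x) x (p₁ x) × S (p₁ x) ≡ true × κ (p₁ x) ℤ.≤ κ x × F₁ (p₁ x) ℕ.< F₁ x
      node₂  : ∀ {x} → S x ≡ true → R x ≡ false →
               L (t₂ x) x (p₂ x) × S (p₂ x) ≡ true × κ (p₂ x) ℤ.≤ κ x × F₂ x ℕ.< F₂ (p₂ x)
      -- An edge may belong to both trees. If the first path from `x` used it at `u` and the second
      -- at `w`, then `F₂ x ≤ F₂ w ≤ F₁ u ≤ F₁ x`, against `lower`.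
      shared : ∀ {u w} → S u ≡ true → R u ≡ false → S w ≡ true → R w ≡ false →
               t₁ u ≡ t₂ w → F₂ w ℕ.≤ F₁ u

    Parental : V → E → Set
    Parental v g = g ≡ t₁ v ⊎ g ≡ t₂ v

  -- A path given by local data: each vertex knows its edges towards `h₀` and `h₁`, and `pos`
  -- increases along the path. The attachment vertices may coincide, but the two end edges may not;
  -- otherwise a one-vertex ear could hang on a single edge.
  record Ear (S : V → Bool) (a : ℤ) : Set where
    field
      In          : V → Bool
      pos         : V → ℕ
      K           : ℕ
      e⁻ e⁺       : V → E
      n⁻ n⁺       : V → V
      h₀ h₁       : V
      g₀ g₁       : E
      h₀∈         : S h₀ ≡ true
      h₁∈         : S h₁ ≡ true
      κh₀         : κ h₀ ℤ.≤ a
      κh₁         : κ h₁ ℤ.≤ a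
      distinct    : g₀ ≢ g₁
      fresh       : ∀ {x} → In x ≡ true → S x ≡ false × κ x ≡ a × W x ≡ true
      bound       : ∀ {x} → In x ≡ true → pos x ℕ.< K
      link⁻       : ∀ {x} → In x ≡ true → L (e⁻ x) x (n⁻ x)
      link⁺       : ∀ {x} → In x ≡ true → L (e⁺ x) x (n⁺ x)
      step⁻       : ∀ {x} → In x ≡ true → (n⁻ x ≡ h₀ × e⁻ x ≡ g₀)
                    ⊎ (In (n⁻ x) ≡ true × pos (n⁻ x) ℕ.< pos x × e⁺ (n⁻ x) ≡ e⁻ x)
      step⁺       : ∀ {x} → In x ≡ true → (n⁺ x ≡ h₁ × e⁺ x ≡ g₁)
                    ⊎ (In (n⁺ x) ≡ true × pos x ℕ.< pos (n⁺ x) × e⁻ (n⁺ x) ≡ e⁺ x)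

  reverse : ∀ {S a} → Ear S a → Ear S a
  reverse ε = record
    { In = In ; pos = λ x → K ∸ suc (pos x) ; K = K
    ; e⁻ = e⁺ ; e⁺ = e⁻ ; n⁻ = n⁺ ; n⁺ = n⁻ ; h₀ = h₁ ; h₁ = h₀ ; g₀ = g₁ ; g₁ = g₀
    ; h₀∈ = h₁∈ ; h₁∈ = h₀∈ ; κh₀ = κh₁ ; κh₁ = κh₀ ; distinct = distinct ∘ sym
    ; fresh = fresh
    ; bound = λ i → ℕ.∸-monoʳ-< {K} {_} {0} (s≤s z≤n) (bound i)
    ; link⁻ = link⁺ ; link⁺ = link⁻
    ; step⁻ = λ i → case step⁺ i of λ
        { (inj₁ p) → inj₁ p
        ; (inj₂ (j , lt , eq)) → inj₂ (j , ℕ.∸-monoʳ-< (s≤s lt) (bound j) , eq) }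
    ; step⁺ = λ i → case step⁻ i of λ
        { (inj₁ p) → inj₁ p
        ; (inj₂ (j , lt , eq)) → inj₂ (j , ℕ.∸-monoʳ-< (s≤s lt) (bound i) , eq) }
    }
    where open Ear ε

  -- The extra fields say that the trees touch a vertex of the newest ear only along its two ear
  -- edges. This holds until a further ear is attached to that vertex.
  record Grown {S a} (ε : Ear S a) : Set where
    open Ear ε
    field
      structure : Structure (λ x → S x ∨ In x)
    open Structure structure
    field
      parental⁻ : ∀ {x} → In x ≡ true → Parental x (e⁻ x)
      parental⁺ : ∀ {x} → In x ≡ true → Parental x (e⁺ x)
      last₁ : ∀ {v u} → In v ≡ true → S u ∨ In u ≡ true → R u ≡ false → p₁ u ≡ v → Parental v (t₁ u)
      last₂ : ∀ {v u} → In v ≡ true → S u ∨ In u ≡ true → R u ≡ false → p₂ u ≡ v → Parental v (t₂ u)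

  unreverse : ∀ {S a} (ε : Ear S a) → Grown (reverse ε) → Grown ε
  unreverse ε γ = record
    { structure = structure ; parental⁻ = parental⁺ ; parental⁺ = parental⁻
    ; last₁ = last₁ ; last₂ = last₂ }
    where open Grown γ

  module _ {S a} (σ : Structure S) (ε : Ear S a) where
    open Structure σ
    open Ear ε

    private
      S′ : V → Bool
      S′ x = S x ∨ In x

      old : ∀ {x} → S x ≡ true → In x ≡ false
      old {x} s with split (In x)
      ... | inj₁ i = clash s (proj₁ (fresh i))
      ... | inj₂ o = o

      place : ∀ {x} → S′ x ≡ true → In x ≡ true ⊎ (In x ≡ false × S x ≡ true)
      place {x} s with split (In x) | ∨-elim {S x} s
      ... | inj₁ i | _            = inj₁ i
      ... | inj₂ o | inj₁ s′      = inj₂ (o , s′)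
      ... | inj₂ o | inj₂ (_ , i) = clash i o

      -- Scaling by `M` leaves a gap above the image of `F₁ h₀`. The ear occupies `base + 1` to
      -- `base + 2 * K`, two values per position, and `base + M` is still at most the scaled
      -- `F₂ h₁`.
      M base : ℕ
      M    = 2 + 2 * K
      base = M * F₁ h₀

      t₁′ t₂′ : V → E
      t₁′ x = if In x then e⁻ x else t₁ x
      t₂′ x = if In x then e⁺ x else t₂ x
      p₁′ p₂′ : V → V
      p₁′ x = if In x then n⁻ x else p₁ x
      p₂′ x = if In x then n⁺ x else p₂ x
      F₁′ F₂′ : V → ℕ
      F₁′ x = if In x then base + (1 + 2 * pos x) else M * F₁ x
      F₂′ x = if In x then base + (2 + 2 * pos x) else M * F₂ x

      M-mono : ∀ {i j} → i ℕ.< j → M * i ℕ.< M * j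
      M-mono = ℕ.*-monoʳ-< M

      double-< : ∀ {i j} → i ℕ.< j → 2 + 2 * i ℕ.≤ 2 * j
      double-< {i} {j} p = subst (ℕ._≤ 2 * j) (ℕ.*-suc 2 i) (ℕ.*-monoʳ-≤ 2 p)

      -- Keeps ear edges apart from the parent edges already in use: the latter have both ends in
      -- `S`.
      clash-ends : ∀ {x y u w g} → In x ≡ true → L g x y → S u ≡ true → S w ≡ true → ¬ L g u w
      clash-ends i l s s′ l′ with ends l l′
      ... | inj₁ (refl , _) = clash i (old s)
      ... | inj₂ (refl , _) = clash i (old s′)

    module _ (oriented : F₁ h₀ ℕ.< F₂ h₁) where
      private
        lower′ : ∀ {x} → S′ x ≡ true → F₁′ x ℕ.< F₂′ x
        lower′ {x} s with place s
        ... | inj₁ i rewrite i = ℕ.+-monoʳ-< base (ℕ.n<1+n _)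
        ... | inj₂ (o , s″) rewrite o = M-mono (lower s″)

        node₁′ : ∀ {x} → S′ x ≡ true → R x ≡ false →
                 L (t₁′ x) x (p₁′ x) × S′ (p₁′ x) ≡ true × κ (p₁′ x) ℤ.≤ κ x × F₁′ (p₁′ x) ℕ.< F₁′ x
        node₁′ {x} s nr with place s
        ... | inj₂ (o , s″) rewrite o = let (l , sp , le , lt) = node₁ s″ nr in
          l , ∨-introˡ sp , le ,
          subst (ℕ._< M * F₁ x) (sym (if-false (old sp))) (M-mono lt)
        ... | inj₁ i rewrite i with step⁻ i
        ... | inj₁ (eq , _) =
          link⁻ i , ∨-introˡ sn , subst₂ ℤ._≤_ (cong κ (sym eq)) (sym (proj₁ (proj₂ (fresh i)))) κh₀ ,
          subst (ℕ._< base + (1 + 2 * pos x)) (sym (trans (if-false (old sn)) (cong (λ h → M * F₁ h) eq)))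
            (ℕ.m<m+n base (s≤s z≤n))
          where
          sn : S (n⁻ x) ≡ true
          sn = subst (λ h → S h ≡ true) (sym eq) h₀∈
        ... | inj₂ (j , lt , _) =
          link⁻ i , ∨-introʳ j , ℤ.≤-reflexive (trans (proj₁ (proj₂ (fresh j))) (sym (proj₁ (proj₂ (fresh i))))) ,
          subst (ℕ._< base + (1 + 2 * pos x)) (sym (if-true j))
            (ℕ.+-monoʳ-< base (s≤s (ℕ.*-monoʳ-< 2 lt)))

        node₂′ : ∀ {x} → S′ x ≡ true → R x ≡ false →
                 L (t₂′ x) x (p₂′ x) × S′ (p₂′ x) ≡ true × κ (p₂′ x) ℤ.≤ κ x × F₂′ x ℕ.< F₂′ (p₂′ x)
        node₂′ {x} s nr with place s
        ... | inj₂ (o , s″) rewrite o = let (l , sp , le , lt) = node₂ s″ nr in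
          l , ∨-introˡ sp , le ,
          subst (M * F₂ x ℕ.<_) (sym (if-false (old sp))) (M-mono lt)
        ... | inj₁ i rewrite i with step⁺ i
        ... | inj₁ (eq , _) =
          link⁺ i , ∨-introˡ sn , subst₂ ℤ._≤_ (cong κ (sym eq)) (sym (proj₁ (proj₂ (fresh i)))) κh₁ ,
          subst (base + (2 + 2 * pos x) ℕ.<_) (sym (trans (if-false (old sn)) (cong (λ h → M * F₂ h) eq)))
            (begin-strict
              base + (2 + 2 * pos x)  <⟨ ℕ.+-monoʳ-< base (ℕ.+-monoʳ-< 2 (ℕ.*-monoʳ-< 2 (bound i))) ⟩
              base + M                ≡⟨ ℕ.+-comm base M ⟩
              M + base                ≡⟨ ℕ.*-suc M (F₁ h₀) ⟨
              M * suc (F₁ h₀)         ≤⟨ ℕ.*-monoʳ-≤ M oriented ⟩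
              M * F₂ h₁               ∎)
          where
          open ℕ.≤-Reasoning
          sn : S (n⁺ x) ≡ true
          sn = subst (λ h → S h ≡ true) (sym eq) h₁∈
        ... | inj₂ (j , lt , _) =
          link⁺ i , ∨-introʳ j , ℤ.≤-reflexive (trans (proj₁ (proj₂ (fresh j))) (sym (proj₁ (proj₂ (fresh i))))) ,
          subst (base + (2 + 2 * pos x) ℕ.<_) (sym (if-true j))
            (ℕ.+-monoʳ-< base (s≤s (s≤s (ℕ.*-monoʳ-< 2 lt))))

        -- Normally the common edge joins `w` to its successor `u`. The other possibility is `u = w`
        -- with both ear edges equal: for a one-vertex ear `distinct` excludes it, and otherwise the
        -- common neighbour would be both earlier and later, or both old and new.
        crossed : ∀ {u w} → In u ≡ true → In w ≡ true → e⁻ u ≡ e⁺ w → pos w ℕ.< pos u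
        crossed {u} {w} i j eq with ends (link⁻ i) (subst (λ g → L g w (n⁺ w)) (sym eq) (link⁺ j))
        crossed {u} {w} i j eq | inj₂ (_ , refl) with step⁻ i
        ... | inj₁ (h , _) = clash (subst (λ h → S h ≡ true) (sym h) h₀∈) (proj₁ (fresh j))
        ... | inj₂ (_ , lt , _) = lt
        crossed {u} i j eq | inj₁ (refl , n≡) with step⁻ i | step⁺ i
        ... | inj₁ (_ , a≡) | inj₁ (_ , b≡) = contradiction (trans (sym a≡) (trans eq b≡)) distinct
        ... | inj₁ (h , _) | inj₂ (k , _) =
          clash (subst (λ h → S h ≡ true) (trans (sym h) n≡) h₀∈) (proj₁ (fresh k))
        ... | inj₂ (k , _) | inj₁ (h , _) =
          clash (subst (λ h → S h ≡ true) (trans (sym h) (sym n≡)) h₁∈) (proj₁ (fresh k))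
        ... | inj₂ (_ , lt , _) | inj₂ (_ , lt′ , _) =
          contradiction (ℕ.<-trans lt (subst (λ z → pos u ℕ.< pos z) (sym n≡) lt′)) (ℕ.<-irrefl refl)

        shared′ : ∀ {u w} → S′ u ≡ true → R u ≡ false → S′ w ≡ true → R w ≡ false →
                  t₁′ u ≡ t₂′ w → F₂′ w ℕ.≤ F₁′ u
        shared′ {u} {w} su ru sw rw eq with place su | place sw
        ... | inj₁ i | inj₁ j rewrite i | j =
          ℕ.+-monoʳ-≤ base (ℕ.≤-trans (double-< (crossed i j eq)) (ℕ.n≤1+n _))
        ... | inj₁ i | inj₂ (o , s) rewrite i | o =
          let (l , sp , _) = node₂ s rw in
          ⊥-elim (clash-ends i (link⁻ i) s sp (subst (λ g → L g w (p₂ w)) (sym eq) l))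
        ... | inj₂ (o , s) | inj₁ j rewrite o | j =
          let (l , sp , _) = node₁ s ru in
          ⊥-elim (clash-ends j (link⁺ j) s sp (subst (λ g → L g u (p₁ u)) eq l))
        ... | inj₂ (o , s) | inj₂ (o′ , s′) rewrite o | o′ = ℕ.*-monoʳ-≤ M (shared s ru s′ rw eq)

        -- Old vertices keep their old parents, so a child of `v` is a neighbour on the ear and
        -- shares an ear edge with it.
        last₁′ : ∀ {v u} → In v ≡ true → S′ u ≡ true → R u ≡ false → p₁′ u ≡ v →
                 t₁′ u ≡ t₁′ v ⊎ t₁′ u ≡ t₂′ v
        last₁′ {v} {u} i s nr eq with place s
        ... | inj₂ (o , s″) rewrite o = clash (subst (λ z → S z ≡ true) eq (proj₁ (proj₂ (node₁ s″ nr)))) (proj₁ (fresh i))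
        ... | inj₁ j rewrite j with step⁻ j
        ... | inj₁ (h , _) = clash (subst (λ z → S z ≡ true) (trans (sym h) eq) h₀∈) (proj₁ (fresh i))
        ... | inj₂ (_ , _ , e≡) rewrite i = inj₂ (trans (sym e≡) (cong e⁺ eq))

        last₂′ : ∀ {v u} → In v ≡ true → S′ u ≡ true → R u ≡ false → p₂′ u ≡ v →
                 t₂′ u ≡ t₁′ v ⊎ t₂′ u ≡ t₂′ v
        last₂′ {v} {u} i s nr eq with place s
        ... | inj₂ (o , s″) rewrite o = clash (subst (λ z → S z ≡ true) eq (proj₁ (proj₂ (node₂ s″ nr)))) (proj₁ (fresh i))
        ... | inj₁ j rewrite j with step⁺ j
        ... | inj₁ (h , _) = clash (subst (λ z → S z ≡ true) (trans (sym h) eq) h₁∈) (proj₁ (fresh i))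
        ... | inj₂ (_ , _ , e≡) rewrite i = inj₁ (trans (sym e≡) (cong e⁻ eq))

      attach-oriented : Grown ε
      attach-oriented = record
        { structure = record
          { t₁ = t₁′ ; t₂ = t₂′ ; p₁ = p₁′ ; p₂ = p₂′ ; F₁ = F₁′ ; F₂ = F₂′
          ; R⊆ = λ p → ∨-introˡ (R⊆ p)
          ; lower = λ {x} → lower′ {x} ; node₁ = node₁′ ; node₂ = node₂′ ; shared = shared′ }
        ; parental⁻ = λ i → inj₁ (sym (if-true i))
        ; parental⁺ = λ i → inj₂ (sym (if-true i))
        ; last₁ = λ {v} {u} → last₁′ {v} {u} ; last₂ = λ {v} {u} → last₂′ {v} {u} }

  -- The open intervals ]F₁ h , F₂ h[ of the two attachment vertices are nonempty, so one
  -- of the two directions of the ear fits between them.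
  attach : ∀ {S a} (σ : Structure S) (ε : Ear S a) → Grown ε
  attach σ ε with Structure.F₁ σ (Ear.h₀ ε) ℕ.<? Structure.F₂ σ (Ear.h₁ ε)
  ... | yes lt = attach-oriented σ ε lt
  ... | no ¬lt = unreverse ε (attach-oriented σ (reverse ε) lt)
    where
    open Structure σ
    open Ear ε
    lt : F₁ h₁ ℕ.< F₂ h₀
    lt = ℕ.<-trans (lower h₁∈) (ℕ.≤-<-trans (ℕ.≮⇒≥ ¬lt) (lower h₀∈))

  module Search {S : V → Bool} {a : ℤ} (r∈S : S r ≡ true)
    (closed : ∀ {u} → W u ≡ true → κ u ℤ.< a → S u ≡ true)
    {h₀ x₁ : V} {g₀ : E} (h₀∈ : S h₀ ≡ true) (κh₀ : κ h₀ ℤ.≤ a) (start : L g₀ h₀ x₁)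
    (x₁∉ : S x₁ ≡ false) (κx₁ : κ x₁ ≡ a) where

    -- An ear that still lacks its way out of `y`. The field `x₁⁻` remembers that it begins with the
    -- prescribed edge `g₀`; this is what later forces a chosen spoke to be a parent edge.
    record PartialEar (y : V) : Set where
      field
        In    : V → Bool
        pos   : V → ℕ
        e⁻ e⁺ : V → E
        n⁻ n⁺ : V → V
        y∈    : In y ≡ true
        x₁∈   : In x₁ ≡ true
        x₁⁻   : e⁻ x₁ ≡ g₀
        fresh : ∀ {x} → In x ≡ true → S x ≡ false × κ x ≡ a × W x ≡ true
        last  : ∀ {x} → In x ≡ true → pos x ℕ.≤ pos y
        link⁻ : ∀ {x} → In x ≡ true → L (e⁻ x) x (n⁻ x)
        link⁺ : ∀ {x} → In x ≡ true → x ≢ y → L (e⁺ x) x (n⁺ x)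
        step⁻ : ∀ {x} → In x ≡ true → (n⁻ x ≡ h₀ × e⁻ x ≡ g₀)
                ⊎ (In (n⁻ x) ≡ true × pos (n⁻ x) ℕ.< pos x × e⁺ (n⁻ x) ≡ e⁻ x)
        step⁺ : ∀ {x} → In x ≡ true → x ≢ y →
                In (n⁺ x) ≡ true × pos x ℕ.< pos (n⁺ x) × e⁻ (n⁺ x) ≡ e⁺ x

    trivial : PartialEar x₁
    trivial = record
      { In = _== x₁ ; pos = λ _ → 0 ; e⁻ = λ _ → g₀ ; e⁺ = λ _ → g₀ ; n⁻ = λ _ → h₀ ; n⁺ = λ _ → h₀
      ; y∈ = ==-refl x₁ ; x₁∈ = ==-refl x₁ ; x₁⁻ = refl
      ; fresh = λ {x} i → case ==⇒≡ x x₁ i of λ { refl → x₁∉ , κx₁ , live start }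
      ; last = λ _ → z≤n
      ; link⁻ = λ {x} i → case ==⇒≡ x x₁ i of λ { refl → flip start }
      ; link⁺ = λ {x} i x≢ → contradiction (==⇒≡ x x₁ i) x≢
      ; step⁻ = λ _ → inj₁ (refl , refl)
      ; step⁺ = λ {x} i x≢ → contradiction (==⇒≡ x x₁ i) x≢ }

    module _ {y u : V} {g : E} (P : PartialEar y) (l : L g y u) where
      open PartialEar P

      module _ (u∉S : S u ≡ false) (u∉In : In u ≡ false) (κu : κ u ≡ a) where
        private
          In′ : V → Bool
          In′ x = (x == u) ∨ In x
          pos′ : V → ℕ
          pos′ x = if x == u then suc (pos y) else pos x
          e⁻′ e⁺′ : V → E
          e⁻′ x = if x == u then g else e⁻ x
          e⁺′ x = if x == y then g else e⁺ x
          n⁻′ n⁺′ : V → V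
          n⁻′ x = if x == u then y else n⁻ x
          n⁺′ x = if x == y then u else n⁺ x

          In⇒≢ : ∀ {x} → In x ≡ true → (x == u) ≡ false
          In⇒≢ {x} i = ==-≢ {i = x} {u} λ { refl → clash i u∉In }

          fresh′ : ∀ {x} → In′ x ≡ true → S x ≡ false × κ x ≡ a × W x ≡ true
          fresh′ {x} i with ∨-elim {x == u} i
          ... | inj₂ (_ , j) = fresh j
          ... | inj₁ p with ==⇒≡ x u p
          ... | refl = u∉S , κu , live l

          last′ : ∀ {x} → In′ x ≡ true → pos′ x ℕ.≤ pos′ u
          last′ {x} i rewrite ==-refl u with ∨-elim {x == u} i
          ... | inj₁ p rewrite p = ℕ.≤-refl
          ... | inj₂ (p , j) rewrite p = ℕ.m≤n⇒m≤1+n (last j)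

          link⁻′ : ∀ {x} → In′ x ≡ true → L (e⁻′ x) x (n⁻′ x)
          link⁻′ {x} i with ∨-elim {x == u} i
          ... | inj₂ (p , j) rewrite p = link⁻ j
          ... | inj₁ p with ==⇒≡ x u p
          ... | refl rewrite p = flip l

          step⁻′ : ∀ {x} → In′ x ≡ true → (n⁻′ x ≡ h₀ × e⁻′ x ≡ g₀)
            ⊎ (In′ (n⁻′ x) ≡ true × pos′ (n⁻′ x) ℕ.< pos′ x × e⁺′ (n⁻′ x) ≡ e⁻′ x)
          step⁻′ {x} i with ∨-elim {x == u} i
          ... | inj₁ p rewrite p | In⇒≢ y∈ | ==-refl y = inj₂ (y∈ , ℕ.n<1+n _ , refl)
          step⁻′ {x} i | inj₂ (p , j) rewrite p with step⁻ j
          ... | inj₁ q = inj₁ q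
          ... | inj₂ (k , lt , eq)
            rewrite In⇒≢ k | ==-≢ {i = n⁻ x} {y} (λ q → ℕ.<⇒≱ lt (subst (λ z → pos x ℕ.≤ pos z) (sym q) (last j)))
            = inj₂ (k , lt , eq)

          step⁺′ : ∀ {x} → In′ x ≡ true → x ≢ u → L (e⁺′ x) x (n⁺′ x) ×
            In′ (n⁺′ x) ≡ true × pos′ x ℕ.< pos′ (n⁺′ x) × e⁻′ (n⁺′ x) ≡ e⁺′ x
          step⁺′ {x} i x≢u with ∨-elim {x == u} i
          ... | inj₁ p = contradiction (==⇒≡ x u p) x≢u
          ... | inj₂ (p , j) with split (x == y)
          ... | inj₂ q rewrite q | p = let x≢y = λ { refl → clash (==-refl x) q }
                                           (k , lt , eq) = step⁺ j x≢y in
            link⁺ j x≢y , ∨-introʳ k , subst (pos x ℕ.<_) (sym (if-false (In⇒≢ k))) lt , trans (if-false (In⇒≢ k)) eq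
          ... | inj₁ q with ==⇒≡ x y q
          ... | refl rewrite q | p | ==-refl u = l , refl , ℕ.n<1+n _ , refl

        extend : PartialEar u
        extend = record
          { In = In′ ; pos = pos′ ; e⁻ = e⁻′ ; e⁺ = e⁺′ ; n⁻ = n⁻′ ; n⁺ = n⁺′
          ; y∈ = ∨-introˡ (==-refl u) ; x₁∈ = ∨-introʳ x₁∈ ; x₁⁻ = trans (if-false (In⇒≢ x₁∈)) x₁⁻
          ; fresh = fresh′ ; last = last′ ; link⁻ = link⁻′
          ; link⁺ = λ i q → proj₁ (step⁺′ i q)
          ; step⁻ = step⁻′
          ; step⁺ = λ i q → proj₂ (step⁺′ i q) }

        extend⊆ : ∀ {Y : V → Bool} → (∀ {x} → In x ≡ true → Y x ≡ true) →
                  ∀ {x} → In′ x ≡ true → (x == u) ∨ Y x ≡ true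
        extend⊆ In⊆Y {x} i with ∨-elim {x == u} i
        ... | inj₁ p       = ∨-introˡ p
        ... | inj₂ (_ , j) = ∨-introʳ (In⊆Y j)

      module _ (u∈S : S u ≡ true) (κu : κ u ℤ.≤ a) (g≢g₀ : g ≢ g₀) where
        private
          e⁺′ : V → E
          e⁺′ x = if x == y then g else e⁺ x
          n⁺′ : V → V
          n⁺′ x = if x == y then u else n⁺ x

          link⁺′ : ∀ {x} → In x ≡ true → L (e⁺′ x) x (n⁺′ x)
          link⁺′ {x} i with split (x == y)
          ... | inj₂ q rewrite q = link⁺ i λ { refl → clash (==-refl x) q }
          ... | inj₁ q with ==⇒≡ x y q
          ... | refl rewrite q = l

          step⁺′ : ∀ {x} → In x ≡ true → (n⁺′ x ≡ u × e⁺′ x ≡ g)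
            ⊎ (In (n⁺′ x) ≡ true × pos x ℕ.< pos (n⁺′ x) × e⁻ (n⁺′ x) ≡ e⁺′ x)
          step⁺′ {x} i with split (x == y)
          ... | inj₁ q rewrite q = inj₁ (refl , refl)
          ... | inj₂ q rewrite q = inj₂ (step⁺ i λ { refl → clash (==-refl x) q })

          step⁻′ : ∀ {x} → In x ≡ true → (n⁻ x ≡ h₀ × e⁻ x ≡ g₀)
            ⊎ (In (n⁻ x) ≡ true × pos (n⁻ x) ℕ.< pos x × e⁺′ (n⁻ x) ≡ e⁻ x)
          step⁻′ {x} i with step⁻ i
          ... | inj₁ q = inj₁ q
          ... | inj₂ (k , lt , eq) = inj₂ (k , lt , trans
            (if-false (==-≢ {i = n⁻ x} {y} (λ q → ℕ.<⇒≱ lt (subst (λ z → pos x ℕ.≤ pos z) (sym q) (last i))))) eq)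

        close : Σ (Ear S a) λ ε → Ear.In ε x₁ ≡ true × Ear.e⁻ ε x₁ ≡ g₀
        close = record
          { In = In ; pos = pos ; K = suc (pos y) ; e⁻ = e⁻ ; e⁺ = e⁺′ ; n⁻ = n⁻ ; n⁺ = n⁺′
          ; h₀ = h₀ ; h₁ = u ; g₀ = g₀ ; g₁ = g ; h₀∈ = h₀∈ ; h₁∈ = u∈S ; κh₀ = κh₀ ; κh₁ = κu
          ; distinct = g≢g₀ ∘ sym ; fresh = fresh ; bound = λ i → s≤s (last i)
          ; link⁻ = link⁻ ; link⁺ = link⁺′ ; step⁻ = step⁻′ ; step⁺ = step⁺′ } , x₁∈ , x₁⁻

    -- The partial ears stay inside `Y`, so an exit from `Y` never runs back into the ear that it
    -- prolongs.
    Reached : (V → Bool) → Set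
    Reached Y = ∀ y → Y y ≡ true → Σ (PartialEar y) λ P →
      ∀ {x} → PartialEar.In P x ≡ true → Y x ≡ true

    private
      -- The reached set is part of one level, so it has an exit other than `g₀`. An exit into `S`
      -- closes an ear whose end edges differ. Any other exit leads to level exactly `a`, everything
      -- lower being in `S`, and enlarges the reached set.
      explore : ∀ fuel Y → size (not ∘ Y) ℕ.< fuel → Y x₁ ≡ true → Reached Y →
                Σ (Ear S a) λ ε → Ear.In ε x₁ ≡ true × Ear.e⁻ ε x₁ ≡ g₀
      explore (suc fuel) Y (s≤s lt) x₁∈Y reached
        with exits Y a x₁ x₁∈Y
               (λ z z∈ → let P = proj₁ (reached z z∈) ; (s , k , w) = PartialEar.fresh P (PartialEar.y∈ P) in
                 w , (λ { refl → clash r∈S s }) , k) g₀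
      ... | exit {g} {y} {u} g≢ l y∈ u∉ κu with reached y y∈ | split (S u)
      ... | P , P⊆Y | inj₁ u∈S = close P l u∈S κu g≢
      ... | P , P⊆Y | inj₂ u∉S =
        explore fuel (λ x → (x == u) ∨ Y x)
          (ℕ.<-≤-trans (size-strict shrink u (cong not (∨-introˡ {b = Y u} (==-refl u))) (cong not u∉)) lt)
          (∨-introʳ x₁∈Y) reached′
        where
        κu≡ : κ u ≡ a
        κu≡ with ℤ.<-cmp (κ u) a
        ... | tri< below _ _ = clash (closed (live l) below) u∉S
        ... | tri≈ _ eq _ = eq
        ... | tri> _ _ above = contradiction κu (ℤ.<⇒≱ above)
        u∉In : ∀ {z} (Q : PartialEar z) → (∀ {x} → PartialEar.In Q x ≡ true → Y x ≡ true) →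
               PartialEar.In Q u ≡ false
        u∉In Q Q⊆Y with split (PartialEar.In Q u)
        ... | inj₁ i = clash (Q⊆Y i) u∉
        ... | inj₂ o = o
        shrink : ∀ x → not ((x == u) ∨ Y x) ≡ true → not (Y x) ≡ true
        shrink x p = cong not (proj₂ (∨-false {x == u} (not-true p)))
        reached′ : Reached (λ x → (x == u) ∨ Y x)
        reached′ x x∈ with ∨-elim {x == u} x∈
        ... | inj₂ (_ , x∈Y) = let (Q , Q⊆Y) = reached x x∈Y in Q , λ i → ∨-introʳ (Q⊆Y i)
        ... | inj₁ p with ==⇒≡ x u p
        ... | refl = extend P l u∉S (u∉In P P⊆Y) κu≡ , extend⊆ P l u∉S (u∉In P P⊆Y) κu≡ P⊆Y

    ear-from : Σ (Ear S a) λ ε → Ear.In ε x₁ ≡ true × Ear.e⁻ ε x₁ ≡ g₀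
    ear-from = explore (suc (size (not ∘ (_== x₁)))) (_== x₁) (ℕ.n<1+n _) (==-refl x₁)
      λ y p → reached₀ (==⇒≡ y x₁ p)
      where
      reached₀ : ∀ {y} → y ≡ x₁ → Σ (PartialEar y) λ P → ∀ {x} → PartialEar.In P x ≡ true → (x == x₁) ≡ true
      reached₀ refl = trivial , λ i → i

  private
    -- All unreached vertices of level `a` together have an exit, which can only lead into `S`; read
    -- backwards it is a first edge for the search. One exit is enough here, so the forbidden edge
    -- is arbitrary.
    outsider : ∀ {S} {a x} → (∀ {u} → W u ≡ true → κ u ℤ.< a → S u ≡ true) → S r ≡ true → E →
      W x ≡ true → S x ≡ false → κ x ≡ a → Σ (Ear S a) λ ε → ∃ λ y → Ear.In ε y ≡ true
    outsider {S} {a} {x} closed r∈S g₀ wx x∉ κx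
      with exits (λ y → W y ∧ (not (S y) ∧ does (κ y ℤ.≟ a))) a x
             (∧-intro wx (∧-intro (cong not x∉) (dec-true (κ x ℤ.≟ a) κx)))
             (λ y p → let (w , q) = ∧-elim p ; (s , k) = ∧-elim q in
               w , (λ { refl → clash r∈S (not-true s) }) , from-does (κ y ℤ.≟ a) k) g₀
    ... | exit {g} {y} {u} _ l y∈ u∉ κu with split (S u)
    ... | inj₁ u∈S =
      let (s , k) = ∧-elim {not (S y)} (proj₂ (∧-elim {W y} y∈))
          (ε , y∈ε , _) = Search.ear-from r∈S closed u∈S κu (flip l) (not-true s) (from-does (κ y ℤ.≟ a) k)
      in ε , y , y∈ε
    ... | inj₂ u∉S with ℤ.<-cmp (κ u) a
    ... | tri< below _ _ = clash (closed (live l) below) u∉S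
    ... | tri> _ _ above = contradiction κu (ℤ.<⇒≱ above)
    ... | tri≈ _ κu≡ _ =
      clash (∧-intro (live l) (∧-intro (cong not u∉S) (dec-true (κ u ℤ.≟ a) κu≡))) u∉

    absorb : ∀ {S a y} (ε : Ear S a) → Ear.In ε y ≡ true →
             size (not ∘ (λ x → S x ∨ Ear.In ε x)) ℕ.< size (not ∘ S)
    absorb {S} {y = y} ε y∈ = size-strict (λ x p → cong not (proj₁ (∨-false {S x} (not-true p)))) y
      (cong not (∨-introʳ {S y} y∈)) (cong not (proj₁ (Ear.fresh ε y∈)))

    -- Every vertex of `R` is both bottom and top of the order, with the interval from 0 to 1. It
    -- has no parent, so the edges and parents are default values.
    base : E → Structure R
    base g = record
      { t₁ = λ _ → g ; t₂ = λ _ → g ; p₁ = λ _ → r ; p₂ = λ _ → r ; F₁ = λ _ → 0 ; F₂ = λ _ → 1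
      ; R⊆ = λ p → p ; lower = λ _ → s≤s z≤n
      ; node₁ = λ p q → clash p q ; node₂ = λ p q → clash p q ; shared = λ p q → clash p q }

  complete : E → Σ (V → Bool) λ S → Structure S × (∀ {u} → W u ≡ true → S u ≡ true)
  complete g = grow (suc (size (not ∘ R))) R (base g) (ℕ.n<1+n _)
    where
    grow : ∀ fuel S → Structure S → size (not ∘ S) ℕ.< fuel →
           Σ (V → Bool) λ S → Structure S × (∀ {u} → W u ≡ true → S u ≡ true)
    -- Taking an unreached vertex of least level guarantees that everything below that level is
    -- already in `S`, as the search requires.
    grow (suc fuel) S σ (s≤s lt) with argmin (λ x → W x ∧ not (S x)) κ
    ... | inj₁ none = S , σ , λ {u} w → covered u w
      where
      covered : ∀ u → W u ≡ true → S u ≡ true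
      covered u w with split (S u)
      ... | inj₁ s = s
      ... | inj₂ s = clash (∧-intro w (cong not s)) (none u)
    ... | inj₂ (x , p , least) =
      let (w , s) = ∧-elim p
          (ε , y , y∈) = outsider (λ {u} → closed {u}) (Structure.R⊆ σ r∈R) g w (not-true s) refl
      in grow fuel _ (Grown.structure (attach σ ε)) (ℕ.<-≤-trans (absorb ε y∈) lt)
      where
      closed : ∀ {u} → W u ≡ true → κ u ℤ.< κ x → S u ≡ true
      closed {u} w lt with split (S u)
      ... | inj₁ s = s
      ... | inj₂ s = contradiction (least u (∧-intro w (cong not s))) (ℤ.<⇒≱ lt)

  -- The outcome of growth that stops with the ear reaching `v`. Stopping there means that at most
  -- two distinct tree edges touch `v`.
  record Captured (a : ℤ) (v : V) : Set where
    field
      S         : V → Bool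
      structure : Structure S
    open Structure structure public
    field
      v∈S   : S v ≡ true
      level : ∀ {x} → S x ≡ true → R x ≡ false → κ x ≡ a × W x ≡ true
      last₁ : ∀ {u} → S u ≡ true → R u ≡ false → p₁ u ≡ v → Parental v (t₁ u)
      last₂ : ∀ {u} → S u ≡ true → R u ≡ false → p₂ u ≡ v → Parental v (t₂ u)

  private
    level-∨ : ∀ {S a} (ε : Ear S a) → (∀ {x} → S x ≡ true → R x ≡ false → κ x ≡ a × W x ≡ true) →
              ∀ {x} → S x ∨ Ear.In ε x ≡ true → R x ≡ false → κ x ≡ a × W x ≡ true
    level-∨ {S} ε level {x} p nr with ∨-elim {S x} p
    ... | inj₁ s       = level s nr
    ... | inj₂ (_ , i) = proj₂ (Ear.fresh ε i)

  module _ {a : ℤ} {v : V} (R-closed : ∀ {u} → W u ≡ true → κ u ℤ.< a → R u ≡ true)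
    (v∉R : R v ≡ false) (κv : κ v ≡ a) where

    capture : E → W v ≡ true → Captured a v
    capture g wv = grow (suc (size (not ∘ R))) R (base g) (λ p q → clash p q) v∉R (ℕ.n<1+n _)
      where
      grow : ∀ fuel S → Structure S → (∀ {x} → S x ≡ true → R x ≡ false → κ x ≡ a × W x ≡ true) →
             S v ≡ false → size (not ∘ S) ℕ.< fuel → Captured a v
      grow (suc fuel) S σ level v∉ (s≤s lt)
        with outsider (λ w below → Structure.R⊆ σ (R-closed w below)) (Structure.R⊆ σ r∈R) g wv v∉ κv
      ... | ε , y , y∈ with split (Ear.In ε v)
      ... | inj₁ v∈ = record
        { structure = structure ; v∈S = ∨-introʳ {S v} v∈ ; level = level-∨ ε level
        ; last₁ = last₁ v∈ ; last₂ = last₂ v∈ }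
        where open Grown (attach σ ε)
      ... | inj₂ v∉ε = grow fuel _ (Grown.structure (attach σ ε)) (level-∨ ε level)
        (trans (cong (_∨ Ear.In ε v) v∉) v∉ε) (ℕ.<-≤-trans (absorb ε y∈) lt)

    -- With `v` as first vertex of the only ear, `g` is its edge towards `h₀`, and ear edges become
    -- parent edges in either orientation of the ear.
    capture-via : ∀ {g h} → L g h v → R h ≡ true → κ h ℤ.≤ a →
                  Σ (Captured a v) λ c → Captured.Parental c v g
    capture-via {g} l h∈ κh with Search.ear-from r∈R R-closed h∈ κh l v∉R κv
    ... | ε , v∈ , refl = record
      { structure = structure ; v∈S = ∨-introʳ {R v} v∈ ; level = level-∨ ε (λ p q → clash p q)
      ; last₁ = last₁ v∈ ; last₂ = last₂ v∈ } , parental⁻ v∈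
      where open Grown (attach (base g) ε)

  module _ {S : V → Bool} (σ : Structure S) where
    open Structure σ

    ParentEdge : V → E → V → Set
    ParentEdge u g p = (g ≡ t₁ u × p ≡ p₁ u) ⊎ (g ≡ t₂ u × p ≡ p₂ u)

    -- A converse to growth: parent edges alone give two exits. The member of least `F₁` leaves by
    -- its first parent edge and the member of greatest `F₂` by its second. Were these equal, either
    -- the two members coincide, against `shared` and `lower`, or one is the parent of the other and
    -- lies outside `Y`.
    climb : ∀ (Y : V → Bool) y → Y y ≡ true → (∀ {x} → Y x ≡ true → S x ≡ true × R x ≡ false) →
            ∀ g₀ → Σ E λ g → Σ V λ u → Σ V λ p → g ≢ g₀ × Y u ≡ true × Y p ≡ false × ParentEdge u g p
    climb Y y y∈ Y⊆ g₀
      with argmin Y (λ x → ℤ.+ F₁ x) | argmin Y (λ x → ℤ.- (ℤ.+ F₂ x))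
    ... | inj₁ none | _ = clash y∈ (none y)
    ... | _ | inj₁ none = clash y∈ (none y)
    ... | inj₂ (u , u∈ , least) | inj₂ (w , w∈ , greatest) = choose (t₁ u Fin.≟ g₀)
      where
      su = proj₁ (Y⊆ u∈)
      ru = proj₂ (Y⊆ u∈)
      sw = proj₁ (Y⊆ w∈)
      rw = proj₂ (Y⊆ w∈)
      out₁ : Y (p₁ u) ≡ false
      out₁ with split (Y (p₁ u))
      ... | inj₂ o = o
      ... | inj₁ i = contradiction (ℤ.drop‿+≤+ (least (p₁ u) i)) (ℕ.<⇒≱ (proj₂ (proj₂ (proj₂ (node₁ su ru)))))
      out₂ : Y (p₂ w) ≡ false
      out₂ with split (Y (p₂ w))
      ... | inj₂ o = o
      ... | inj₁ i = contradiction (ℤ.drop‿+≤+ (ℤ.neg-cancel-≤ (greatest (p₂ w) i)))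
                                   (ℕ.<⇒≱ (proj₂ (proj₂ (proj₂ (node₂ sw rw)))))
      different : t₁ u ≢ t₂ w
      different eq with ends (proj₁ (node₁ su ru)) (subst (λ g → L g w (p₂ w)) (sym eq) (proj₁ (node₂ sw rw)))
      ... | inj₁ (refl , _) = ℕ.<⇒≱ (lower su) (shared su ru sw rw eq)
      ... | inj₂ (u≡ , _) = clash (trans (cong Y (sym u≡)) u∈) out₂
      choose : Dec (t₁ u ≡ g₀) → _
      choose (no ≢g₀) = t₁ u , u , p₁ u , ≢g₀ , u∈ , out₁ , inj₁ (refl , refl)
      choose (yes refl) = t₂ w , w , p₂ w , different ∘ sym , w∈ , out₂ , inj₂ (refl , refl)

-- Decompositions and pinching

data Label : Set where
  F B O : Label

-- The label given is the excluded one: `B` leaves the edges of the forward trees and `F` those of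
-- the backward trees.
Usable : ∀ {n m} → Link n m → (Fin m → Label) → Label → Link n m
Usable J lab ℓ g a b = J g a b × lab g ≢ ℓ

usable-isLink : ∀ {n m} {W : Fin n → Bool} {J : Link n m} → IsLink W J → ∀ lab ℓ → IsLink W (Usable J lab ℓ)
usable-isLink isLink lab ℓ = record
  { flip = λ (l , p) → flip l , p
  ; ends = λ (l , _) (l′ , _) → ends l l′
  ; live = λ (l , _) → live l }
  where open IsLink isLink

-- Every vertex x other than r is placed on one time axis twice, at α x < β x.  The edges
-- labelled F or O carry two trees that run back in α-time, those labelled B or O two trees
-- that run forward in β-time.
record Decomposition {n m} (W : Fin n → Bool) (r : Fin n) (J : Link n m) : Set where
  field
    α β    : Fin n → ℤ
    lab    : Fin m → Label
    α<β    : ∀ {x} → W x ≡ true → α x ℤ.< β x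
    oneway : ∀ {g a b} → J g a b → lab g ≡ O → β a ℤ.< α b ⊎ β b ℤ.< α a
    fwd    : TwoExits W r α (Usable J lab B)
    bwd    : TwoExits W r (λ u → ℤ.- β u) (Usable J lab F)

swapFB : Label → Label
swapFB F = B
swapFB B = F
swapFB O = O

swapFB-≢B : ∀ {ℓ} → ℓ ≢ F → swapFB ℓ ≢ B
swapFB-≢B {F} p _ = p refl
swapFB-≢F : ∀ {ℓ} → ℓ ≢ B → swapFB ℓ ≢ F
swapFB-≢F {B} p _ = p refl
swapFB-O : ∀ {ℓ} → swapFB ℓ ≡ O → ℓ ≡ O
swapFB-O {O} _ = refl

exits-mono : ∀ {n m} {W : Fin n → Bool} {r} {κ κ′ : Fin n → ℤ} {L L′ : Link n m} →
  (∀ u → κ u ≡ κ′ u) → (∀ {g a b} → L g a b → L′ g a b) → TwoExits W r κ L → TwoExits W r κ′ L′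
exits-mono {κ = κ} {κ′} κ≡ L⊆ exits Y t y y∈ Y⊆ g₀
  with exits Y t y y∈ (λ z z∈ → let (w , z≢ , k) = Y⊆ z z∈ in w , z≢ , trans (κ≡ z) k) g₀
... | exit {to = u} g≢ l a∈ b∉ κb = exit g≢ (L⊆ l) a∈ b∉ (subst (ℤ._≤ t) (κ≡ u) κb)

-- Reversal of time; it reduces the cases with a backward edge to those with a forward edge.
dual : ∀ {n m} {W : Fin n → Bool} {r} {J : Link n m} → Decomposition W r J → Decomposition W r J
dual D = record
  { α = λ u → ℤ.- β u ; β = λ u → ℤ.- α u ; lab = λ g → swapFB (lab g)
  ; α<β = λ w → ℤ.neg-mono-< (α<β w)
  ; oneway = λ l p → case oneway l (swapFB-O p) of λ
      { (inj₁ q) → inj₂ (ℤ.neg-mono-< q) ; (inj₂ q) → inj₁ (ℤ.neg-mono-< q) }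
  ; fwd = exits-mono (λ _ → refl) (λ (l , p) → l , swapFB-≢B p) bwd
  ; bwd = exits-mono (λ u → sym (ℤ.neg-involutive (α u))) (λ (l , p) → l , swapFB-≢F p) fwd }
  where open Decomposition D

partner : Fin 4 → Fin 4
partner 0F = 1F
partner 1F = 0F
partner 2F = 3F
partner 3F = 2F

-- J arises from J′ by pinching the edges hub 0F = hub 1F and hub 2F = hub 3F at the new
-- vertex v: the half of hub i at tip i becomes spoke i.
record Pinch {n m} (W′ W : Fin n → Bool) (r : Fin n) (J′ J : Link n m) : Set where
  field
    isLink′     : IsLink W′ J′
    isLink      : IsLink W J
    v           : Fin n
    v∉W′        : W′ v ≡ false
    v∈W         : W v ≡ true
    v≢r         : v ≢ r
    same        : ∀ {u} → u ≢ v → W u ≡ W′ u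
    spoke hub   : Fin 4 → Fin m
    tip         : Fin 4 → Fin n
    spoke-inj   : ∀ {i j} → spoke i ≡ spoke j → i ≡ j
    spokes      : ∀ i → J (spoke i) v (tip i)
    hubs        : ∀ i → J′ (hub i) (tip i) (tip (partner i))
    hub-partner : ∀ i → hub (partner i) ≡ hub i
    hub≢        : hub 0F ≢ hub 2F
    lift        : ∀ {g a b} → J′ g a b →
                  (∃ λ i → g ≡ hub i × a ≡ tip i × b ≡ tip (partner i)) ⊎ ((∀ i → g ≢ spoke i) × J g a b)
    drop        : ∀ {g a b} → J g a b → (∃ λ i → g ≡ spoke i) ⊎ ((∀ i → g ≢ spoke i) × J′ g a b)

TwoOf : (Fin 4 → Set) → Set
TwoOf Q = ∃ λ i → ∃ λ j → i ≢ j × Q i × Q j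

locate : ∀ {k m} (e : Fin k → Fin m) g → (∃ λ i → g ≡ e i) ⊎ (∀ i → g ≢ e i)
locate e g with Fin.any? (λ i → g Fin.≟ e i)
... | yes p = inj₁ p
... | no ¬p = inj₂ λ i eq → ¬p (i , eq)

module Pinching {n m} {W′ W : Fin n → Bool} {r : Fin n} {J′ J : Link n m} (P : Pinch W′ W r J′ J) where
  open Pinch P
  module J = IsLink isLink
  module J′ = IsLink isLink′

  tip∈ : ∀ i → W′ (tip i) ≡ true
  tip∈ i = J′.live (J′.flip (hubs i))

  old≢v : ∀ {u} → W′ u ≡ true → u ≢ v
  old≢v w refl = clash w v∉W′

  tip≢v : ∀ i → tip i ≢ v
  tip≢v i = old≢v (tip∈ i)

  spokeOf : ∀ g → (∃ λ i → g ≡ spoke i) ⊎ (∀ i → g ≢ spoke i)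
  spokeOf = locate spoke

  -- What a pinched edge needs to remain an exit. A set without `v` leaves along the spoke of its
  -- own tip; a set with `v`, which then has the same level, leaves along the spoke of the other
  -- tip.
  Passage : (κ κ₁ : Fin n → ℤ) (L′ : Link n m) (Up : Fin 4 → Set) → Fin 4 → Set
  Passage κ κ₁ L′ Up i = L′ (hub i) (tip i) (tip (partner i)) → κ (tip (partner i)) ℤ.≤ κ (tip i) →
    Up i × κ₁ v ℤ.≤ κ₁ (tip i) × (κ₁ v ≡ κ₁ (tip i) → Up (partner i))

  -- Removing `v` from a level set of the new graph gives a level set of the old one, because old
  -- vertices keep their order and their levels. If nothing remains, the two spokes of `v` itself
  -- are the exits.
  transfer : ∀ {κ κ₁ : Fin n → ℤ} {L′ L : Link n m} →
    (∀ {g a b} → L′ g a b → J′ g a b) →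
    (∀ {g a b} → (∀ i → g ≢ spoke i) → J g a b → L′ g a b → L g a b) →
    (∀ {g a b} → L g a b → L g b a) →
    (∀ {u w} → u ≢ v → w ≢ v → κ u ℤ.≤ κ w → κ₁ u ℤ.≤ κ₁ w) →
    (∀ {u w} → u ≢ v → w ≢ v → κ₁ u ≡ κ₁ w → κ u ≡ κ w) →
    (∀ i → Passage κ κ₁ L′ (λ i → L (spoke i) v (tip i)) i) →
    TwoOf (λ i → L (spoke i) v (tip i) × κ₁ (tip i) ℤ.≤ κ₁ v) →
    TwoExits W′ r κ L′ → TwoExits W r κ₁ L
  transfer {κ} {κ₁} {L′} {L} L′⊆J′ L′⊆L L-flip mono reflects pass (i₁ , i₂ , i₁≢i₂ , up₁ , up₂) exits Y t y₀ y₀∈ Y⊆ g₀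
    with find (λ u → Y u ∧ not (u == v))
  ... | inj₁ none = alone (y₀ Fin.≟ v)
    where
    only-v : ∀ {u} → u ≢ v → Y u ≡ false
    only-v {u} u≢v with split (Y u)
    ... | inj₂ o = o
    ... | inj₁ i = clash (∧-intro i (cong not (==-≢ u≢v))) (none u)
    via : ∀ k → L (spoke k) v (tip k) × κ₁ (tip k) ℤ.≤ κ₁ v → Y v ≡ true → spoke k ≢ g₀ → Exit κ₁ L Y t g₀
    via k (l , le) v∈ ≢g₀ = exit ≢g₀ l v∈ (only-v (tip≢v k))
      (subst (κ₁ (tip k) ℤ.≤_) (proj₂ (proj₂ (Y⊆ v v∈))) le)
    alone : Dec (y₀ ≡ v) → Exit κ₁ L Y t g₀
    alone (no y₀≢v) = clash y₀∈ (only-v y₀≢v)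
    alone (yes refl) with spoke i₁ Fin.≟ g₀
    ... | no ≢g₀ = via i₁ up₁ y₀∈ ≢g₀
    ... | yes refl = via i₂ up₂ y₀∈ (λ eq → i₁≢i₂ (sym (spoke-inj eq)))
  ... | inj₂ (y₁ , p₁) = continue
    (exits Y₀ (κ y₁) y₁ p₁ (λ y p → let (y∈ , y≢v) = member p ; (w , y≢r , k) = Y⊆ y y∈ in
       trans (sym (same y≢v)) w , y≢r ,
       reflects y≢v (proj₂ (member p₁)) (trans k (sym (proj₂ (proj₂ (Y⊆ y₁ (proj₁ (member p₁)))))))) h)
    where
    Y₀ : Fin n → Bool
    Y₀ u = Y u ∧ not (u == v)
    member : ∀ {u} → Y₀ u ≡ true → Y u ≡ true × u ≢ v
    member {u} p = let (i , q) = ∧-elim p in i , λ { refl → clash (==-refl u) (not-true q) }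
    -- A forbidden spoke is translated into its whole hub, so an exit through another hub uses
    -- neither half of the forbidden one.
    h : Fin m
    h with spokeOf g₀
    ... | inj₁ (i , _) = hub i
    ... | inj₂ _ = g₀
    h-hub : ∀ {k} → g₀ ≡ spoke k → h ≡ hub k
    h-hub {k} eq with spokeOf g₀
    ... | inj₁ (i , eq′) = cong hub (spoke-inj (trans (sym eq′) eq))
    ... | inj₂ ns = contradiction eq (ns k)
    h-other : ∀ {g} → (∀ i → g ≢ spoke i) → g ≢ h → g ≢ g₀
    h-other ns g≢h refl with spokeOf g₀
    ... | inj₁ (i , eq) = ns i eq
    ... | inj₂ _ = g≢h refl
    continue : Exit κ L′ Y₀ (κ y₁) h → Exit κ₁ L Y t g₀
    continue (exit {g} {a} {b} g≢h l a∈₀ b∉₀ κb) = go (lift (L′⊆J′ l))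
      where
      a∈ = proj₁ (member a∈₀)
      a≢v = proj₂ (member a∈₀)
      b≢v : b ≢ v
      b≢v = old≢v (J′.live (L′⊆J′ l))
      b∉ : Y b ≡ false
      b∉ with split (Y b)
      ... | inj₂ o = o
      ... | inj₁ i = clash (∧-intro i (cong not (==-≢ b≢v))) b∉₀
      κ₁a : κ₁ a ≡ t
      κ₁a = proj₂ (proj₂ (Y⊆ a a∈))
      κa : κ a ≡ κ y₁
      κa = reflects a≢v (proj₂ (member p₁)) (trans κ₁a (sym (proj₂ (proj₂ (Y⊆ y₁ (proj₁ (member p₁)))))))
      κb≤κa : κ b ℤ.≤ κ a
      κb≤κa = subst (κ b ℤ.≤_) (sym κa) κb
      κ₁b : κ₁ b ℤ.≤ t
      κ₁b = subst (κ₁ b ℤ.≤_) κ₁a (mono b≢v a≢v κb≤κa)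
      go : (∃ λ i → g ≡ hub i × a ≡ tip i × b ≡ tip (partner i)) ⊎ ((∀ i → g ≢ spoke i) × J g a b) →
           Exit κ₁ L Y t g₀
      go (inj₂ (ns , j)) = exit (h-other ns g≢h) (L′⊆L ns j l) a∈ b∉ κ₁b
      go (inj₁ (k , refl , refl , refl)) with pass k l κb≤κa | split (Y v)
      ... | up-k , le , _ | inj₂ v∉ =
        exit (λ eq → g≢h (sym (h-hub (sym eq)))) (L-flip up-k) a∈ v∉ (subst (κ₁ v ℤ.≤_) κ₁a le)
      ... | up-k , le , up-pk | inj₁ v∈ =
        exit (λ eq → g≢h (sym (trans (h-hub (sym eq)) (hub-partner k))))
             (up-pk (trans (proj₂ (proj₂ (Y⊆ v v∈))) (sym κ₁a))) v∈ b∉ κ₁b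

module Placing {n m} {W′ W : Fin n → Bool} {r : Fin n} {J′ J : Link n m} (P : Pinch W′ W r J′ J)
  (D : Decomposition W′ r J′) where
  open Pinch P
  open Pinching P
  open Decomposition D

  relabel : (Fin 4 → Label) → Fin m → Label
  relabel l g with spokeOf g
  ... | inj₁ (i , _) = l i
  ... | inj₂ _       = lab g

  relabel-spoke : ∀ l i → relabel l (spoke i) ≡ l i
  relabel-spoke l i with spokeOf (spoke i)
  ... | inj₁ (j , eq) = cong l (sym (spoke-inj eq))
  ... | inj₂ ns       = contradiction refl (ns i)

  relabel-other : ∀ l {g} → (∀ i → g ≢ spoke i) → relabel l g ≡ lab g
  relabel-other l {g} ns with spokeOf g
  ... | inj₁ (i , eq) = contradiction eq (ns i)
  ... | inj₂ _        = refl

  insert : ℕ → (Fin n → ℤ) → ℤ → Fin n → ℤ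
  insert k κ x u = if u == v then x else at (κ u) k

  insert-v : ∀ k κ x → insert k κ x v ≡ x
  insert-v k κ x = if-true (==-refl v)

  insert-old : ∀ k κ x {u} → u ≢ v → insert k κ x u ≡ at (κ u) k
  insert-old k κ x u≢v = if-false (==-≢ u≢v)

  insert-mono : ∀ k κ x {u w} → u ≢ v → w ≢ v → κ u ℤ.≤ κ w → insert k κ x u ℤ.≤ insert k κ x w
  insert-mono k κ x u≢v w≢v le =
    subst₂ ℤ._≤_ (sym (insert-old k κ x u≢v)) (sym (insert-old k κ x w≢v)) (at-≤ˡ k le)

  insert-reflects : ∀ k κ x {u w} → u ≢ v → w ≢ v → insert k κ x u ≡ insert k κ x w → κ u ≡ κ w
  insert-reflects k κ x u≢v w≢v eq =
    at-injective {j = k} (trans (sym (insert-old k κ x u≢v)) (trans eq (insert-old k κ x w≢v)))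

  -- All of `α₁` is a parameter because splitting a level also moves old vertices; on the `β` side
  -- only `v` is inserted.
  module Place (α₁ : Fin n → ℤ) (B₁ : ℤ) (forward : Fin 4 → Bool) where

    A : ℤ
    A = α₁ v

    β₁ : Fin n → ℤ
    β₁ = insert 4 β B₁

    pick : ∀ {X Y : Set} → Bool → Dec X → Dec Y → Label
    pick true  d _ = if does d then O else F
    pick false _ d = if does d then O else B

    -- v uses spoke i in its forward trees if forward i holds and in its backward trees
    -- otherwise; the label O lets tip i use the spoke in the other direction where possible.
    l : Fin 4 → Label
    l i = pick (forward i) (at (β (tip i)) 4 ℤ.<? A) (B₁ ℤ.<? α₁ (tip i))

    lab₁ : Fin m → Label
    lab₁ = relabel l

    Fw Bw : Fin 4 → Set
    Fw i = forward i ≡ true ⊎ B₁ ℤ.< α₁ (tip i)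
    Bw i = forward i ≡ false ⊎ at (β (tip i)) 4 ℤ.< A

    l≢B : ∀ i → Fw i → l i ≢ B
    l≢B i fw eq with forward i | fw | at (β (tip i)) 4 ℤ.<? A | B₁ ℤ.<? α₁ (tip i)
    l≢B i fw () | true  | _       | yes _ | _
    l≢B i fw () | true  | _       | no _  | _
    l≢B i fw () | false | _       | _     | yes _
    l≢B i fw eq | false | inj₂ lt | _     | no ¬lt = ¬lt lt

    l≢F : ∀ i → Bw i → l i ≢ F
    l≢F i bw eq with forward i | bw | at (β (tip i)) 4 ℤ.<? A | B₁ ℤ.<? α₁ (tip i)
    l≢F i bw () | false | _       | _      | yes _
    l≢F i bw () | false | _       | _      | no _
    l≢F i bw () | true  | _       | yes _  | _
    l≢F i bw eq | true  | inj₂ lt | no ¬lt | _ = ¬lt lt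

    l-O : ∀ i → l i ≡ O → at (β (tip i)) 4 ℤ.< A ⊎ B₁ ℤ.< α₁ (tip i)
    l-O i eq with forward i | at (β (tip i)) 4 ℤ.<? A | B₁ ℤ.<? α₁ (tip i)
    l-O i eq | true  | yes lt | _      = inj₁ lt
    l-O i () | true  | no _   | _
    l-O i eq | false | _      | yes lt = inj₂ lt
    l-O i () | false | _      | no _

    usableF : ∀ i → Fw i → Usable J lab₁ B (spoke i) v (tip i)
    usableF i fw = spokes i , λ eq → l≢B i fw (trans (sym (relabel-spoke l i)) eq)

    usableB : ∀ i → Bw i → Usable J lab₁ F (spoke i) v (tip i)
    usableB i bw = spokes i , λ eq → l≢F i bw (trans (sym (relabel-spoke l i)) eq)

    keep : ∀ ℓ {g a b} → (∀ i → g ≢ spoke i) → J g a b → Usable J′ lab ℓ g a b → Usable J lab₁ ℓ g a b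
    keep ℓ ns j (_ , ≢ℓ) = j , λ eq → ≢ℓ (trans (sym (relabel-other l ns)) eq)

    -- `lo` preserves the gaps of one-way edges and `hi` the inequality between `α` and `β`. Both
    -- allow an old `α` to be moved within slots 0 to 3.
    module _ (A<B₁ : A ℤ.< B₁)
      (lo : ∀ {u} → u ≢ v → at (α u) 0 ℤ.≤ α₁ u)
      (hi : ∀ {u} → u ≢ v → α u ℤ.< β u → α₁ u ℤ.< at (β u) 4) where

      private
        β₁v : β₁ v ≡ B₁
        β₁v = insert-v 4 β B₁

        β₁-old : ∀ {u} → u ≢ v → β₁ u ≡ at (β u) 4
        β₁-old = insert-old 4 β B₁

        α<β₁ : ∀ {x} → W x ≡ true → α₁ x ℤ.< β₁ x
        α<β₁ {x} w = by-cases (x Fin.≟ v)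
          where
          by-cases : Dec (x ≡ v) → α₁ x ℤ.< β₁ x
          by-cases (yes refl) = subst (A ℤ.<_) (sym β₁v) A<B₁
          by-cases (no x≢v) = subst (α₁ x ℤ.<_) (sym (β₁-old x≢v)) (hi x≢v (α<β (trans (sym (same x≢v)) w)))

        apart : ∀ {a b} → a ≢ v → b ≢ v → β a ℤ.< α b → β₁ a ℤ.< α₁ b
        apart {a} {b} a≢v b≢v lt = subst (ℤ._< α₁ b) (sym (β₁-old a≢v))
          (ℤ.<-≤-trans (at-< 0 lt (s≤s (s≤s (s≤s (s≤s (s≤s z≤n)))))) (lo b≢v))

        oneway₁ : ∀ {g a b} → J g a b → lab₁ g ≡ O → β₁ a ℤ.< α₁ b ⊎ β₁ b ℤ.< α₁ a
        oneway₁ {g} {a} {b} j g-O with drop j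
        ... | inj₂ (ns , j′) with oneway j′ (trans (sym (relabel-other l ns)) g-O)
        ... | inj₁ lt = inj₁ (apart (old≢v (J′.live (J′.flip j′))) (old≢v (J′.live j′)) lt)
        ... | inj₂ lt = inj₂ (apart (old≢v (J′.live j′)) (old≢v (J′.live (J′.flip j′))) lt)
        oneway₁ {g} {a} {b} j g-O | inj₁ (i , refl) with J.ends j (spokes i) | l-O i (trans (sym (relabel-spoke l i)) g-O)
        ... | inj₁ (refl , refl) | inj₁ lt = inj₂ (subst (ℤ._< A) (sym (β₁-old (tip≢v i))) lt)
        ... | inj₁ (refl , refl) | inj₂ lt = inj₁ (subst (ℤ._< α₁ b) (sym β₁v) lt)
        ... | inj₂ (refl , refl) | inj₁ lt = inj₁ (subst (ℤ._< A) (sym (β₁-old (tip≢v i))) lt)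
        ... | inj₂ (refl , refl) | inj₂ lt = inj₂ (subst (ℤ._< α₁ a) (sym β₁v) lt)

      assemble : TwoExits W r α₁ (Usable J lab₁ B) → TwoExits W r (λ u → ℤ.- β₁ u) (Usable J lab₁ F) →
                 Decomposition W r J
      assemble fwd₁ bwd₁ = record
        { α = α₁ ; β = β₁ ; lab = lab₁ ; α<β = α<β₁ ; oneway = oneway₁ ; fwd = fwd₁ ; bwd = bwd₁ }

    PassB : Fin m → Fin 4 → Fin 4 → Set
    PassB g i j = lab g ≢ F → β (tip i) ℤ.≤ β (tip j) →
      Bw i × at (β (tip i)) 4 ℤ.≤ B₁ × (B₁ ≡ at (β (tip i)) 4 → Bw j)

    backward : (∀ i → PassB (hub i) i (partner i)) → TwoOf (λ i → Bw i × B₁ ℤ.≤ at (β (tip i)) 4) →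
               TwoExits W r (λ u → ℤ.- β₁ u) (Usable J lab₁ F)
    backward pass (i , j , i≢j , (bi , lei) , (bj , lej)) = transfer proj₁ (keep F)
      (λ (e , q) → J.flip e , q)
      (λ u≢v w≢v le → ℤ.neg-mono-≤ (insert-mono 4 β B₁ w≢v u≢v (ℤ.neg-cancel-≤ le)))
      (λ u≢v w≢v eq → cong ℤ.-_ (insert-reflects 4 β B₁ u≢v w≢v (ℤ.neg-injective eq)))
      (λ k (_ , nF) le → let (b , le′ , b′) = pass k nF (ℤ.neg-cancel-≤ le) in
         usableB k b ,
         ℤ.neg-mono-≤ (subst₂ ℤ._≤_ (sym (β₁-tip k)) (sym β₁v) le′) ,
         λ eq → usableB (partner k) (b′ (trans (sym β₁v) (trans (ℤ.neg-injective eq) (β₁-tip k)))))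
      (i , j , i≢j , (usableB i bi , own i lei) , (usableB j bj , own j lej)) bwd
      where
      β₁v : β₁ v ≡ B₁
      β₁v = insert-v 4 β B₁
      β₁-tip : ∀ k → β₁ (tip k) ≡ at (β (tip k)) 4
      β₁-tip k = insert-old 4 β B₁ (tip≢v k)
      own : ∀ k → B₁ ℤ.≤ at (β (tip k)) 4 → ℤ.- β₁ (tip k) ℤ.≤ ℤ.- β₁ v
      own k le = ℤ.neg-mono-≤ (subst₂ ℤ._≤_ (sym β₁v) (sym (β₁-tip k)) le)

  module Simple (A B₁ : ℤ) (forward : Fin 4 → Bool) (A<B₁ : A ℤ.< B₁) where
    α₁ : Fin n → ℤ
    α₁ = insert 0 α A

    open Place α₁ B₁ forward hiding (A; Fw; Bw)

    Fw Bw : Fin 4 → Set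
    Fw i = forward i ≡ true ⊎ B₁ ℤ.< at (α (tip i)) 0
    Bw i = forward i ≡ false ⊎ at (β (tip i)) 4 ℤ.< A

    PassF PassB′ : Fin m → Fin 4 → Fin 4 → Set
    PassF g i j = lab g ≢ B → α (tip j) ℤ.≤ α (tip i) →
      Fw i × A ℤ.≤ at (α (tip i)) 0 × (A ≡ at (α (tip i)) 0 → Fw j)
    PassB′ g i j = lab g ≢ F → β (tip i) ℤ.≤ β (tip j) →
      Bw i × at (β (tip i)) 4 ℤ.≤ B₁ × (B₁ ≡ at (β (tip i)) 4 → Bw j)

    Passes : Fin m → Fin 4 → Fin 4 → Set
    Passes g i j = PassF g i j × PassF g j i × PassB′ g i j × PassB′ g j i

    private
      α₁v : α₁ v ≡ A
      α₁v = insert-v 0 α A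
      α₁-tip : ∀ k → α₁ (tip k) ≡ at (α (tip k)) 0
      α₁-tip k = insert-old 0 α A (tip≢v k)
      toFw : ∀ {i} → Fw i → Place.Fw α₁ B₁ forward i
      toFw (inj₁ p)      = inj₁ p
      toFw {i} (inj₂ lt) = inj₂ (subst (B₁ ℤ.<_) (sym (α₁-tip i)) lt)
      toBw : ∀ {i} → Bw i → Place.Bw α₁ B₁ forward i
      toBw (inj₁ p)      = inj₁ p
      toBw {i} (inj₂ lt) = inj₂ (subst (at (β (tip i)) 4 ℤ.<_) (sym α₁v) lt)

    place : Passes (hub 0F) 0F 1F → Passes (hub 2F) 2F 3F →
            TwoOf (λ i → Fw i × at (α (tip i)) 0 ℤ.≤ A) → TwoOf (λ i → Bw i × B₁ ℤ.≤ at (β (tip i)) 4) →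
            Decomposition W r J
    place (f₀ , f₁ , b₀ , b₁) (f₂ , f₃ , b₂ , b₃) (i , j , i≢j , (fi , lei) , (fj , lej))
          (i′ , j′ , i≢j′ , (bi , lei′) , (bj , lej′)) =
      assemble (subst (ℤ._< B₁) (sym α₁v) A<B₁)
        (λ u≢v → ℤ.≤-reflexive (sym (insert-old 0 α A u≢v)))
        (λ u≢v lt → subst (ℤ._< _) (sym (insert-old 0 α A u≢v)) (at-< 4 lt (s≤s z≤n)))
        (transfer proj₁ (keep B) (λ (e , q) → J.flip e , q)
          (insert-mono 0 α A) (insert-reflects 0 α A)
          (λ k (_ , nB) le → let (f , le′ , f′) = passF k nB le in
             usableF k (toFw f) , subst₂ ℤ._≤_ (sym α₁v) (sym (α₁-tip k)) le′ ,
             λ eq → usableF (partner k) (toFw (f′ (trans (sym α₁v) (trans eq (α₁-tip k))))))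
          (i , j , i≢j , (usableF i (toFw fi) , own i lei) , (usableF j (toFw fj) , own j lej)) fwd)
        (backward
          (λ k nF le → let (b , le′ , b′) = passB k nF le in toBw b , le′ , λ eq → toBw (b′ eq))
          (i′ , j′ , i≢j′ , (toBw bi , lei′) , (toBw bj , lej′)))
      where
      own : ∀ k → at (α (tip k)) 0 ℤ.≤ A → α₁ (tip k) ℤ.≤ α₁ v
      own k le = subst₂ ℤ._≤_ (sym (α₁-tip k)) (sym α₁v) le
      passF : ∀ k → PassF (hub k) k (partner k)
      passF 0F = f₀
      passF 1F = subst (λ g → PassF g 1F 0F) (sym (hub-partner 0F)) f₁
      passF 2F = f₂
      passF 3F = subst (λ g → PassF g 3F 2F) (sym (hub-partner 2F)) f₃
      passB : ∀ k → PassB′ (hub k) k (partner k)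
      passB 0F = b₀
      passB 1F = subst (λ g → PassB′ g 1F 0F) (sym (hub-partner 0F)) b₁
      passB 2F = b₂
      passB 3F = subst (λ g → PassB′ g 3F 2F) (sym (hub-partner 2F)) b₃

    module _ {g : Fin m} {i j : Fin 4}
      (ordα : lab g ≢ B → α (tip i) ℤ.≤ α (tip j)) (ordβ : lab g ≢ F → β (tip i) ℤ.≤ β (tip j)) where

      -- A forward exit over the hub starts at the later tip `j`, so `v` must not come after `j`. If
      -- the hub also serves backward exits, these start at `i`, and `i` ends before `v` begins:
      -- spoke `i` is one-way and `v` itself is the exit, so nothing is asked of spoke `j`.
      both-forward : forward i ≡ true → forward j ≡ true →
        (lab g ≢ B → A ℤ.≤ at (α (tip j)) 0) → (lab g ≢ F → at (β (tip i)) 4 ℤ.< A) → Passes g i j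
      both-forward fi fj cα cβ =
        (λ nB le → inj₁ fi , ℤ.≤-trans (cα nB) (at-≤ˡ 0 le) , λ _ → inj₁ fj) ,
        (λ nB le → inj₁ fj , cα nB , λ _ → inj₁ fi) ,
        (λ nF le → let lt = cβ nF in
          inj₂ lt , ℤ.<⇒≤ (ℤ.<-trans lt A<B₁) , λ eq → contradiction (sym eq) (ℤ.<⇒≢ (ℤ.<-trans lt A<B₁))) ,
        (λ nF le → let lt = ℤ.≤-<-trans (at-≤ˡ 4 le) (cβ nF) in
          inj₂ lt , ℤ.<⇒≤ (ℤ.<-trans lt A<B₁) , λ eq → contradiction (sym eq) (ℤ.<⇒≢ (ℤ.<-trans lt A<B₁)))

      -- The mirror image in time of `both-forward`.
      both-backward : forward i ≡ false → forward j ≡ false →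
        (lab g ≢ B → B₁ ℤ.< at (α (tip j)) 0) → (lab g ≢ F → at (β (tip i)) 4 ℤ.≤ B₁) → Passes g i j
      both-backward fi fj cα cβ =
        (λ nB le → let lt = ℤ.<-≤-trans (cα nB) (at-≤ˡ 0 le) in
          inj₂ lt , ℤ.<⇒≤ (ℤ.<-trans A<B₁ lt) , λ eq → contradiction eq (ℤ.<⇒≢ (ℤ.<-trans A<B₁ lt))) ,
        (λ nB le → let lt = cα nB in
          inj₂ lt , ℤ.<⇒≤ (ℤ.<-trans A<B₁ lt) , λ eq → contradiction eq (ℤ.<⇒≢ (ℤ.<-trans A<B₁ lt))) ,
        (λ nF le → inj₁ fi , cβ nF , λ _ → inj₁ fj) ,
        (λ nF le → inj₁ fj , ℤ.≤-trans (at-≤ˡ 4 le) (cβ nF) , λ _ → inj₁ fi)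

      -- Meant for one-way hubs: `v` is put into the gap between the intervals of the two tips, and
      -- both spokes become one-way.
      forward-backward : forward i ≡ true → forward j ≡ false →
        (lab g ≢ B → B₁ ℤ.< at (α (tip j)) 0) → (lab g ≢ F → at (β (tip i)) 4 ℤ.< A) → Passes g i j
      forward-backward fi fj cα cβ =
        (λ nB le → let lt = ℤ.<-trans A<B₁ (ℤ.<-≤-trans (cα nB) (at-≤ˡ 0 le)) in
          inj₁ fi , ℤ.<⇒≤ lt , λ eq → contradiction eq (ℤ.<⇒≢ lt)) ,
        (λ nB le → let lt = ℤ.<-trans A<B₁ (cα nB) in
          inj₂ (cα nB) , ℤ.<⇒≤ lt , λ eq → contradiction eq (ℤ.<⇒≢ lt)) ,
        (λ nF le → let lt = ℤ.<-trans (cβ nF) A<B₁ in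
          inj₂ (cβ nF) , ℤ.<⇒≤ lt , λ eq → contradiction (sym eq) (ℤ.<⇒≢ lt)) ,
        (λ nF le → let lt = ℤ.<-trans (ℤ.≤-<-trans (at-≤ˡ 4 le) (cβ nF)) A<B₁ in
          inj₁ fj , ℤ.<⇒≤ lt , λ eq → contradiction (sym eq) (ℤ.<⇒≢ lt))

-- Positions of the two pinched edges in time

data Kind (ℓ : Label) (a b : ℤ) : Set where
  fw : ℓ ≡ F → a ℤ.≤ b → Kind ℓ a b
  bw : ℓ ≡ B → a ℤ.≤ b → Kind ℓ a b
  ow : ℓ ≡ O → b ℤ.< a → Kind ℓ a b

-- `x` is the earlier end in each order in which the edge may be used. In `kind` the later end's
-- start is compared with the earlier end's finish: edges across a gap are one-way, and `F` or `B`
-- is left for overlapping intervals.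
record Oriented {n} (α β : Fin n → ℤ) (ℓ : Label) (x y : Fin n) : Set where
  field
    ordα : ℓ ≢ B → α x ℤ.≤ α y
    ordβ : ℓ ≢ F → β x ℤ.≤ β y
    kind : Kind ℓ (α y) (β x)

at-gap : ∀ {a b j} → a ℤ.< b → j ℕ.< 8 → at a j ℤ.< at b 0
at-gap = at-< 0

private
  6<8 : 6 ℕ.< 8
  6<8 = ℕ.m≤m+n 7 1
  4<8 : 4 ℕ.< 8
  4<8 = ℕ.m≤m+n 5 3
  2<8 : 2 ℕ.< 8
  2<8 = ℕ.m≤m+n 3 5

module Cases {n m} {W′ W : Fin n → Bool} {r : Fin n} {J′ J : Link n m} (P : Pinch W′ W r J′ J)
  (D : Decomposition W′ r J′)
  (e-oriented : Oriented (Decomposition.α D) (Decomposition.β D) (Decomposition.lab D (Pinch.hub P 0F))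
                         (Pinch.tip P 0F) (Pinch.tip P 1F))
  (f-oriented : Oriented (Decomposition.α D) (Decomposition.β D) (Decomposition.lab D (Pinch.hub P 2F))
                         (Pinch.tip P 2F) (Pinch.tip P 3F)) where
  open Pinch P
  open Pinching P
  open Placing P D
  open Decomposition D
  module E = Oriented e-oriented
  module F = Oriented f-oriented

  e f : Label
  e = lab (hub 0F)
  f = lab (hub 2F)

  a b a′ b′ : ℤ
  a  = α (tip 1F)
  b  = β (tip 0F)
  a′ = α (tip 3F)
  b′ = β (tip 2F)

  α<β-tip : ∀ i → α (tip i) ℤ.< β (tip i)
  α<β-tip i = α<β (tip∈ i)

  front back mixed : Fin 4 → Bool
  front 0F = true
  front 1F = true
  front _  = false
  back i = not (front i)
  mixed 0F = true
  mixed 2F = true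
  mixed _  = false

  ≡⇒≢ : ∀ {ℓ ℓ′ : Label} → ℓ ≡ ℓ′ → ∀ {ℓ″} → ℓ′ ≢ ℓ″ → ℓ ≢ ℓ″
  ≡⇒≢ refl p = p

  F≢B : F ≢ B
  F≢B ()
  O≢B : O ≢ B
  O≢B ()
  O≢F : O ≢ F
  O≢F ()
  B≢F : B ≢ F
  B≢F ()

  -- `v` starts together with the later end of the first hub and finishes together with the earlier
  -- end of the second; `a ≤ b′` makes this an interval.
  e-first : e ≢ B → (e ≢ F → b ℤ.< a) → f ≢ F → (f ≢ B → b′ ℤ.< a′) → a ℤ.≤ b′ → Decomposition W r J
  e-first e≢B e-ow f≢F f-ow a≤b′ = place
    (both-forward E.ordα E.ordβ refl refl (λ _ → ℤ.≤-refl) (λ nF → at-gap (e-ow nF) 4<8))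
    (both-backward F.ordα F.ordβ refl refl (λ nB → at-gap (f-ow nB) 4<8) (λ _ → ℤ.≤-refl))
    (0F , 1F , (λ ()) , (inj₁ refl , at-≤ˡ 0 (E.ordα e≢B)) , (inj₁ refl , ℤ.≤-refl))
    (2F , 3F , (λ ()) , (inj₁ refl , ℤ.≤-refl) , (inj₁ refl , at-≤ˡ 4 (F.ordβ f≢F)))
    where
    open Simple (at a 0) (at b′ 4) front (at-≤< a≤b′ (s≤s z≤n))

  -- `v` lives briefly at `a′` and is over before `a`. So spoke 1 becomes one-way and still carries
  -- the forward exits of the first hub, although both spokes of that hub are given to the backward
  -- trees.
  f-first : e ≡ F → a ℤ.≤ b → f ≢ B → (f ≢ F → b′ ℤ.< a′) → a′ ℤ.< a → Decomposition W r J
  f-first e≡F a≤b f≢B f-ow a′<a = place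
    (both-backward E.ordα E.ordβ refl refl (λ _ → at-gap a′<a (s≤s (s≤s z≤n))) (λ nF → contradiction e≡F nF))
    (both-forward F.ordα F.ordβ refl refl (λ _ → ℤ.≤-refl) (λ nF → at-gap (f-ow nF) 4<8))
    (2F , 3F , (λ ()) , (inj₁ refl , at-≤ˡ 0 (F.ordα f≢B)) , (inj₁ refl , ℤ.≤-refl))
    (0F , 1F , (λ ()) , (inj₁ refl , after (ℤ.<-≤-trans a′<a a≤b)) , (inj₁ refl , after (ℤ.<-trans a′<a (α<β-tip 1F))))
    where
    open Simple (at a′ 0) (at a′ 1) back (at-<ʳ a′ (s≤s z≤n))
    after : ∀ {t} → a′ ℤ.< t → at a′ 1 ℤ.≤ at t 4
    after lt = ℤ.<⇒≤ (at-< 4 lt (s≤s (s≤s z≤n)))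

  -- `v` fits between the finish `b′` of tip 2 and the start `a` of tip 1. Spokes 2 and 1 become
  -- one-way and carry the old backward and forward exits respectively.
  f-then-e : e ≡ F → a ℤ.≤ b → f ≡ B → a′ ℤ.≤ b′ → b′ ℤ.< a → Decomposition W r J
  f-then-e e≡F a≤b f≡B a′≤b′ b′<a = place
    (both-backward E.ordα E.ordβ refl refl (λ _ → at-gap b′<a 6<8) (λ nF → contradiction e≡F nF))
    (both-forward F.ordα F.ordβ refl refl (λ nB → contradiction f≡B nB) (λ _ → at-<ʳ b′ (ℕ.n<1+n 4)))
    (2F , 3F , (λ ()) , (inj₁ refl , before (ℤ.<⇒≤ (α<β-tip 2F))) , (inj₁ refl , before a′≤b′))
    (0F , 1F , (λ ()) , (inj₁ refl , after (ℤ.<-≤-trans b′<a a≤b)) , (inj₁ refl , after (ℤ.<-trans b′<a (α<β-tip 1F))))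
    where
    open Simple (at b′ 5) (at b′ 6) back (at-<ʳ b′ (ℕ.n<1+n 5))
    before : ∀ {t} → t ℤ.≤ b′ → at t 0 ℤ.≤ at b′ 5
    before le = ℤ.<⇒≤ (at-≤< le (s≤s z≤n))
    after : ∀ {t} → b′ ℤ.< t → at b′ 6 ℤ.≤ at t 4
    after lt = ℤ.<⇒≤ (at-< 4 lt 6<8)

  -- The instant `c` lies in the gaps of both hubs, so all four spokes can be one-way.
  straddle : e ≡ O → f ≡ O → ∀ c → b ℤ.≤ c → b′ ℤ.≤ c → c ℤ.< a → c ℤ.< a′ → Decomposition W r J
  straddle e≡O f≡O c b≤c b′≤c c<a c<a′ = place
    (forward-backward E.ordα E.ordβ refl refl (λ _ → at-gap c<a 6<8) (λ _ → at-≤< b≤c (ℕ.n<1+n 4)))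
    (forward-backward F.ordα F.ordβ refl refl (λ _ → at-gap c<a′ 6<8) (λ _ → at-≤< b′≤c (ℕ.n<1+n 4)))
    (0F , 2F , (λ ()) , (inj₁ refl , before (ℤ.≤-trans (ℤ.<⇒≤ (α<β-tip 0F)) b≤c))
                      , (inj₁ refl , before (ℤ.≤-trans (ℤ.<⇒≤ (α<β-tip 2F)) b′≤c)))
    (1F , 3F , (λ ()) , (inj₁ refl , after (ℤ.<-trans c<a (α<β-tip 1F)))
                      , (inj₁ refl , after (ℤ.<-trans c<a′ (α<β-tip 3F))))
    where
    open Simple (at c 5) (at c 6) mixed (at-<ʳ c (ℕ.n<1+n 5))
    before : ∀ {t} → t ℤ.≤ c → at t 0 ℤ.≤ at c 5
    before le = ℤ.<⇒≤ (at-≤< le (s≤s z≤n))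
    after : ∀ {t} → c ℤ.< t → at c 6 ℤ.≤ at t 4
    after lt = ℤ.<⇒≤ (at-< 4 lt 6<8)

  -- v first joins level a, with all four spokes usable.  The ears of that level are then
  -- regrown until v is reached; what is not reached by then moves up to the instant at a 3,
  -- which leaves room for β v = at a 2, and v is left with two spokes for its backward trees.
  module Splitting (e≡F : e ≡ F) (a≤b : a ℤ.≤ b) (f≢B : f ≢ B) (a≤a′ : a ℤ.≤ a′)
    (tail : (f ≡ F × a ≡ a′ × a′ ℤ.≤ b′) ⊎ (f ≡ O × b′ ℤ.< a × b′ ℤ.< a′)) where

    κ₀ : Fin n → ℤ
    κ₀ u = if u == v then a else α u

    κ₀v : κ₀ v ≡ a
    κ₀v = if-true (==-refl v)

    κ₀-old : ∀ {u} → u ≢ v → κ₀ u ≡ α u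
    κ₀-old u≢v = if-false (==-≢ u≢v)

    lab₀ : Fin m → Label
    lab₀ = relabel (λ _ → F)

    L₀ : Link n m
    L₀ = Usable J lab₀ B

    spoke₀ : ∀ i → L₀ (spoke i) v (tip i)
    spoke₀ i = spokes i , λ eq → F≢B (trans (sym (relabel-spoke (λ _ → F) i)) eq)

    exits₀ : TwoExits W r κ₀ L₀
    exits₀ = transfer proj₁
      (λ ns j (_ , nB) → j , λ eq → nB (trans (sym (relabel-other (λ _ → F) ns)) eq))
      (λ (j , q) → J.flip j , q)
      (λ u≢v w≢v → subst₂ ℤ._≤_ (sym (κ₀-old u≢v)) (sym (κ₀-old w≢v)))
      (λ u≢v w≢v eq → trans (sym (κ₀-old u≢v)) (trans eq (κ₀-old w≢v)))
      (λ i _ le → spoke₀ i , subst₂ ℤ._≤_ (sym κ₀v) (sym (κ₀-old (tip≢v i))) (above i le) , λ _ → spoke₀ (partner i))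
      (0F , 1F , (λ ()) , (spoke₀ 0F , own 0F (E.ordα (≡⇒≢ e≡F F≢B))) , (spoke₀ 1F , own 1F ℤ.≤-refl))
      fwd
      where
      own : ∀ i → α (tip i) ℤ.≤ a → κ₀ (tip i) ℤ.≤ κ₀ v
      own i = subst₂ ℤ._≤_ (sym (κ₀-old (tip≢v i))) (sym κ₀v)
      above : ∀ i → α (tip (partner i)) ℤ.≤ α (tip i) → a ℤ.≤ α (tip i)
      above 0F le = le
      above 1F le = ℤ.≤-refl
      above 2F le = ℤ.≤-trans a≤a′ le
      above 3F le = a≤a′

    R : Fin n → Bool
    R u = does (κ₀ u ℤ.<? a) ∨ (u == r)

    R-closed : ∀ {u} → W u ≡ true → κ₀ u ℤ.< a → R u ≡ true
    R-closed {u} _ lt = ∨-introˡ (dec-true (κ₀ u ℤ.<? a) lt)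

    not-R : ∀ {u} → κ₀ u ≡ a → u ≢ r → R u ≡ false
    not-R {u} κu u≢r = trans (cong (_∨ (u == r)) (dec-false (κ₀ u ℤ.<? a) (ℤ.<-irrefl κu))) (==-≢ u≢r)

    open Growth W r κ₀ L₀ (usable-isLink isLink lab₀ B) exits₀ R (∨-introʳ {does (κ₀ r ℤ.<? a)} (==-refl r))

    z-below : b′ ℤ.< a → κ₀ (tip 2F) ℤ.< a
    z-below b′<a = subst (ℤ._< a) (sym (κ₀-old (tip≢v 2F))) (ℤ.<-trans (α<β-tip 2F) b′<a)

    abstract
      via-z : b′ ℤ.< a → Σ (Captured a v) λ c → Captured.Parental c v (spoke 2F)
      via-z b′<a = capture-via R-closed (not-R κ₀v v≢r) κ₀v {spoke 2F} {tip 2F} z-link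
        (R-closed (J.live (spokes 2F)) (z-below b′<a)) (ℤ.<⇒≤ (z-below b′<a))
        where
        z-link : L₀ (spoke 2F) (tip 2F) v
        z-link = J.flip (spokes 2F) , proj₂ (spoke₀ 2F)

      via-any : Captured a v
      via-any = capture R-closed (not-R κ₀v v≢r) κ₀v (spoke 0F) v∈W

    -- If the second hub is one-way, tip 2 is over before level `a` and spoke 2 is useless as one of
    -- the two backward spokes of `v`. It therefore has to be among the parent edges.
    Forced : Captured a v → Set
    Forced c = f ≢ F → Captured.Parental c v (spoke 2F)

    captured-F : f ≡ F → Σ (Captured a v) Forced
    captured-F f≡F = via-any , contradiction f≡F

    captured-O : b′ ℤ.< a → Σ (Captured a v) Forced
    captured-O b′<a = proj₁ (via-z b′<a) , λ _ → proj₂ (via-z b′<a)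

    captured : Σ (Captured a v) Forced
    captured = by tail
      where
      by : (f ≡ F × a ≡ a′ × a′ ℤ.≤ b′) ⊎ (f ≡ O × b′ ℤ.< a × b′ ℤ.< a′) → Σ (Captured a v) Forced
      by (inj₁ (p , _))     = captured-F p
      by (inj₂ (_ , q , _)) = captured-O q

    open Captured (proj₁ captured)

    moved : Fin n → Bool
    moved u = not (S u) ∧ does (κ₀ u ℤ.≟ a)

    moved⇒ : ∀ {u} → moved u ≡ true → S u ≡ false × κ₀ u ≡ a
    moved⇒ {u} p = let (s , q) = ∧-elim {not (S u)} p in not-true s , from-does (κ₀ u ℤ.≟ a) q

    stays : ∀ {u} → S u ≡ true → moved u ≡ false
    stays {u} s with split (moved u)
    ... | inj₁ i = clash s (proj₁ (moved⇒ i))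
    ... | inj₂ o = o

    α₁ : Fin n → ℤ
    α₁ u = if moved u then at a 3 else at (κ₀ u) 0

    α₁v : α₁ v ≡ at a 0
    α₁v = trans (if-false (stays v∈S)) (cong (λ t → at t 0) κ₀v)

    -- These become the forward spokes of `v`. The two trees meet `v` along no others, so at least
    -- two spokes remain for the backward side.
    is-parental : Fin 4 → Bool
    is-parental i = does (spoke i Fin.≟ t₁ v) ∨ does (spoke i Fin.≟ t₂ v)

    is-parental-intro : ∀ {i} → Parental v (spoke i) → is-parental i ≡ true
    is-parental-intro {i} (inj₁ p) = ∨-introˡ (dec-true (spoke i Fin.≟ t₁ v) p)
    is-parental-intro {i} (inj₂ p) = ∨-introʳ (dec-true (spoke i Fin.≟ t₂ v) p)

    is-parental-elim : ∀ {i} → is-parental i ≡ true → Parental v (spoke i)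
    is-parental-elim {i} p with ∨-elim {spoke i == t₁ v} p
    ... | inj₁ q       = inj₁ (==⇒≡ (spoke i) (t₁ v) q)
    ... | inj₂ (_ , q) = inj₂ (==⇒≡ (spoke i) (t₂ v) q)

    at-most-two : ∀ {i j k} → i ≢ j → i ≢ k → j ≢ k →
      is-parental i ≡ true → is-parental j ≡ true → is-parental k ≡ true → ⊥
    at-most-two i≢j i≢k j≢k pi pj pk with is-parental-elim pi | is-parental-elim pj | is-parental-elim pk
    ... | inj₁ p | inj₁ q | _      = i≢j (spoke-inj (trans p (sym q)))
    ... | inj₂ p | inj₂ q | _      = i≢j (spoke-inj (trans p (sym q)))
    ... | inj₁ p | inj₂ _ | inj₁ q = i≢k (spoke-inj (trans p (sym q)))
    ... | inj₂ p | inj₁ _ | inj₂ q = i≢k (spoke-inj (trans p (sym q)))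
    ... | inj₁ _ | inj₂ p | inj₂ q = j≢k (spoke-inj (trans p (sym q)))
    ... | inj₂ _ | inj₁ p | inj₁ q = j≢k (spoke-inj (trans p (sym q)))

    two-left : TwoOf (λ i → is-parental i ≡ false)
    two-left with split (is-parental 0F) | split (is-parental 1F) | split (is-parental 2F) | split (is-parental 3F)
    ... | inj₂ p | inj₂ q | _ | _ = 0F , 1F , (λ ()) , p , q
    ... | inj₂ p | _ | inj₂ q | _ = 0F , 2F , (λ ()) , p , q
    ... | inj₂ p | _ | _ | inj₂ q = 0F , 3F , (λ ()) , p , q
    ... | _ | inj₂ p | inj₂ q | _ = 1F , 2F , (λ ()) , p , q
    ... | _ | inj₂ p | _ | inj₂ q = 1F , 3F , (λ ()) , p , q
    ... | _ | _ | inj₂ p | inj₂ q = 2F , 3F , (λ ()) , p , q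
    ... | inj₁ p | inj₁ q | inj₁ s | _ = ⊥-elim (at-most-two {0F} {1F} {2F} (λ ()) (λ ()) (λ ()) p q s)
    ... | inj₁ p | inj₁ q | _ | inj₁ s = ⊥-elim (at-most-two {0F} {1F} {3F} (λ ()) (λ ()) (λ ()) p q s)
    ... | inj₁ p | _ | inj₁ q | inj₁ s = ⊥-elim (at-most-two {0F} {2F} {3F} (λ ()) (λ ()) (λ ()) p q s)
    ... | _ | inj₁ p | inj₁ q | inj₁ s = ⊥-elim (at-most-two {1F} {2F} {3F} (λ ()) (λ ()) (λ ()) p q s)

    open Place α₁ (at a 2) is-parental hiding (A)

    a≤β-tip : ∀ i → is-parental i ≡ false → a ℤ.≤ β (tip i)
    a≤β-tip 0F _ = a≤b
    a≤β-tip 1F _ = ℤ.<⇒≤ (α<β-tip 1F)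
    a≤β-tip 3F _ = ℤ.≤-trans a≤a′ (ℤ.<⇒≤ (α<β-tip 3F))
    a≤β-tip 2F np = case tail of λ where
      (inj₁ (_ , _ , a′≤b′)) → ℤ.≤-trans a≤a′ a′≤b′
      (inj₂ (f≡O , _)) → clash (is-parental-intro (proj₂ captured (≡⇒≢ f≡O O≢F))) np

    bwd₁ : TwoExits W r (λ u → ℤ.- β₁ u) (Usable J lab₁ F)
    bwd₁ = backward passB (let (i , j , i≢j , p , q) = two-left in
      i , j , i≢j , (inj₁ p , own i p) , (inj₁ q , own j q))
      where
      own : ∀ i → is-parental i ≡ false → at a 2 ℤ.≤ at (β (tip i)) 4
      own i p = ℤ.<⇒≤ (at-≤< (a≤β-tip i p) (s≤s (s≤s (s≤s z≤n))))
      early : ∀ {i j} → β (tip i) ℤ.< a → Bw i × at (β (tip i)) 4 ℤ.≤ at a 2 × (at a 2 ≡ at (β (tip i)) 4 → Bw j)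
      early {i} lt = inj₂ (subst (at (β (tip i)) 4 ℤ.<_) (sym α₁v) (at-gap lt 4<8)) ,
        ℤ.<⇒≤ lt′ , λ eq → contradiction (sym eq) (ℤ.<⇒≢ lt′)
        where
        lt′ : at (β (tip i)) 4 ℤ.< at a 2
        lt′ = at-< 2 lt 4<8
      passB : ∀ i → PassB (hub i) i (partner i)
      passB 0F nF _ = contradiction e≡F nF
      passB 1F nF _ = contradiction (trans (cong lab (hub-partner 0F)) e≡F) nF
      passB 2F nF _ = case tail of λ where
        (inj₁ (f≡F , _)) → contradiction f≡F nF
        (inj₂ (_ , b′<a , _)) → early b′<a
      passB 3F nF le = case tail of λ where
        (inj₁ (f≡F , _)) → contradiction (trans (cong lab (hub-partner 2F)) f≡F) nF
        (inj₂ (_ , b′<a , _)) → early (ℤ.≤-<-trans le b′<a)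

    not-v : ∀ {u} → S u ≡ false → u ≢ v
    not-v s refl = clash v∈S s

    α₁-unmoved : ∀ {u} → moved u ≡ false → α₁ u ≡ at (κ₀ u) 0
    α₁-unmoved = if-false

    α₁-lo : ∀ u → at (κ₀ u) 0 ℤ.≤ α₁ u
    α₁-lo u with split (moved u)
    ... | inj₂ o = ℤ.≤-reflexive (sym (if-false o))
    ... | inj₁ i = subst₂ ℤ._≤_ (cong (λ t → at t 0) (sym (proj₂ (moved⇒ i)))) (sym (if-true i)) (at-≤ʳ a z≤n)

    α₁-hi : ∀ {u} → u ≢ v → α u ℤ.< β u → α₁ u ℤ.< at (β u) 4
    α₁-hi {u} u≢v lt with split (moved u)
    ... | inj₂ o = subst (ℤ._< at (β u) 4) (sym (trans (if-false o) (cong (λ t → at t 0) (κ₀-old u≢v)))) (at-< 4 lt (s≤s z≤n))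
    ... | inj₁ i = subst (ℤ._< at (β u) 4) (sym (if-true i))
      (at-< 4 (subst (ℤ._< β u) (trans (sym (κ₀-old u≢v)) (proj₂ (moved⇒ i))) lt) (s≤s (s≤s (s≤s (s≤s z≤n)))))

    -- For a set without `v` a spoke can be an exit only towards `v`. Then `v` is over before `T`,
    -- so that spoke is forward or one-way and the old exit survives.
    old-exit : ∀ {Y T t y g₀} → Y y ≡ true →
      (∀ y → Y y ≡ true → W y ≡ true × y ≢ r × α₁ y ≡ T × κ₀ y ≡ t × y ≢ v) →
      (κ₀ v ℤ.≤ t → at a 2 ℤ.< T) → (∀ u → κ₀ u ℤ.≤ t → α₁ u ℤ.≤ T) → Exit α₁ (Usable J lab₁ B) Y T g₀
    old-exit {Y} {T} {t} {y} {g₀} y∈ Y⊆ above below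
      with exits₀ Y t y y∈ (λ z z∈ → let (w , z≢r , _ , k , _) = Y⊆ z z∈ in w , z≢r , k) g₀
    ... | exit {g} {c} {d} g≢ (j , nB) c∈ d∉ κd = exit g≢ (j , usable (spokeOf g)) c∈ d∉ (below d κd)
      where
      usable : (∃ λ i → g ≡ spoke i) ⊎ (∀ i → g ≢ spoke i) → lab₁ g ≢ B
      usable (inj₂ ns) eq = nB (trans (relabel-other (λ _ → F) ns) (trans (sym (relabel-other l ns)) eq))
      usable (inj₁ (i , refl)) with J.ends j (spokes i)
      ... | inj₁ (c≡v , _) = contradiction c≡v (proj₂ (proj₂ (proj₂ (proj₂ (Y⊆ c c∈)))))
      ... | inj₂ (refl , refl) = proj₂ (usableF i (inj₂ (subst (at a 2 ℤ.<_) (sym (proj₁ (proj₂ (proj₂ (Y⊆ c c∈))))) (above κd))))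

    -- On the part of level `a` that stays, the non-parental spokes may no longer be usable. Parent
    -- edges suffice there by `climb`, and a spoke among them is a parent edge of `v`, whichever way
    -- it is climbed.
    tree-exit : ∀ {Y y g₀} → Y y ≡ true → (∀ {y} → Y y ≡ true → S y ≡ true × R y ≡ false) →
      Exit α₁ (Usable J lab₁ B) Y (at a 0) g₀
    tree-exit {Y} {y} {g₀} y∈ Y⊆ with climb structure Y y y∈ Y⊆ g₀
    ... | g , u , p , g≢ , u∈ , p∉ , parent = finish (node parent)
      where
      su = proj₁ (Y⊆ u∈)
      ru = proj₂ (Y⊆ u∈)
      node : ParentEdge structure u g p → L₀ g u p × S p ≡ true × κ₀ p ℤ.≤ κ₀ u × (p ≡ v → Parental v g)
      node (inj₁ (refl , refl)) = let (link , s , le , _) = node₁ su ru in link , s , le , last₁ su ru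
      node (inj₂ (refl , refl)) = let (link , s , le , _) = node₂ su ru in link , s , le , last₂ su ru
      own : ParentEdge structure u g p → u ≡ v → Parental v g
      own (inj₁ (t≡ , _)) refl = inj₁ t≡
      own (inj₂ (t≡ , _)) refl = inj₂ t≡
      finish : L₀ g u p × S p ≡ true × κ₀ p ℤ.≤ κ₀ u × (p ≡ v → Parental v g) → Exit α₁ (Usable J lab₁ B) Y (at a 0) g₀
      finish ((j , nB) , s , le , last) = exit g≢ (j , usable (spokeOf g)) u∈ p∉
        (subst₂ ℤ._≤_ (sym (α₁-unmoved (stays s))) (cong (λ t → at t 0) (proj₁ (level su ru))) (at-≤ˡ 0 le))
        where
        usable : (∃ λ i → g ≡ spoke i) ⊎ (∀ i → g ≢ spoke i) → lab₁ g ≢ B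
        usable (inj₂ ns) eq = nB (trans (relabel-other (λ _ → F) ns) (trans (sym (relabel-other l ns)) eq))
        usable (inj₁ (i , refl)) with J.ends j (spokes i)
        ... | inj₁ (u≡v , _) = proj₂ (usableF i (inj₁ (is-parental-intro (own parent u≡v))))
        ... | inj₂ (_ , p≡v) = proj₂ (usableF i (inj₁ (is-parental-intro (last p≡v))))

    ranks-differ : ∀ {s t} → at s 3 ≢ at t 0
    ranks-differ {s} {t} eq with s ℤ.<? t
    ... | yes lt = ℤ.<⇒≢ (at-gap lt (s≤s (s≤s (s≤s (s≤s z≤n))))) eq
    ... | no ¬lt = ℤ.<⇒≢ (at-≤< (ℤ.≮⇒≥ ¬lt) (s≤s z≤n)) (sym eq)

    -- A level of `α₁` is the moved part of level `a`, the captured part of it, or an old level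
    -- different from `a`. Slots 3 and 0 keep the first kind apart from the others.
    fwd₁ : TwoExits W r α₁ (Usable J lab₁ B)
    fwd₁ Y T y₀ y₀∈ Y⊆ g₀ with split (moved y₀)
    ... | inj₁ i = old-exit y₀∈ moved-Y (λ _ → subst (at a 2 ℤ.<_) T≡ (at-<ʳ a (ℕ.n<1+n 2)))
        (λ u le → subst (α₁ u ℤ.≤_) T≡ (below u le))
      where
      T≡ : at a 3 ≡ T
      T≡ = trans (sym (if-true i)) (proj₂ (proj₂ (Y⊆ y₀ y₀∈)))
      moved-Y : ∀ y → Y y ≡ true → W y ≡ true × y ≢ r × α₁ y ≡ T × κ₀ y ≡ a × y ≢ v
      moved-Y y y∈ with split (moved y) | Y⊆ y y∈
      ... | inj₁ i′ | w , y≢r , eq = w , y≢r , eq , proj₂ (moved⇒ i′) , not-v (proj₁ (moved⇒ i′))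
      ... | inj₂ o  | _ , _ , eq = contradiction (trans T≡ (trans (sym eq) (α₁-unmoved o))) ranks-differ
      below : ∀ u → κ₀ u ℤ.≤ a → α₁ u ℤ.≤ at a 3
      below u le with split (moved u)
      ... | inj₁ i′ = ℤ.≤-reflexive (if-true i′)
      ... | inj₂ o  = subst (ℤ._≤ at a 3) (sym (α₁-unmoved o)) (ℤ.<⇒≤ (at-≤< le (s≤s z≤n)))
    ... | inj₂ o = by-level (κ₀ y₀ ℤ.≟ a)
      where
      T≡ : at (κ₀ y₀) 0 ≡ T
      T≡ = trans (sym (α₁-unmoved o)) (proj₂ (proj₂ (Y⊆ y₀ y₀∈)))
      unmoved-Y : ∀ {y} → Y y ≡ true → moved y ≡ false × κ₀ y ≡ κ₀ y₀
      unmoved-Y {y} y∈ with split (moved y) | proj₂ (proj₂ (Y⊆ y y∈))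
      ... | inj₁ i  | eq = contradiction (trans (sym (if-true i)) (trans eq (sym T≡))) ranks-differ
      ... | inj₂ o′ | eq = o′ , at-injective {j = 0} (trans (sym (α₁-unmoved o′)) (trans eq (sym T≡)))
      tree-Y : κ₀ y₀ ≡ a → ∀ {y} → Y y ≡ true → S y ≡ true × R y ≡ false
      tree-Y κ≡a {y} y∈ = in-S (split (S y)) , not-R κy (proj₁ (proj₂ (Y⊆ y y∈)))
        where
        κy : κ₀ y ≡ a
        κy = trans (proj₂ (unmoved-Y y∈)) κ≡a
        in-S : S y ≡ true ⊎ S y ≡ false → S y ≡ true
        in-S (inj₁ s) = s
        in-S (inj₂ s) = clash (∧-intro (cong not s) (dec-true (κ₀ y ℤ.≟ a) κy)) (proj₁ (unmoved-Y y∈))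
      module _ (κ≢a : κ₀ y₀ ≢ a) where
        strict : a ℤ.≤ κ₀ y₀ → a ℤ.< κ₀ y₀
        strict le = ℤ.≤∧≢⇒< le (κ≢a ∘ sym)
        level-Y : ∀ y → Y y ≡ true → W y ≡ true × y ≢ r × α₁ y ≡ T × κ₀ y ≡ κ₀ y₀ × y ≢ v
        level-Y y y∈ = let (w , y≢r , eq) = Y⊆ y y∈ in
          w , y≢r , eq , proj₂ (unmoved-Y y∈) ,
          λ y≡v → κ≢a (trans (sym (proj₂ (unmoved-Y y∈))) (trans (cong κ₀ y≡v) κ₀v))
        below : ∀ u → κ₀ u ℤ.≤ κ₀ y₀ → α₁ u ℤ.≤ at (κ₀ y₀) 0
        below u le with split (moved u)
        ... | inj₂ o′ = subst (ℤ._≤ at (κ₀ y₀) 0) (sym (α₁-unmoved o′)) (at-≤ˡ 0 le)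
        ... | inj₁ i  = subst (ℤ._≤ at (κ₀ y₀) 0) (sym (if-true i))
          (ℤ.<⇒≤ (at-gap (strict (subst (ℤ._≤ κ₀ y₀) (proj₂ (moved⇒ i)) le)) (s≤s (s≤s (s≤s (s≤s z≤n))))))
      by-level : Dec (κ₀ y₀ ≡ a) → Exit α₁ (Usable J lab₁ B) Y T g₀
      by-level (yes κ≡a) = subst (λ T → Exit α₁ (Usable J lab₁ B) Y T g₀)
        (trans (cong (λ t → at t 0) (sym κ≡a)) T≡) (tree-exit y₀∈ (tree-Y κ≡a))
      by-level (no κ≢a) = old-exit y₀∈ (level-Y κ≢a)
        (λ le → subst (at a 2 ℤ.<_) T≡ (at-gap (strict κ≢a (subst (ℤ._≤ κ₀ y₀) κ₀v le)) 2<8))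
        (λ u le → subst (α₁ u ℤ.≤_) T≡ (below κ≢a u le))

    divided : Decomposition W r J
    divided = assemble (subst (ℤ._< at a 2) (sym α₁v) (at-<ʳ a (s≤s z≤n)))
      (λ {u} u≢v → subst (λ t → at t 0 ℤ.≤ α₁ u) (κ₀-old u≢v) (α₁-lo u))
      α₁-hi fwd₁ bwd₁

-- Symmetries of a pinch and the case distinction

module _ {n m} {W′ W : Fin n → Bool} {r : Fin n} {J′ J : Link n m} where

  reindex : (P : Pinch W′ W r J′ J) (π : Fin 4 → Fin 4) → (∀ i → π (π i) ≡ i) →
            (∀ i → π (partner i) ≡ partner (π i)) → Pinch.hub P (π 0F) ≢ Pinch.hub P (π 2F) →
            Pinch W′ W r J′ J
  reindex P π involutive commutes hub≢′ = record
    { isLink′ = isLink′ ; isLink = isLink ; v = v ; v∉W′ = v∉W′ ; v∈W = v∈W ; v≢r = v≢r ; same = same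
    ; spoke = λ i → spoke (π i) ; hub = λ i → hub (π i) ; tip = λ i → tip (π i)
    ; spoke-inj = λ {i} {j} eq → trans (sym (involutive i)) (trans (cong π (spoke-inj eq)) (involutive j))
    ; spokes = λ i → spokes (π i)
    ; hubs = λ i → subst (λ k → J′ (hub (π i)) (tip (π i)) (tip k)) (sym (commutes i)) (hubs (π i))
    ; hub-partner = λ i → trans (cong hub (commutes i)) (hub-partner (π i))
    ; hub≢ = hub≢′
    ; lift = λ j → case lift j of λ
        { (inj₁ (i , p , q , s)) → inj₁ (π i , trans p (cong hub (sym (involutive i))) ,
            trans q (cong tip (sym (involutive i))) ,
            trans s (cong tip (trans (sym (involutive (partner i))) (cong π (commutes i)))))
        ; (inj₂ (ns , j′)) → inj₂ ((λ i → ns (π i)) , j′) }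
    ; drop = λ j → case drop j of λ
        { (inj₁ (i , p)) → inj₁ (π i , trans p (cong spoke (sym (involutive i))))
        ; (inj₂ (ns , j′)) → inj₂ ((λ i → ns (π i)) , j′) } }
    where open Pinch P

  swap : Pinch W′ W r J′ J → Pinch W′ W r J′ J
  swap P = reindex P π (λ { 0F → refl ; 1F → refl ; 2F → refl ; 3F → refl })
    (λ { 0F → refl ; 1F → refl ; 2F → refl ; 3F → refl }) (Pinch.hub≢ P ∘ sym)
    where
    π : Fin 4 → Fin 4
    π 0F = 2F
    π 1F = 3F
    π 2F = 0F
    π 3F = 1F

  flip₀ : Pinch W′ W r J′ J → Pinch W′ W r J′ J
  flip₀ P = reindex P π (λ { 0F → refl ; 1F → refl ; 2F → refl ; 3F → refl })
    (λ { 0F → refl ; 1F → refl ; 2F → refl ; 3F → refl })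
    (λ eq → Pinch.hub≢ P (trans (sym (Pinch.hub-partner P 0F)) eq))
    where
    π : Fin 4 → Fin 4
    π 0F = 1F
    π 1F = 0F
    π 2F = 2F
    π 3F = 3F

  flip₂ : Pinch W′ W r J′ J → Pinch W′ W r J′ J
  flip₂ P = swap (flip₀ (swap P))

  Half : Pinch W′ W r J′ J → Decomposition W′ r J′ → Fin 4 → Fin 4 → Set
  Half P D i j = Oriented (Decomposition.α D) (Decomposition.β D) (Decomposition.lab D (Pinch.hub P i))
                          (Pinch.tip P i) (Pinch.tip P j)

  label : Pinch W′ W r J′ J → Decomposition W′ r J′ → Fin 4 → Label
  label P D i = Decomposition.lab D (Pinch.hub P i)

  α-tip β-tip : Pinch W′ W r J′ J → Decomposition W′ r J′ → Fin 4 → ℤ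
  α-tip P D i = Decomposition.α D (Pinch.tip P i)
  β-tip P D i = Decomposition.β D (Pinch.tip P i)

  module Dispatch where

    open Oriented

    -- For two forward hubs the one whose later end starts first takes the forward spokes; only a
    -- tie requires splitting. A one-way second hub requires it when its gap begins before `a` but
    -- does not end before `a`.
    F-any : (P : Pinch W′ W r J′ J) (D : Decomposition W′ r J′) (e : Half P D 0F 1F) (f : Half P D 2F 3F) →
      label P D 0F ≡ F → α-tip P D 1F ℤ.≤ β-tip P D 0F → Decomposition W r J
    F-any P D e f e≡F a≤b = go (kind f)
      where
      open Cases P D e f hiding (e; f)
      go : Kind (label P D 2F) a′ b′ → Decomposition W r J
      go (fw f≡F a′≤b′) with ℤ.<-cmp a a′
      ... | tri< a<a′ _ _ = Cases.f-first (swap P) D f e f≡F a′≤b′ (≡⇒≢ e≡F F≢B) (λ nF → contradiction e≡F nF) a<a′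
      ... | tri≈ _ a≡a′ _ = Splitting.divided e≡F a≤b (≡⇒≢ f≡F F≢B) (ℤ.≤-reflexive a≡a′) (inj₁ (f≡F , a≡a′ , a′≤b′))
      ... | tri> _ _ a′<a = f-first e≡F a≤b (≡⇒≢ f≡F F≢B) (λ nF → contradiction f≡F nF) a′<a
      go (bw f≡B a′≤b′) with b′ ℤ.<? a
      ... | yes lt = f-then-e e≡F a≤b f≡B a′≤b′ lt
      ... | no ¬lt = e-first (≡⇒≢ e≡F F≢B) (λ nF → contradiction e≡F nF) (≡⇒≢ f≡B B≢F) (λ nB → contradiction f≡B nB) (ℤ.≮⇒≥ ¬lt)
      go (ow f≡O b′<a′) with b′ ℤ.<? a | a′ ℤ.<? a
      ... | no ¬lt | _ = e-first (≡⇒≢ e≡F F≢B) (λ nF → contradiction e≡F nF) (≡⇒≢ f≡O O≢F) (λ _ → b′<a′) (ℤ.≮⇒≥ ¬lt)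
      ... | yes _  | yes a′<a = f-first e≡F a≤b (≡⇒≢ f≡O O≢B) (λ _ → b′<a′) a′<a
      ... | yes lt | no ¬lt = Splitting.divided e≡F a≤b (≡⇒≢ f≡O O≢B) (ℤ.≮⇒≥ ¬lt) (inj₂ (f≡O , lt , b′<a′))

    -- Either one gap ends no later than the other begins, or the gaps meet and the later of their
    -- two beginnings lies in both.
    O-O : (P : Pinch W′ W r J′ J) (D : Decomposition W′ r J′) (e : Half P D 0F 1F) (f : Half P D 2F 3F) →
      label P D 0F ≡ O → β-tip P D 0F ℤ.< α-tip P D 1F → label P D 2F ≡ O → β-tip P D 2F ℤ.< α-tip P D 3F →
      Decomposition W r J
    O-O P D e f e≡O b<a f≡O b′<a′ with β-tip P D 2F ℤ.<? α-tip P D 1F | β-tip P D 0F ℤ.<? α-tip P D 3F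
    ... | no ¬lt | _ = e-first (≡⇒≢ e≡O O≢B) (λ _ → b<a) (≡⇒≢ f≡O O≢F) (λ _ → b′<a′) (ℤ.≮⇒≥ ¬lt)
      where open Cases P D e f
    ... | yes _  | no ¬lt = e-first (≡⇒≢ f≡O O≢B) (λ _ → b′<a′) (≡⇒≢ e≡O O≢F) (λ _ → b<a) (ℤ.≮⇒≥ ¬lt)
      where open Cases (swap P) D f e
    ... | yes b′<a | yes b<a′ with ℤ.≤-total (β-tip P D 0F) (β-tip P D 2F)
    ... | inj₁ b≤b′ = Cases.straddle P D e f e≡O f≡O _ b≤b′ ℤ.≤-refl b′<a b′<a′
    ... | inj₂ b′≤b = Cases.straddle P D e f e≡O f≡O _ ℤ.≤-refl b′≤b b<a b<a′

    dual-oriented : ∀ {α β : Fin n → ℤ} {ℓ x y} → Oriented α β ℓ x y →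
      Oriented (λ u → ℤ.- β u) (λ u → ℤ.- α u) (swapFB ℓ) y x
    dual-oriented {ℓ = ℓ} o = record
      { ordα = λ nB → ℤ.neg-mono-≤ (ordβ o λ { refl → nB refl })
      ; ordβ = λ nF → ℤ.neg-mono-≤ (ordα o λ { refl → nF refl })
      ; kind = dual-kind (kind o) }
      where
      dual-kind : ∀ {ℓ a b} → Kind ℓ a b → Kind (swapFB ℓ) (ℤ.- b) (ℤ.- a)
      dual-kind (fw refl le) = bw refl (ℤ.neg-mono-≤ le)
      dual-kind (bw refl le) = fw refl (ℤ.neg-mono-≤ le)
      dual-kind (ow refl lt) = ow refl (ℤ.neg-mono-< lt)

    B-any : (P : Pinch W′ W r J′ J) (D : Decomposition W′ r J′) (e : Half P D 0F 1F) (f : Half P D 2F 3F) →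
      label P D 0F ≡ B → α-tip P D 1F ℤ.≤ β-tip P D 0F → Decomposition W r J
    -- Reversing time exchanges the earlier and the later tip of each hub, hence the two flips.
    B-any P D e f e≡B a≤b = dual (F-any (flip₀ (flip₂ P)) (dual D)
      (hub-at (sym (Pinch.hub-partner P 0F)) (dual-oriented e))
      (hub-at (sym (Pinch.hub-partner P 2F)) (dual-oriented f))
      (cong swapFB (trans (cong (Decomposition.lab D) (Pinch.hub-partner P 0F)) e≡B)) (ℤ.neg-mono-≤ a≤b))
      where
      hub-at : ∀ {g h x y} → g ≡ h →
        Oriented (Decomposition.α (dual D)) (Decomposition.β (dual D)) (swapFB (Decomposition.lab D g)) x y →
        Oriented (Decomposition.α (dual D)) (Decomposition.β (dual D)) (swapFB (Decomposition.lab D h)) x y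
      hub-at refl o = o

    oriented-pinch : (P : Pinch W′ W r J′ J) (D : Decomposition W′ r J′) → Half P D 0F 1F → Half P D 2F 3F →
                     Decomposition W r J
    oriented-pinch P D e f = go (kind e) (kind f)
      where
      go : Kind _ _ _ → Kind _ _ _ → Decomposition W r J
      go (fw p q) _        = F-any P D e f p q
      go (bw p q) _        = B-any P D e f p q
      go _        (fw p q) = F-any (swap P) D f e p q
      go _        (bw p q) = B-any (swap P) D f e p q
      go (ow p q) (ow s t) = O-O P D e f p q s t

  module _ (isLink′ : IsLink W′ J′) where
    open IsLink isLink′

    record Normalised (D : Decomposition W′ r J′) (g : Fin m) (x y : Fin n) : Set where
      private
        module D = Decomposition D
      field
        result : Decomposition W′ r J′
      open Decomposition result
      field
        α≡      : α ≡ D.α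
        β≡      : β ≡ D.β
        others  : ∀ {h} → h ≢ g → lab h ≡ D.lab h
        oriented : Oriented α β (lab g) x y ⊎ Oriented α β (lab g) y x

    -- Calling an edge one-way only makes more edges usable, so it is free whenever the intervals
    -- are disjoint. The times stay the same, so treating the second hub does not disturb the first.
    normalise : (D : Decomposition W′ r J′) → ∀ {g x y} → J′ g x y → Normalised D g x y
    normalise D {g} {x} {y} j = go (β x ℤ.<? α y) (β y ℤ.<? α x)
      where
      open Decomposition D

      relaxed : β x ℤ.< α y ⊎ β y ℤ.< α x → Decomposition W′ r J′
      relaxed p = record
        { α = α ; β = β ; lab = lab [ g ↦ O ] ; α<β = α<β ; oneway = oneway′
        ; fwd = exits-mono (λ _ → refl) (λ {h} (k , q) → k , weaker (λ ()) h q) fwd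
        ; bwd = exits-mono (λ _ → refl) (λ {h} (k , q) → k , weaker (λ ()) h q) bwd }
        where
        weaker : ∀ {ℓ} → O ≢ ℓ → ∀ h → lab h ≢ ℓ → (lab [ g ↦ O ]) h ≢ ℓ
        weaker O≢ℓ h q with h Fin.≟ g
        ... | yes _ = O≢ℓ
        ... | no _  = q
        oneway′ : ∀ {h c d} → J′ h c d → (lab [ g ↦ O ]) h ≡ O → β c ℤ.< α d ⊎ β d ℤ.< α c
        oneway′ {h} k eq with h Fin.≟ g
        ... | no _ = oneway k eq
        ... | yes refl with ends j k
        ... | inj₁ (refl , refl) = p
        ... | inj₂ (refl , refl) = [ inj₂ , inj₁ ]′ p

      along : ∀ {x y} → W′ x ≡ true → W′ y ≡ true → β x ℤ.< α y → ∀ {ℓ} → ℓ ≡ O → Oriented α β ℓ x y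
      along wx wy lt ℓ≡O = record
        { ordα = λ _ → ℤ.<⇒≤ (ℤ.<-trans (α<β wx) lt) ; ordβ = λ _ → ℤ.<⇒≤ (ℤ.<-trans lt (α<β wy)) ; kind = ow ℓ≡O lt }

      overlapping : ∀ ℓ → lab g ≡ ℓ → α y ℤ.≤ β x → α x ℤ.≤ β y → Oriented α β ℓ x y ⊎ Oriented α β ℓ y x
      overlapping O eq p q = contradiction (oneway j eq) [ (λ lt → ℤ.<⇒≱ lt p) , (λ lt → ℤ.<⇒≱ lt q) ]′
      overlapping F eq p q with ℤ.≤-total (α x) (α y)
      ... | inj₁ le = inj₁ record { ordα = λ _ → le ; ordβ = λ nF → contradiction refl nF ; kind = fw refl p }
      ... | inj₂ le = inj₂ record { ordα = λ _ → le ; ordβ = λ nF → contradiction refl nF ; kind = fw refl q }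
      overlapping B eq p q with ℤ.≤-total (β x) (β y)
      ... | inj₁ le = inj₁ record { ordα = λ nB → contradiction refl nB ; ordβ = λ _ → le ; kind = bw refl p }
      ... | inj₂ le = inj₂ record { ordα = λ nB → contradiction refl nB ; ordβ = λ _ → le ; kind = bw refl q }

      go : Dec (β x ℤ.< α y) → Dec (β y ℤ.< α x) → Normalised D g x y
      go (yes lt) _ = record
        { result = relaxed (inj₁ lt) ; α≡ = refl ; β≡ = refl ; others = kept lab O
        ; oriented = inj₁ (along (live (flip j)) (live j) lt (updated lab g O)) }
      go _ (yes lt) = record
        { result = relaxed (inj₂ lt) ; α≡ = refl ; β≡ = refl ; others = kept lab O
        ; oriented = inj₂ (along (live j) (live (flip j)) lt (updated lab g O)) }
      go (no ¬lt) (no ¬lt′) = record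
        { result = D ; α≡ = refl ; β≡ = refl ; others = λ _ → refl
        ; oriented = overlapping (lab g) refl (ℤ.≮⇒≥ ¬lt) (ℤ.≮⇒≥ ¬lt′) }

  pinch : Pinch W′ W r J′ J → Decomposition W′ r J′ → Decomposition W r J
  pinch P D = go (carry (Normalised.oriented N₀)) (Normalised.oriented N₂)
    where
    open Pinch P
    N₀ = normalise isLink′ D (hubs 0F)
    D₀ = Normalised.result N₀
    N₂ = normalise isLink′ D₀ (hubs 2F)
    D₂ = Normalised.result N₂
    open Decomposition D₂
    transport : ∀ {x y} → Oriented (Decomposition.α D₀) (Decomposition.β D₀) (Decomposition.lab D₀ (hub 0F)) x y →
                Oriented α β (lab (hub 0F)) x y
    transport {x} {y} o rewrite Normalised.α≡ N₂ | Normalised.β≡ N₂ | Normalised.others N₂ hub≢ = o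
    carry : _ → Oriented α β (lab (hub 0F)) (tip 0F) (tip 1F) ⊎ Oriented α β (lab (hub 0F)) (tip 1F) (tip 0F)
    carry (inj₁ o) = inj₁ (transport o)
    carry (inj₂ o) = inj₂ (transport o)
    at-partner : ∀ {i x y} → Oriented α β (lab (hub i)) x y → Oriented α β (lab (hub (partner i))) x y
    at-partner {i} {x} {y} = subst (λ g → Oriented α β (lab g) x y) (sym (hub-partner i))
    open Dispatch
    go : Oriented α β (lab (hub 0F)) (tip 0F) (tip 1F) ⊎ Oriented α β (lab (hub 0F)) (tip 1F) (tip 0F) →
         Oriented α β (lab (hub 2F)) (tip 2F) (tip 3F) ⊎ Oriented α β (lab (hub 2F)) (tip 3F) (tip 2F) →
         Decomposition W r J
    go (inj₁ e) (inj₁ f) = oriented-pinch P D₂ e f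
    go (inj₂ e) (inj₁ f) = oriented-pinch (flip₀ P) D₂ (at-partner {0F} e) f
    go (inj₁ e) (inj₂ f) = oriented-pinch (flip₂ P) D₂ e (at-partner {2F} f)
    go (inj₂ e) (inj₂ f) = oriented-pinch (flip₀ (flip₂ P)) D₂ (at-partner {0F} e) (at-partner {2F} f)

-- Splitting off a vertex of degree four

∀-Bool? : ∀ {P : Bool → Set} → (∀ b → Dec (P b)) → Dec (∀ b → P b)
∀-Bool? P? = map′ (λ { (p , q) true → p ; (p , q) false → q }) (λ f → f true , f false) (P? true ×-dec P? false)

-- Vertices and edges are switched off instead of removed, so all graphs of the induction share
-- their index types and the surviving edges keep their names.
record Net (n m : ℕ) : Set where
  field
    src tgt : Fin m → Fin n
    alive   : Fin m → Bool
    W       : Fin n → Bool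
    src∈    : ∀ {g} → alive g ≡ true → W (src g) ≡ true
    tgt∈    : ∀ {g} → alive g ≡ true → W (tgt g) ≡ true

  Join : Link n m
  Join g a b = alive g ≡ true × ((src g ≡ a × tgt g ≡ b) ⊎ (src g ≡ b × tgt g ≡ a))

  isLink : IsLink W Join
  isLink = record { flip = λ { (l , inj₁ p) → l , inj₂ p ; (l , inj₂ p) → l , inj₁ p } ; ends = ends ; live = live }
    where
    ends : ∀ {g a b c d} → Join g a b → Join g c d → (a ≡ c × b ≡ d) ⊎ (a ≡ d × b ≡ c)
    ends (_ , inj₁ (refl , refl)) (_ , inj₁ (refl , refl)) = inj₁ (refl , refl)
    ends (_ , inj₁ (refl , refl)) (_ , inj₂ (refl , refl)) = inj₂ (refl , refl)
    ends (_ , inj₂ (refl , refl)) (_ , inj₁ (refl , refl)) = inj₂ (refl , refl)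
    ends (_ , inj₂ (refl , refl)) (_ , inj₂ (refl , refl)) = inj₁ (refl , refl)
    live : ∀ {g a b} → Join g a b → W b ≡ true
    live (l , inj₁ (_ , refl)) = tgt∈ l
    live (l , inj₂ (refl , _)) = src∈ l

  crosses : (Fin n → Bool) → Fin m → Bool
  crosses X g = X (src g) xor X (tgt g)

  cut : (Fin n → Bool) → Fin m → ℕ
  cut X g = bit (alive g ∧ crosses X g)

  d : (Fin n → Bool) → ℕ
  d X = sum (cut X)

  d-cong : ∀ {X Y} → (∀ u → X u ≡ Y u) → d X ≡ d Y
  d-cong {X} {Y} eq = sum-cong-≗ λ g → cong (λ b → bit (alive g ∧ b)) (cong₂ _xor_ (eq (src g)) (eq (tgt g)))

  -- A cut is represented by its side without `r`; the live vertex excludes sets made of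
  -- switched-off vertices only.
  Cut4 : Fin n → Set
  Cut4 r = ∀ X → X r ≡ false → ∀ {x} → W x ≡ true → X x ≡ true → 4 ℕ.≤ d X

  Violation : Fin n → Set
  Violation r = ∃ λ X → X r ≡ false × (∃ λ x → W x ≡ true × X x ≡ true) × d X ℕ.≤ 3

  cut4? : ∀ r → Cut4 r ⊎ Violation r
  cut4? r with anySubset? (λ S → (Vec.lookup S r Bool.≟ false) ×-dec
                 Fin.any? (λ x → (W x Bool.≟ true) ×-dec (Vec.lookup S x Bool.≟ true)) ×-dec (d (Vec.lookup S) ℕ.≤? 3))
  ... | yes (S , r∉ , x∈ , le) = inj₂ (Vec.lookup S , r∉ , x∈ , le)
  ... | no none = inj₁ λ X r∉ {x} wx x∈ → ℕ.≰⇒> λ le → none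
    ( Vec.tabulate X
    , trans (Vec.lookup∘tabulate X r) r∉
    , (x , wx , trans (Vec.lookup∘tabulate X x) x∈)
    , subst (ℕ._≤ 3) (sym (d-cong (Vec.lookup∘tabulate X))) le )

search : ∀ {n} {A C : Fin n → Set} → (∀ i → A i ⊎ C i) → ∃ A ⊎ (∀ i → C i)
search {zero}  f = inj₂ λ ()
search {suc n} f with f zero | search (f ∘ suc)
... | inj₁ a | _            = inj₁ (zero , a)
... | _      | inj₁ (i , a) = inj₁ (suc i , a)
... | inj₂ c | inj₂ cs      = inj₂ λ { zero → c ; (suc i) → cs i }

delete : ∀ {n m} → Net n m → Fin m → Net n m
delete N e = record
  { src = src ; tgt = tgt ; alive = λ g → not (g == e) ∧ alive g ; W = W
  ; src∈ = λ {g} p → src∈ (proj₂ (∧-elim {not (g == e)} p))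
  ; tgt∈ = λ {g} p → tgt∈ (proj₂ (∧-elim {not (g == e)} p)) }
  where open Net N

-- Exits survive the addition of edges, and the label `F`, unlike `O`, puts no condition on the
-- times of the ends.
undelete : ∀ {n m} (N : Net n m) e {r} → Decomposition (Net.W N) r (Net.Join (delete N e)) →
           Decomposition (Net.W N) r (Net.Join N)
undelete N e D = record
  { α = α ; β = β ; lab = lab [ e ↦ F ] ; α<β = α<β ; oneway = oneway′
  ; fwd = exits-mono (λ _ → refl) (λ {g} {a} {b} → keep g {a} {b}) fwd
  ; bwd = exits-mono (λ _ → refl) (λ {g} {a} {b} → keep g {a} {b}) bwd }
  where
  open Net N
  open Decomposition D
  keep : ∀ g {a b ℓ} → Usable (Net.Join (delete N e)) lab ℓ g a b → Usable (Net.Join N) (lab [ e ↦ F ]) ℓ g a b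
  keep g ((l , p) , q) = let (≢e , l′) = ∧-elim l in (l′ , p) , λ eq → q (trans (sym (if-false (not-true ≢e))) eq)
  oneway′ : ∀ {g a b} → Net.Join N g a b → (lab [ e ↦ F ]) g ≡ O → β a ℤ.< α b ⊎ β b ℤ.< α a
  oneway′ {g} (l , p) eq with split (g == e)
  ... | inj₁ q = contradiction (trans (sym (if-true q)) eq) λ ()
  ... | inj₂ q = oneway (∧-intro (cong not q) l , p) (trans (sym (if-false q)) eq)

module Reduction {n m} (N : Net n m) (r : Fin n) (cut4 : Net.Cut4 N r) where
  open Net N

  record Tight (X : Fin n → Bool) : Set where
    field
      r∉   : X r ≡ false
      some : ∃ λ x → W x ≡ true × X x ≡ true
      d≤4  : d X ℕ.≤ 4

  Blocked : Fin m → Set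
  Blocked e = alive e ≡ true → ∃ λ X → Tight X × crosses X e ≡ true

  -- A cut that becomes too small had at most one edge more. So it was a 4-cut, and the deleted edge
  -- crossed it.
  deletable? : ∀ e → (alive e ≡ true × Net.Cut4 (delete N e) r) ⊎ Blocked e
  deletable? e with split (alive e) | Net.cut4? (delete N e) r
  ... | inj₂ dead | _        = inj₂ λ l → clash l dead
  ... | inj₁ l    | inj₁ cut = inj₁ (l , cut)
  ... | inj₁ l    | inj₂ (X , r∉ , (x , wx , x∈) , le) = inj₂ λ _ →
    X , record { r∉ = r∉ ; some = x , wx , x∈ ; d≤4 = d≤ } , crossing
    where
    h : Fin m → ℕ
    h g = bit (alive g ∧ crosses X g)
    removed : ∀ g → bit ((not (g == e) ∧ alive g) ∧ crosses X g) ≡ (h [ e ↦ 0 ]) g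
    removed g with g == e
    ... | true  = refl
    ... | false = refl
    d≡ : d X ≡ bit (alive e ∧ crosses X e) + Net.d (delete N e) X
    d≡ = trans (sum-extract h e) (cong (bit (alive e ∧ crosses X e) +_) (sym (sum-cong-≗ removed)))
    bit≤1 : ∀ b → bit b ℕ.≤ 1
    bit≤1 true  = ℕ.≤-refl
    bit≤1 false = z≤n
    d≤ : d X ℕ.≤ 4
    d≤ = subst (ℕ._≤ 4) (sym d≡) (ℕ.+-mono-≤ (bit≤1 _) le)
    crossing : crosses X e ≡ true
    crossing with split (crosses X e)
    ... | inj₁ c = c
    ... | inj₂ c = contradiction
      (ℕ.≤-trans (cut4 X r∉ wx x∈) (subst (ℕ._≤ 3) (sym (trans d≡ (cong (_+ Net.d (delete N e) X) (cong bit (trans (cong (alive e ∧_) c) (Bool.∧-zeroʳ (alive e))))))) le))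
      (ℕ.<⇒≱ ℕ.≤-refl)

  module _ (blocked : ∀ e → Blocked e) where

    -- Submodularity of the cut function. It holds for each edge separately, which leaves a check of
    -- 32 cases.
    uncross : ∀ {X Y : Fin n → Bool} → d (λ u → X u ∧ Y u) + d (λ u → X u ∨ Y u) ℕ.≤ d X + d Y
    uncross {X} {Y} = sum-+-+ (cut (λ u → X u ∧ Y u)) (cut (λ u → X u ∨ Y u)) (cut X) (cut Y)
      λ g → pointwise (alive g) (X (src g)) (X (tgt g)) (Y (src g)) (Y (tgt g))
      where
      pointwise : ∀ l a a′ b b′ → bit (l ∧ ((a ∧ b) xor (a′ ∧ b′))) + bit (l ∧ ((a ∨ b) xor (a′ ∨ b′)))
                    ℕ.≤ bit (l ∧ (a xor a′)) + bit (l ∧ (b xor b′))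
      pointwise = from-yes (∀-Bool? λ l → ∀-Bool? λ a → ∀-Bool? λ a′ → ∀-Bool? λ b → ∀-Bool? λ b′ →
        bit (l ∧ ((a ∧ b) xor (a′ ∧ b′))) + bit (l ∧ ((a ∨ b) xor (a′ ∨ b′)))
          ℕ.≤? bit (l ∧ (a xor a′)) + bit (l ∧ (b xor b′)))

    -- With no edge inside `X`, every edge that meets `X` leaves it, so the cuts of the two parts
    -- share no edge.
    separate : ∀ {X x} → (∀ g → (alive g ∧ (X (src g) ∧ X (tgt g))) ≡ false) → X x ≡ true →
               d (_== x) + d (λ u → X u ∧ not (u == x)) ℕ.≤ d X
    separate {X} {x} none x∈ = sum-+ (cut (_== x)) (cut (λ u → X u ∧ not (u == x)))
      λ g → pointwise (alive g) (X (src g)) (X (tgt g)) (src g == x) (tgt g == x) (none g)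
        (subset (src g)) (subset (tgt g))
      where
      subset : ∀ u → (u == x) ≡ true → X u ≡ true
      subset u p = trans (cong X (==⇒≡ u x p)) x∈
      pointwise : ∀ l a a′ b b′ → (l ∧ (a ∧ a′)) ≡ false → (b ≡ true → a ≡ true) → (b′ ≡ true → a′ ≡ true) →
        bit (l ∧ (b xor b′)) + bit (l ∧ ((a ∧ not b) xor (a′ ∧ not b′))) ℕ.≤ bit (l ∧ (a xor a′))
      pointwise = from-yes (∀-Bool? λ l → ∀-Bool? λ a → ∀-Bool? λ a′ → ∀-Bool? λ b → ∀-Bool? λ b′ →
        (l ∧ (a ∧ a′) Bool.≟ false) →-dec ((b Bool.≟ true) →-dec (a Bool.≟ true)) →-dec
        ((b′ Bool.≟ true) →-dec (a′ Bool.≟ true)) →-dec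
        (bit (l ∧ (b xor b′)) + bit (l ∧ ((a ∧ not b) xor (a′ ∧ not b′))) ℕ.≤? bit (l ∧ (a xor a′))))

    -- Intersecting a tight set that spans an edge with a tight set separating the ends of
    -- that edge gives a smaller tight set.
    shrink : ∀ fuel X → Tight X → size (λ u → W u ∧ X u) ℕ.< fuel →
             ∃ λ v → W v ≡ true × v ≢ r × ∃ λ X → Tight X × X v ≡ true × (∀ {u} → W u ≡ true → X u ≡ true → u ≡ v)
    shrink (suc fuel) X tight (s≤s lt) with Tight.some tight
    ... | x , wx , x∈ with find (λ u → (W u ∧ X u) ∧ not (u == x)) | find (λ g → alive g ∧ (X (src g) ∧ X (tgt g)))
    ... | inj₁ none | _ = x , wx , (λ { refl → clash x∈ r∉ }) , X , tight , x∈ , λ {u} wu u∈ → only u wu u∈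
      where
      open Tight tight
      only : ∀ u → W u ≡ true → X u ≡ true → u ≡ x
      only u wu u∈ with split (u == x)
      ... | inj₁ p = ==⇒≡ u x p
      ... | inj₂ q = clash (∧-intro (∧-intro wu u∈) (cong not q)) (none u)
    -- Two live vertices with no edge inside the tight set would force its cut to have at least 4 +
    -- 4 edges.
    ... | inj₂ (y , p) | inj₁ none =
      contradiction (ℕ.≤-trans (ℕ.+-mono-≤ (cut4 (_== x) (==-≢ {i = r} {x} r≢x) wx (==-refl x)) (cut4 X∖x r∉X∖x wy y∈X∖x))
                      (ℕ.≤-trans (separate {X} {x} none x∈) d≤4)) (ℕ.<⇒≱ (ℕ.m≤m+n 5 3))
      where
      open Tight tight
      X∖x : Fin n → Bool
      X∖x u = X u ∧ not (u == x)
      r≢x : r ≢ x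
      r≢x refl = clash x∈ r∉
      r∉X∖x : X∖x r ≡ false
      r∉X∖x = cong (_∧ not (r == x)) r∉
      wy : W y ≡ true
      wy = proj₁ (∧-elim {W y} (proj₁ (∧-elim p)))
      y∈X∖x : X∖x y ≡ true
      y∈X∖x = ∧-intro (proj₂ (∧-elim {W y} (proj₁ (∧-elim p)))) (proj₂ (∧-elim p))
    ... | inj₂ _ | inj₂ (g , p) with ∧-elim {alive g} p
    ... | l , q with ∧-elim {X (src g)} q | blocked g l
    ... | s∈ , t∈ | Z , tightZ , c = shrink fuel (λ u → X u ∧ Z u) tight∧ (ℕ.<-≤-trans smaller lt)
      where
      module X = Tight tight
      module Z = Tight tightZ
      both : ∃ λ u → ∃ λ w → (W u ≡ true × X u ≡ true × Z u ≡ true) × (W w ≡ true × X w ≡ true × Z w ≡ false)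
      both with split (Z (src g)) | split (Z (tgt g))
      ... | inj₁ i | inj₂ o = src g , tgt g , (src∈ l , s∈ , i) , (tgt∈ l , t∈ , o)
      ... | inj₂ o | inj₁ i = tgt g , src g , (tgt∈ l , t∈ , i) , (src∈ l , s∈ , o)
      ... | inj₁ i | inj₁ j = contradiction (trans (sym (cong₂ _xor_ i j)) c) λ ()
      ... | inj₂ i | inj₂ j = contradiction (trans (sym (cong₂ _xor_ i j)) c) λ ()
      u = proj₁ both
      u-in = proj₁ (proj₂ (proj₂ both))
      w-out = proj₂ (proj₂ (proj₂ both))
      tight∧ : Tight (λ u → X u ∧ Z u)
      tight∧ = record
        { r∉ = cong (_∧ Z r) X.r∉
        ; some = u , proj₁ u-in , ∧-intro (proj₁ (proj₂ u-in)) (proj₂ (proj₂ u-in))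
        -- The union misses `r` as well, so its cut takes at least 4 of the at most 8 edges and
        -- leaves 4 to the intersection.
        ; d≤4 = ℕ.+-cancelʳ-≤ 4 _ 4 (ℕ.≤-trans
            (ℕ.+-monoʳ-≤ (d (λ u → X u ∧ Z u)) (cut4 (λ u → X u ∨ Z u) (cong₂ _∨_ X.r∉ Z.r∉) (proj₁ u-in) (∨-introˡ (proj₁ (proj₂ u-in)))))
            (ℕ.≤-trans (uncross {X} {Z}) (ℕ.+-mono-≤ X.d≤4 Z.d≤4))) }
      smaller : size (λ u → W u ∧ (X u ∧ Z u)) ℕ.< size (λ u → W u ∧ X u)
      smaller = size-strict
        (λ z q → let (wz , q′) = ∧-elim {W z} q in ∧-intro wz (proj₁ (∧-elim q′)))
        (proj₁ (proj₂ both))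
        (trans (cong₂ _∧_ (proj₁ w-out) (cong₂ _∧_ (proj₁ (proj₂ w-out)) (proj₂ (proj₂ w-out)))) refl)
        (∧-intro (proj₁ w-out) (proj₁ (proj₂ w-out)))

    -- A loop crosses no set and hence cannot be blocked.
    no-loops : ∀ {g} → alive g ≡ true → src g ≢ tgt g
    no-loops {g} l eq with blocked g l
    ... | Z , _ , c = contradiction (trans (sym (cong (_xor Z (tgt g)) (cong Z eq))) c) (λ q → contradiction (trans (sym q) (Bool.xor-same (Z (tgt g)))) λ ())

    degree-four : (∃ λ x → W x ≡ true × x ≢ r) → ∃ λ v → W v ≡ true × v ≢ r × d (_== v) ℕ.≤ 4
    degree-four (x , wx , x≢r) with find (λ g → alive g ∧ not (src g == tgt g))
    ... | inj₁ none = contradiction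
      (ℕ.≤-trans (cut4 (_== x) (==-≢ {i = r} {x} (x≢r ∘ sym)) wx (==-refl x)) (ℕ.≤-reflexive empty)) λ ()
      where
      pointwise : ∀ g → bit (alive g ∧ crosses (_== x) g) ≡ 0
      pointwise g with split (alive g)
      ... | inj₂ dead = cong (λ l → bit (l ∧ crosses (_== x) g)) dead
      ... | inj₁ l = clash (∧-intro l (cong not (==-≢ (no-loops l)))) (none g)
      empty : d (_== x) ≡ 0
      empty = trans (sum-cong-≗ pointwise) (sum-replicate-zero m)
    ... | inj₂ (g , p) with blocked g (proj₁ (∧-elim p))
    ... | X , tight , _ with shrink (suc (size (λ u → W u ∧ X u))) X tight (ℕ.n<1+n _)
    ... | v , wv , v≢r , Z , tightZ , v∈ , only = v , wv , v≢r , ℕ.≤-trans (sum-mono pointwise) (Tight.d≤4 tightZ)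
      where
      same : ∀ u → W u ≡ true → (u == v) ≡ Z u
      same u wu with split (Z u)
      ... | inj₁ i = trans (trans (cong (_== v) (only wu i)) (==-refl v)) (sym i)
      ... | inj₂ o = trans (==-≢ {i = u} {v} λ { refl → clash v∈ o }) (sym o)
      pointwise : ∀ g → bit (alive g ∧ crosses (_== v) g) ℕ.≤ bit (alive g ∧ crosses Z g)
      pointwise g with split (alive g)
      ... | inj₂ dead rewrite dead = z≤n
      ... | inj₁ l = ℕ.≤-reflexive (cong (λ b → bit (alive g ∧ b)) (cong₂ _xor_ (same _ (src∈ l)) (same _ (tgt∈ l))))

enumerate : ∀ {m} k (f : Fin m → Bool) → size f ≡ k →
  ∃ λ (e : Fin k → Fin m) → (∀ {i j} → e i ≡ e j → i ≡ j) × (∀ i → f (e i) ≡ true) × (∀ g → f g ≡ true → ∃ λ i → g ≡ e i)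
enumerate k f eq with find f
enumerate zero f eq | inj₁ none = (λ ()) , (λ { {()} }) , (λ ()) , λ g p → clash p (none g)
enumerate {m} (suc k) f eq | inj₁ none = contradiction (trans (sym eq) (ℕ.≤-antisym
    (ℕ.≤-trans (size-mono {X = f} {λ _ → false} (λ i p → clash p (none i))) (ℕ.≤-reflexive (sum-replicate-zero m))) z≤n)) λ ()
enumerate {m} k f eq | inj₂ (i , fi) = by k (trans (sym eq) size≡)
  where
  f′ : Fin m → Bool
  f′ = f [ i ↦ false ]
  size≡ : size f ≡ suc (size f′)
  size≡ = trans (sum-extract (bit ∘ f) i) (cong₂ _+_ (cong bit fi) (sum-cong-≗ λ j → pointwise j))
    where
    pointwise : ∀ j → ((bit ∘ f) [ i ↦ 0 ]) j ≡ bit (f′ j)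
    pointwise j with j == i
    ... | true  = refl
    ... | false = refl
  by : ∀ k → k ≡ suc (size f′) →
    ∃ λ (e : Fin k → Fin m) → (∀ {i j} → e i ≡ e j → i ≡ j) × (∀ i → f (e i) ≡ true) × (∀ g → f g ≡ true → ∃ λ i → g ≡ e i)
  by (suc k) eq′ with enumerate k f′ (sym (ℕ.suc-injective eq′))
  ... | e , inj , all , cover = e′ , inj′ , all′ , cover′
    where
    in-f′ : ∀ {g} → f′ g ≡ true → g ≢ i × f g ≡ true
    in-f′ {g} p with split (g == i)
    ... | inj₁ q = clash p (if-true q)
    ... | inj₂ q = (λ { refl → clash (==-refl g) q }) , trans (sym (if-false q)) p
    e′ : Fin (suc k) → Fin m
    e′ zero    = i
    e′ (suc j) = e j
    inj′ : ∀ {i j} → e′ i ≡ e′ j → i ≡ j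
    inj′ {zero}  {zero}  _ = refl
    inj′ {zero}  {suc j} p = contradiction (sym p) (proj₁ (in-f′ (all j)))
    inj′ {suc j} {zero}  p = contradiction p (proj₁ (in-f′ (all j)))
    inj′ {suc _} {suc _} p = cong suc (inj p)
    all′ : ∀ j → f (e′ j) ≡ true
    all′ zero    = fi
    all′ (suc j) = proj₂ (in-f′ (all j))
    cover′ : ∀ g → f g ≡ true → ∃ λ j → g ≡ e′ j
    cover′ g p with g Fin.≟ i
    ... | yes q = zero , q
    ... | no q with cover g (trans (kept f false q) p)
    ... | j , eq = suc j , eq

record Star {n m} (N : Net n m) (v : Fin n) : Set where
  open Net N
  field
    spoke     : Fin 4 → Fin m
    tip       : Fin 4 → Fin n
    spoke-inj : ∀ {i j} → spoke i ≡ spoke j → i ≡ j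
    spokes    : ∀ i → Join (spoke i) v (tip i)
    tip≢v     : ∀ i → tip i ≢ v
    cover     : ∀ {g a} → Join g v a → ∃ λ i → g ≡ spoke i

star : ∀ {n m} (N : Net n m) {v} → (∀ {g} → Net.alive N g ≡ true → Net.src N g ≢ Net.tgt N g) →
       Net.d N (_== v) ≡ 4 → Star N v
star {n} {m} N {v} no-loops deg with enumerate 4 (λ g → Net.alive N g ∧ Net.crosses N (_== v) g) deg
... | e , inj , all , cover = record
  { spoke = e ; tip = λ i → proj₁ (far i) ; spoke-inj = inj ; spokes = λ i → proj₁ (proj₂ (far i))
  ; tip≢v = λ i → proj₂ (proj₂ (far i)) ; cover = λ {g} j → cover g (∧-intro (proj₁ j) (incident j)) }
  where
  open Net N
  far : ∀ i → ∃ λ u → Join (e i) v u × u ≢ v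
  far i = from (∧-elim (all i))
    where
    from : alive (e i) ≡ true × crosses (_== v) (e i) ≡ true → ∃ λ u → Join (e i) v u × u ≢ v
    from (l , c) with src (e i) Fin.≟ v | tgt (e i) Fin.≟ v
    from (l , c)  | yes p | no q  = tgt (e i) , (l , inj₁ (p , refl)) , q
    from (l , c)  | no p  | yes q = src (e i) , (l , inj₂ (refl , q)) , p
    from (l , ()) | yes p | yes q
    from (l , ()) | no p  | no q
  incident : ∀ {g a} → Join g v a → crosses (_== v) g ≡ true
  incident {g} (l , inj₁ (p , refl)) = cong₂ _xor_ (trans (cong (_== v) p) (==-refl v))
    (==-≢ {i = tgt g} {v} λ q → no-loops l (trans p (sym q)))
  incident {g} (l , inj₂ (refl , q)) = cong₂ _xor_ (==-≢ {i = src g} {v} λ p → no-loops l (trans p (sym q)))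
    (trans (cong (_== v) q) (==-refl v))

-- Spokes 0 and 2 are reused as the two new edges, and spokes 1 and 3 are switched off. Two tips may
-- coincide; the new edge is then a loop.
module Splitting-off {n m} (N : Net n m) {r v : Fin n} (v∈W : Net.W N v ≡ true) (v≢r : v ≢ r) (S : Star N v) where
  open Net N
  open Star S

  spokeOf : ∀ g → (∃ λ i → g ≡ spoke i) ⊎ (∀ i → g ≢ spoke i)
  spokeOf = locate spoke

  src₀ tgt₀ src′ tgt′ : Fin m → Fin n
  src₀ = src [ spoke 0F ↦ tip 0F ]
  tgt₀ = tgt [ spoke 0F ↦ tip 1F ]
  src′ = src₀ [ spoke 2F ↦ tip 2F ]
  tgt′ = tgt₀ [ spoke 2F ↦ tip 3F ]
  alive₁ alive′ : Fin m → Bool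
  alive₁ = alive [ spoke 1F ↦ false ]
  alive′ = alive₁ [ spoke 3F ↦ false ]
  W′ : Fin n → Bool
  W′ = W [ v ↦ false ]

  apart : ∀ i j → i ≢ j → spoke i ≢ spoke j
  apart i j p q = p (spoke-inj q)

  data View (g : Fin m) : Set where
    hub₀  : g ≡ spoke 0F → src′ g ≡ tip 0F → tgt′ g ≡ tip 1F → alive′ g ≡ true → View g
    hub₂  : g ≡ spoke 2F → src′ g ≡ tip 2F → tgt′ g ≡ tip 3F → alive′ g ≡ true → View g
    dead  : alive′ g ≡ false → (∃ λ i → g ≡ spoke i) → View g
    other : (∀ i → g ≢ spoke i) → src′ g ≡ src g → tgt′ g ≡ tgt g → alive′ g ≡ alive g → View g

  view : ∀ g → View g
  view g with spokeOf g
  ... | inj₂ ns = other ns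
    (trans (kept src₀ (tip 2F) (ns 2F)) (kept src (tip 0F) (ns 0F)))
    (trans (kept tgt₀ (tip 3F) (ns 2F)) (kept tgt (tip 1F) (ns 0F)))
    (trans (kept alive₁ false (ns 3F)) (kept alive false (ns 1F)))
  ... | inj₁ (0F , refl) = hub₀ refl
    (trans (kept src₀ (tip 2F) (apart 0F 2F λ ())) (updated src (spoke 0F) (tip 0F)))
    (trans (kept tgt₀ (tip 3F) (apart 0F 2F λ ())) (updated tgt (spoke 0F) (tip 1F)))
    (trans (kept alive₁ false (apart 0F 3F λ ())) (trans (kept alive false (apart 0F 1F λ ())) (proj₁ (spokes 0F))))
  ... | inj₁ (1F , refl) = dead
    (trans (kept alive₁ false (apart 1F 3F λ ())) (updated alive (spoke 1F) false)) (1F , refl)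
  ... | inj₁ (2F , refl) = hub₂ refl
    (updated src₀ (spoke 2F) (tip 2F)) (updated tgt₀ (spoke 2F) (tip 3F))
    (trans (kept alive₁ false (apart 2F 3F λ ())) (trans (kept alive false (apart 2F 1F λ ())) (proj₁ (spokes 2F))))
  ... | inj₁ (3F , refl) = dead (updated alive₁ (spoke 3F) false) (3F , refl)

  tip∈ : ∀ i → W (tip i) ≡ true
  tip∈ i = IsLink.live isLink (spokes i)

  W′-old : ∀ {u} → u ≢ v → W u ≡ W′ u
  W′-old u≢v = sym (kept W false u≢v)

  tip∈′ : ∀ i → W′ (tip i) ≡ true
  tip∈′ i = trans (sym (W′-old (tip≢v i))) (tip∈ i)

  ends≢v : ∀ {g} → (∀ i → g ≢ spoke i) → alive g ≡ true → src g ≢ v × tgt g ≢ v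
  ends≢v ns l = (λ p → let (i , q) = cover (l , inj₁ (p , refl)) in ns i q) ,
                (λ p → let (i , q) = cover (l , inj₂ (refl , p)) in ns i q)

  reduced : Net n m
  reduced = record
    { src = src′ ; tgt = tgt′ ; alive = alive′ ; W = W′
    ; src∈ = λ {g} → src∈′ g ; tgt∈ = λ {g} → tgt∈′ g }
    where
    src∈′ : ∀ g → alive′ g ≡ true → W′ (src′ g) ≡ true
    src∈′ g l with view g
    ... | hub₀ _ s _ _   = trans (cong W′ s) (tip∈′ 0F)
    ... | hub₂ _ s _ _   = trans (cong W′ s) (tip∈′ 2F)
    ... | dead d _       = clash l d
    ... | other ns s _ a = let l′ = trans (sym a) l in
      trans (cong W′ s) (trans (sym (W′-old (proj₁ (ends≢v ns l′)))) (src∈ l′))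
    tgt∈′ : ∀ g → alive′ g ≡ true → W′ (tgt′ g) ≡ true
    tgt∈′ g l with view g
    ... | hub₀ _ _ t _   = trans (cong W′ t) (tip∈′ 1F)
    ... | hub₂ _ _ t _   = trans (cong W′ t) (tip∈′ 3F)
    ... | dead d _       = clash l d
    ... | other ns _ t a = let l′ = trans (sym a) l in
      trans (cong W′ t) (trans (sym (W′-old (proj₂ (ends≢v ns l′)))) (tgt∈ l′))

  reduced-smaller : size alive′ ℕ.< size alive
  reduced-smaller = size-strict below (spoke 1F) (from-view (view (spoke 1F))) (proj₁ (spokes 1F))
    where
    from-view : View (spoke 1F) → alive′ (spoke 1F) ≡ false
    from-view (hub₀ p _ _ _)   = contradiction p (apart 1F 0F λ ())
    from-view (hub₂ p _ _ _)   = contradiction p (apart 1F 2F λ ())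
    from-view (dead d _)       = d
    from-view (other ns _ _ _) = contradiction refl (ns 1F)
    below : ∀ g → alive′ g ≡ true → alive g ≡ true
    below g l with view g
    ... | hub₀ refl _ _ _ = proj₁ (spokes 0F)
    ... | hub₂ refl _ _ _ = proj₁ (spokes 2F)
    ... | dead d _        = clash l d
    ... | other _ _ _ a   = trans (sym a) l

  pinch-at-v : Pinch W′ W r (Net.Join reduced) Join
  pinch-at-v = record
    { isLink′ = Net.isLink reduced ; isLink = isLink ; v = v ; v∉W′ = updated W v false ; v∈W = v∈W ; v≢r = v≢r
    ; same = W′-old ; spoke = spoke ; hub = hub ; tip = tip ; spoke-inj = spoke-inj ; spokes = spokes
    ; hubs = hubs
    ; hub-partner = λ { 0F → refl ; 1F → refl ; 2F → refl ; 3F → refl }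
    ; hub≢ = apart 0F 2F λ () ; lift = lift ; drop = drop }
    where
    hub : Fin 4 → Fin m
    hub 0F = spoke 0F
    hub 1F = spoke 0F
    hub 2F = spoke 2F
    hub 3F = spoke 2F
    join₀ : Net.Join reduced (spoke 0F) (tip 0F) (tip 1F)
    join₀ with view (spoke 0F)
    ... | hub₀ _ s t l        = l , inj₁ (s , t)
    ... | hub₂ p _ _ _        = contradiction p (apart 0F 2F λ ())
    ... | other ns _ _ _      = contradiction refl (ns 0F)
    ... | dead d _            = clash (trans (trans (kept alive₁ false (apart 0F 3F λ ())) (kept alive false (apart 0F 1F λ ()))) (proj₁ (spokes 0F))) d
    join₂ : Net.Join reduced (spoke 2F) (tip 2F) (tip 3F)
    join₂ with view (spoke 2F)
    ... | hub₂ _ s t l        = l , inj₁ (s , t)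
    ... | hub₀ p _ _ _        = contradiction p (apart 2F 0F λ ())
    ... | other ns _ _ _      = contradiction refl (ns 2F)
    ... | dead d _            = clash (trans (trans (kept alive₁ false (apart 2F 3F λ ())) (kept alive false (apart 2F 1F λ ()))) (proj₁ (spokes 2F))) d
    hubs : ∀ i → Net.Join reduced (hub i) (tip i) (tip (partner i))
    hubs 0F = join₀
    hubs 1F = IsLink.flip (Net.isLink reduced) {spoke 0F} join₀
    hubs 2F = join₂
    hubs 3F = IsLink.flip (Net.isLink reduced) {spoke 2F} join₂
    lift : ∀ {g a b} → Net.Join reduced g a b →
      (∃ λ i → g ≡ hub i × a ≡ tip i × b ≡ tip (partner i)) ⊎ ((∀ i → g ≢ spoke i) × Join g a b)
    lift {g} (l , p) with view g
    ... | dead d _ = clash l d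
    lift (l , inj₁ (p , q)) | hub₀ eq s t _ = inj₁ (0F , eq , trans (sym p) s , trans (sym q) t)
    lift (l , inj₂ (p , q)) | hub₀ eq s t _ = inj₁ (1F , eq , trans (sym q) t , trans (sym p) s)
    lift (l , inj₁ (p , q)) | hub₂ eq s t _ = inj₁ (2F , eq , trans (sym p) s , trans (sym q) t)
    lift (l , inj₂ (p , q)) | hub₂ eq s t _ = inj₁ (3F , eq , trans (sym q) t , trans (sym p) s)
    lift (l , inj₁ (p , q)) | other ns s t a = inj₂ (ns , trans (sym a) l , inj₁ (trans (sym s) p , trans (sym t) q))
    lift (l , inj₂ (p , q)) | other ns s t a = inj₂ (ns , trans (sym a) l , inj₂ (trans (sym s) p , trans (sym t) q))
    drop : ∀ {g a b} → Join g a b → (∃ λ i → g ≡ spoke i) ⊎ ((∀ i → g ≢ spoke i) × Net.Join reduced g a b)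
    drop {g} (l , p) with view g
    ... | hub₀ eq _ _ _ = inj₁ (0F , eq)
    ... | hub₂ eq _ _ _ = inj₁ (2F , eq)
    ... | dead _ i      = inj₁ i
    drop (l , inj₁ (p , q)) | other ns s t a = inj₂ (ns , trans a l , inj₁ (trans s p , trans t q))
    drop (l , inj₂ (p , q)) | other ns s t a = inj₂ (ns , trans a l , inj₂ (trans s p , trans t q))

sum-four : ∀ {m} (e : Fin 4 → Fin m) → (∀ {i j} → e i ≡ e j → i ≡ j) → (off : Fin m → Bool) →
  (∀ i → off (e i) ≡ true) → (∀ g → off g ≡ true → ∃ λ i → g ≡ e i) → ∀ f →
  sum f ≡ f (e 0F) + (f (e 1F) + (f (e 2F) + (f (e 3F) + sum λ g → if off g then 0 else f g)))
sum-four {m} e inj off off-e off⇒ f = begin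
  sum f                                                   ≡⟨ sum-extract f (e 0F) ⟩
  f (e 0F) + sum f₁                                       ≡⟨ cong (f (e 0F) +_) (sum-extract f₁ (e 1F)) ⟩
  f (e 0F) + (f₁ (e 1F) + sum f₂)                         ≡⟨ cong (λ z → f (e 0F) + (f₁ (e 1F) + z)) (sum-extract f₂ (e 2F)) ⟩
  f (e 0F) + (f₁ (e 1F) + (f₂ (e 2F) + sum f₃))           ≡⟨ cong (λ z → f (e 0F) + (f₁ (e 1F) + (f₂ (e 2F) + z))) (sum-extract f₃ (e 3F)) ⟩
  f (e 0F) + (f₁ (e 1F) + (f₂ (e 2F) + (f₃ (e 3F) + sum f₄)))
    ≡⟨ cong (f (e 0F) +_) (cong₂ _+_ (k₁ (e 1F) (apart 1F 0F λ ()))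
        (cong₂ _+_ (trans (k₂ (e 2F) (apart 2F 1F λ ())) (k₁ (e 2F) (apart 2F 0F λ ())))
        (cong₂ _+_ (trans (k₃ (e 3F) (apart 3F 2F λ ())) (trans (k₂ (e 3F) (apart 3F 1F λ ())) (k₁ (e 3F) (apart 3F 0F λ ()))))
        (sum-cong-≗ rest)))) ⟩
  f (e 0F) + (f (e 1F) + (f (e 2F) + (f (e 3F) + sum λ g → if off g then 0 else f g))) ∎
  where
  open ≡-Reasoning
  f₁ f₂ f₃ f₄ : Fin m → ℕ
  f₁ = f [ e 0F ↦ 0 ]
  f₂ = f₁ [ e 1F ↦ 0 ]
  f₃ = f₂ [ e 2F ↦ 0 ]
  f₄ = f₃ [ e 3F ↦ 0 ]
  k₁ : ∀ g → g ≢ e 0F → f₁ g ≡ f g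
  k₁ g = kept f 0
  k₂ : ∀ g → g ≢ e 1F → f₂ g ≡ f₁ g
  k₂ g = kept f₁ 0
  k₃ : ∀ g → g ≢ e 2F → f₃ g ≡ f₂ g
  k₃ g = kept f₂ 0
  k₄ : ∀ g → g ≢ e 3F → f₄ g ≡ f₃ g
  k₄ g = kept f₃ 0
  apart : ∀ i j → i ≢ j → e i ≢ e j
  apart i j p q = p (inj q)
  erased : ∀ i → f₄ (e i) ≡ 0
  erased 3F = updated f₃ (e 3F) 0
  erased 2F = trans (k₄ (e 2F) (apart 2F 3F λ ())) (updated f₂ (e 2F) 0)
  erased 1F = trans (k₄ (e 1F) (apart 1F 3F λ ())) (trans (k₃ (e 1F) (apart 1F 2F λ ())) (updated f₁ (e 1F) 0))
  erased 0F = trans (k₄ (e 0F) (apart 0F 3F λ ())) (trans (k₃ (e 0F) (apart 0F 2F λ ()))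
    (trans (k₂ (e 0F) (apart 0F 1F λ ())) (updated f (e 0F) 0)))
  rest : ∀ g → f₄ g ≡ (if off g then 0 else f g)
  rest g with split (off g)
  ... | inj₁ p = let (i , eq) = off⇒ g p in trans (cong f₄ eq) (trans (erased i) (sym (if-true p)))
  ... | inj₂ p = trans (k₄ g (ne 3F)) (trans (k₃ g (ne 2F)) (trans (k₂ g (ne 1F)) (trans (k₁ g (ne 0F)) (sym (if-false p)))))
    where
    ne : ∀ i → g ≢ e i
    ne i refl = clash (off-e i) p

-- `off` marks the spokes without regard to their numbering, so `others` is literally the same
-- function for both pairings and their bad cuts can be compared.
module Pairing {n m} (N : Net n m) {r v : Fin n} (v∈W : Net.W N v ≡ true) (v≢r : v ≢ r) (cut4 : Net.Cut4 N r)
  (off : Fin m → Bool) where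
  open Net N

  others : (Fin n → Bool) → ℕ
  others X = sum λ g → bit ((alive g ∧ not (off g)) ∧ crosses X g)

  module _ (S : Star N v) (off-spoke : ∀ i → off (Star.spoke S i) ≡ true)
    (off⇒ : ∀ g → off g ≡ true → ∃ λ i → g ≡ Star.spoke S i) where
    open Star S
    open Splitting-off N v∈W v≢r S

    others-rest : ∀ X → sum (λ g → if off g then 0 else cut X g) ≡ others X
    others-rest X = sum-cong-≗ λ g → pointwise (alive g) (off g) (crosses X g)
      where
      pointwise : ∀ l o c → (if o then 0 else bit (l ∧ c)) ≡ bit ((l ∧ not o) ∧ c)
      pointwise = from-yes (∀-Bool? λ l → ∀-Bool? λ o → ∀-Bool? λ c →
        (if o then 0 else bit (l ∧ c)) ℕ.≟ bit ((l ∧ not o) ∧ c))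

    cut-spoke : ∀ X i → cut X (spoke i) ≡ bit (X v xor X (tip i))
    cut-spoke X i with spokes i
    ... | l , inj₁ (p , q) = cong bit (cong₂ _∧_ l (cong₂ _xor_ (cong X p) (cong X q)))
    ... | l , inj₂ (p , q) = cong bit (trans (cong₂ _∧_ l (cong₂ _xor_ (cong X p) (cong X q))) (Bool.xor-comm (X (tip i)) (X v)))

    d-star : ∀ X → d X ≡ bit (X v xor X (tip 0F)) + (bit (X v xor X (tip 1F)) +
                          (bit (X v xor X (tip 2F)) + (bit (X v xor X (tip 3F)) + others X)))
    d-star X = trans (sum-four spoke spoke-inj off off-spoke off⇒ (cut X))
      (cong₂ _+_ (cut-spoke X 0F) (cong₂ _+_ (cut-spoke X 1F) (cong₂ _+_ (cut-spoke X 2F) (cong₂ _+_ (cut-spoke X 3F) (others-rest X)))))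

    others-cong : ∀ {X Y} → (∀ {u} → u ≢ v → X u ≡ Y u) → others X ≡ others Y
    others-cong {X} {Y} eq = sum-cong-≗ λ g → pointwise g (view g)
      where
      pointwise : ∀ g → View g → bit ((alive g ∧ not (off g)) ∧ crosses X g) ≡ bit ((alive g ∧ not (off g)) ∧ crosses Y g)
      pointwise g _ with split (alive g) | spokeOf g
      ... | inj₂ no-l | _ rewrite no-l = refl
      ... | inj₁ l | inj₁ (i , refl) rewrite off-spoke i | Bool.∧-zeroʳ (alive (spoke i)) = refl
      ... | inj₁ l | inj₂ ns = cong (λ c → bit ((alive g ∧ not (off g)) ∧ c))
        (cong₂ _xor_ (eq (proj₁ (ends≢v ns l))) (eq (proj₂ (ends≢v ns l))))

    d-reduced : ∀ X → Net.d reduced X ≡ bit (X (tip 0F) xor X (tip 1F)) + (0 + (bit (X (tip 2F) xor X (tip 3F)) + (0 + others X)))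
    d-reduced X = trans (sum-four spoke spoke-inj off off-spoke off⇒ (Net.cut reduced X))
      (cong₂ _+_ (on-hub₀ (view (spoke 0F))) (cong₂ _+_ (on-dead 1F (view (spoke 1F)) (λ ()) (λ ()))
        (cong₂ _+_ (on-hub₂ (view (spoke 2F))) (cong₂ _+_ (on-dead 3F (view (spoke 3F)) (λ ()) (λ ()))
          (trans (sum-cong-≗ λ g → on-other g (view g)) (others-rest X))))))
      where
      on-hub₀ : View (spoke 0F) → Net.cut reduced X (spoke 0F) ≡ bit (X (tip 0F) xor X (tip 1F))
      on-hub₀ (hub₀ _ s t l)   = cong bit (cong₂ _∧_ l (cong₂ _xor_ (cong X s) (cong X t)))
      on-hub₀ (hub₂ p _ _ _)   = contradiction p (apart 0F 2F λ ())
      on-hub₀ (other ns _ _ _) = contradiction refl (ns 0F)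
      on-hub₀ (dead d _)       = clash (proj₁ (Pinch.hubs pinch-at-v 0F)) d
      on-hub₂ : View (spoke 2F) → Net.cut reduced X (spoke 2F) ≡ bit (X (tip 2F) xor X (tip 3F))
      on-hub₂ (hub₂ _ s t l)   = cong bit (cong₂ _∧_ l (cong₂ _xor_ (cong X s) (cong X t)))
      on-hub₂ (hub₀ p _ _ _)   = contradiction p (apart 2F 0F λ ())
      on-hub₂ (other ns _ _ _) = contradiction refl (ns 2F)
      on-hub₂ (dead d _)       = clash (proj₁ (Pinch.hubs pinch-at-v 2F)) d
      on-dead : ∀ i → View (spoke i) → i ≢ 0F → i ≢ 2F → Net.cut reduced X (spoke i) ≡ 0
      on-dead i (hub₀ p _ _ _)   q _ = contradiction (spoke-inj p) q
      on-dead i (hub₂ p _ _ _)   _ q = contradiction (spoke-inj p) q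
      on-dead i (other ns _ _ _) _ _ = contradiction refl (ns i)
      on-dead i (dead d _)       _ _ = cong (λ l → bit (l ∧ Net.crosses reduced X (spoke i))) d
      on-other : ∀ g → View g → (if off g then 0 else Net.cut reduced X g) ≡ (if off g then 0 else cut X g)
      on-other g (hub₀ refl _ _ _)     = trans (if-true (off-spoke 0F)) (sym (if-true (off-spoke 0F)))
      on-other g (hub₂ refl _ _ _)     = trans (if-true (off-spoke 2F)) (sym (if-true (off-spoke 2F)))
      on-other g (dead _ (i , refl))   = trans (if-true (off-spoke i)) (sym (if-true (off-spoke i)))
      on-other g (other _ s t l)       = cong (λ z → if off g then 0 else z)
        (cong bit (cong₂ _∧_ l (cong₂ _xor_ (cong X s) (cong X t))))

    -- The only form of a violating cut after splitting off: it separates one pair of tips from the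
    -- other.
    record Bad : Set where
      field
        X    : Fin n → Bool
        few  : others X ℕ.≤ 3
        t₀₁  : X (tip 1F) ≡ X (tip 0F)
        t₂₃  : X (tip 3F) ≡ X (tip 2F)
        t₀₂  : X (tip 2F) ≡ not (X (tip 0F))

    private
      Forced : Bool → Bool → Bool → Bool → Fin 4 → Set
      Forced x₀ x₁ x₂ x₃ o =
        bit (x₀ xor x₁) + (0 + (bit (x₂ xor x₃) + (0 + toℕ o))) ℕ.≤ 3 →
        4 ℕ.≤ bit x₀ + (bit x₁ + (bit x₂ + (bit x₃ + toℕ o))) →
        4 ℕ.≤ bit (not x₀) + (bit (not x₁) + (bit (not x₂) + (bit (not x₃) + toℕ o))) →
        x₁ ≡ x₀ × x₃ ≡ x₂ × x₂ ≡ not x₀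

      forced? : ∀ x₀ x₁ x₂ x₃ o → Dec (Forced x₀ x₁ x₂ x₃ o)
      forced? x₀ x₁ x₂ x₃ o =
        (_ ℕ.≤? 3) →-dec (4 ℕ.≤? _) →-dec (4 ℕ.≤? _) →-dec
        ((x₁ Bool.≟ x₀) ×-dec (x₃ Bool.≟ x₂) ×-dec (x₂ Bool.≟ not x₀))

      -- Let `k` tips lie in the set. The lower bounds say `k + o ≥ 4` and `(4 - k) + o ≥ 4`, so
      -- `o ≤ 3` excludes `k = 0` and `k = 4`. For odd `k`, `o = 3` and one pair is split; for
      -- `k = 2`, `o ≥ 2`, so two split pairs are too many. Writing `o` in `Fin 4` makes the check
      -- finite.
      analysis : ∀ x₀ x₁ x₂ x₃ o → Forced x₀ x₁ x₂ x₃ o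
      analysis = from-yes (∀-Bool? λ x₀ → ∀-Bool? λ x₁ → ∀-Bool? λ x₂ → ∀-Bool? λ x₃ → Fin.all? (forced? x₀ x₁ x₂ x₃))

    bad : Net.Violation reduced r → Bad
    bad (X , r∉ , (x , wx , x∈) , le) = record
      { X = X ; few = few ; t₀₁ = proj₁ result ; t₂₃ = proj₁ (proj₂ result) ; t₀₂ = proj₂ (proj₂ result) }
      where
      x≢v : x ≢ v
      x≢v refl = clash wx (updated W v false)
      le′ : bit (X (tip 0F) xor X (tip 1F)) + (0 + (bit (X (tip 2F) xor X (tip 3F)) + (0 + others X))) ℕ.≤ 3
      le′ = subst (ℕ._≤ 3) (d-reduced X) le
      few : others X ℕ.≤ 3
      few = ℕ.≤-trans (ℕ.m≤n+m (others X) (bit (X (tip 2F) xor X (tip 3F))))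
        (ℕ.≤-trans (ℕ.m≤n+m (bit (X (tip 2F) xor X (tip 3F)) + others X) (bit (X (tip 0F) xor X (tip 1F)))) le′)
      -- After splitting off, the side of `v` is immaterial; both completions are cuts of the
      -- original graph.
      X₀ X₁ : Fin n → Bool
      X₀ u = X u ∧ not (u == v)
      X₁ u = X u ∨ (u == v)
      X₀-old : ∀ {u} → u ≢ v → X₀ u ≡ X u
      X₀-old u≢v = trans (cong (λ b → X _ ∧ not b) (==-≢ u≢v)) (Bool.∧-identityʳ (X _))
      X₁-old : ∀ {u} → u ≢ v → X₁ u ≡ X u
      X₁-old u≢v = trans (cong (X _ ∨_) (==-≢ u≢v)) (Bool.∨-identityʳ (X _))
      X₀v : X₀ v ≡ false
      X₀v = trans (cong (λ b → X v ∧ not b) (==-refl v)) (Bool.∧-zeroʳ (X v))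
      X₁v : X₁ v ≡ true
      X₁v = trans (cong (X v ∨_) (==-refl v)) (Bool.∨-zeroʳ (X v))
      wx′ : W x ≡ true
      wx′ = trans (W′-old x≢v) wx
      low : 4 ℕ.≤ d X₀
      low = cut4 X₀ (trans (X₀-old (v≢r ∘ sym)) r∉) wx′ (trans (X₀-old x≢v) x∈)
      high : 4 ℕ.≤ d X₁
      high = cut4 X₁ (trans (X₁-old (v≢r ∘ sym)) r∉) wx′ (trans (X₁-old x≢v) x∈)
      term₀ : ∀ i → bit (X₀ v xor X₀ (tip i)) ≡ bit (X (tip i))
      term₀ i = cong bit (cong₂ _xor_ X₀v (X₀-old (tip≢v i)))
      term₁ : ∀ i → bit (X₁ v xor X₁ (tip i)) ≡ bit (not (X (tip i)))
      term₁ i = cong bit (cong₂ _xor_ X₁v (X₁-old (tip≢v i)))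
      d₀ : d X₀ ≡ bit (X (tip 0F)) + (bit (X (tip 1F)) + (bit (X (tip 2F)) + (bit (X (tip 3F)) + others X)))
      d₀ = trans (d-star X₀) (cong₂ _+_ (term₀ 0F) (cong₂ _+_ (term₀ 1F) (cong₂ _+_ (term₀ 2F) (cong₂ _+_ (term₀ 3F) (others-cong X₀-old)))))
      d₁ : d X₁ ≡ bit (not (X (tip 0F))) + (bit (not (X (tip 1F))) + (bit (not (X (tip 2F))) + (bit (not (X (tip 3F))) + others X)))
      d₁ = trans (d-star X₁) (cong₂ _+_ (term₁ 0F) (cong₂ _+_ (term₁ 1F) (cong₂ _+_ (term₁ 2F) (cong₂ _+_ (term₁ 3F) (others-cong X₁-old)))))
      o : Fin 4
      o = fromℕ< (s≤s few)
      o≡ : toℕ o ≡ others X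
      o≡ = Fin.toℕ-fromℕ< (s≤s few)
      result : X (tip 1F) ≡ X (tip 0F) × X (tip 3F) ≡ X (tip 2F) × X (tip 2F) ≡ not (X (tip 0F))
      result = analysis (X (tip 0F)) (X (tip 1F)) (X (tip 2F)) (X (tip 3F)) o
        (subst (λ z → bit (X (tip 0F) xor X (tip 1F)) + (0 + (bit (X (tip 2F) xor X (tip 3F)) + (0 + z))) ℕ.≤ 3) (sym o≡) le′)
        (subst (4 ℕ.≤_) (trans d₀ (cong (λ z → bit (X (tip 0F)) + (bit (X (tip 1F)) + (bit (X (tip 2F)) + (bit (X (tip 3F)) + z)))) (sym o≡))) low)
        (subst (4 ℕ.≤_) (trans d₁ (cong (λ z → bit (not (X (tip 0F))) + (bit (not (X (tip 1F))) + (bit (not (X (tip 2F))) + (bit (not (X (tip 3F))) + z)))) (sym o≡))) high)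

    -- The four cells cut out by two bad sets each contain one tip, hence have at least three
    -- edges besides the spokes; this is more than the few edges crossing X and Y allow.
    module Crossing (B : Bad) (Y : Fin n → Bool) (Y-few : others Y ℕ.≤ 3)
      (y₀₂ : Y (tip 2F) ≡ Y (tip 0F)) (y₁₃ : Y (tip 3F) ≡ Y (tip 1F)) (y₀₁ : Y (tip 1F) ≡ not (Y (tip 0F))) where
      open Bad B

      eqb : Bool → Bool → Bool
      eqb a b = not (a xor b)

      cell : Bool → Bool → Fin n → Bool
      cell p q u = eqb (X u) p ∧ eqb (Y u) q

      tips-in : (Fin n → Bool) → ℕ
      tips-in Z = bit (Z (tip 0F)) + (bit (Z (tip 1F)) + (bit (Z (tip 2F)) + bit (Z (tip 3F))))

      cell-bound : ∀ p q i j → tips-in (cell p q) ≡ 1 → cell p q (tip i) ≡ true → cell p q (tip j) ≡ false →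
                   3 ℕ.≤ others (cell p q)
      cell-bound p q i j one i∈ j∉ = ℕ.+-cancelˡ-≤ 1 3 (others (cell p q)) (subst (4 ℕ.≤_) dZ (bound (split (Z r))))
        where
        Z : Fin n → Bool
        Z u = cell p q u ∧ not (u == v)
        Z-old : ∀ {u} → u ≢ v → Z u ≡ cell p q u
        Z-old u≢v = trans (cong (λ b → cell p q _ ∧ not b) (==-≢ u≢v)) (Bool.∧-identityʳ (cell p q _))
        Zv : Z v ≡ false
        Zv = trans (cong (λ b → cell p q v ∧ not b) (==-refl v)) (Bool.∧-zeroʳ (cell p q v))
        complement : d (not ∘ Z) ≡ d Z
        complement = sum-cong-≗ λ g → cong (λ c → bit (alive g ∧ c)) (pointwise (Z (src g)) (Z (tgt g)))
          where
          pointwise : ∀ a b → not a xor not b ≡ a xor b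
          pointwise = from-yes (∀-Bool? λ a → ∀-Bool? λ b → (not a xor not b) Bool.≟ (a xor b))
        bound : Z r ≡ true ⊎ Z r ≡ false → 4 ℕ.≤ d Z
        bound (inj₂ r∉) = cut4 Z r∉ (tip∈ i) (trans (Z-old (tip≢v i)) i∈)
        -- The cell that contains `r` is replaced by its complement, in which tip `j` is the live
        -- vertex.
        bound (inj₁ r∈) = subst (4 ℕ.≤_) complement
          (cut4 (not ∘ Z) (cong not r∈) (tip∈ j) (cong not (trans (Z-old (tip≢v j)) j∉)))
        t : Fin 4 → ℕ
        t k = bit (cell p q (tip k))
        term : ∀ k → bit (Z v xor Z (tip k)) ≡ bit (cell p q (tip k))
        term k = cong bit (cong₂ _xor_ Zv (Z-old (tip≢v k)))
        regroup : ∀ a b c e o → a + (b + (c + (e + o))) ≡ a + (b + (c + e)) + o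
        regroup a b c e o = sym (trans (ℕ.+-assoc a (b + (c + e)) o)
          (cong (a +_) (trans (ℕ.+-assoc b (c + e) o) (cong (b +_) (ℕ.+-assoc c e o)))))
        dZ : d Z ≡ 1 + others (cell p q)
        dZ = trans (d-star Z) (trans (cong₂ _+_ (term 0F) (cong₂ _+_ (term 1F) (cong₂ _+_ (term 2F) (cong₂ _+_ (term 3F) (others-cong Z-old)))))
          (trans (regroup (t 0F) (t 1F) (t 2F) (t 3F) (others (cell p q))) (cong (_+ others (cell p q)) one)))

      inner : Bool → ℕ
      inner p = sum λ g → bit ((alive g ∧ not (off g)) ∧ ((eqb (X (src g)) p ∧ eqb (X (tgt g)) p) ∧ crosses Y g))

      -- An edge that crosses `Y` within one side of `X` borders both cells of that side, hence the
      -- factor two. An edge that crosses `X` borders at most one of them.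
      side : ∀ p q → others (cell p q) + others (cell p (not q)) ℕ.≤ others X + (inner p + inner p)
      side p q = ℕ.≤-trans
        (sum-+ (λ g → bit ((alive g ∧ not (off g)) ∧ crosses (cell p q) g))
               (λ g → bit ((alive g ∧ not (off g)) ∧ crosses (cell p (not q)) g))
               (λ g → pointwise (alive g ∧ not (off g)) (X (src g)) (X (tgt g)) (Y (src g)) (Y (tgt g)) p q))
        (ℕ.≤-reflexive (trans (∑-distrib-+ _ (λ g → inn g + inn g)) (cong (others X +_) (∑-distrib-+ inn inn))))
        where
        inn : Fin m → ℕ
        inn g = bit ((alive g ∧ not (off g)) ∧ ((eqb (X (src g)) p ∧ eqb (X (tgt g)) p) ∧ crosses Y g))
        pointwise : ∀ l a a′ b b′ p q →
          bit (l ∧ ((eqb a p ∧ eqb b q) xor (eqb a′ p ∧ eqb b′ q))) + bit (l ∧ ((eqb a p ∧ eqb b (not q)) xor (eqb a′ p ∧ eqb b′ (not q))))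
          ℕ.≤ bit (l ∧ (a xor a′)) + (bit (l ∧ ((eqb a p ∧ eqb a′ p) ∧ (b xor b′))) + bit (l ∧ ((eqb a p ∧ eqb a′ p) ∧ (b xor b′))))
        pointwise = from-yes (∀-Bool? λ l → ∀-Bool? λ a → ∀-Bool? λ a′ → ∀-Bool? λ b → ∀-Bool? λ b′ → ∀-Bool? λ p → ∀-Bool? λ q →
          bit (l ∧ ((eqb a p ∧ eqb b q) xor (eqb a′ p ∧ eqb b′ q))) + bit (l ∧ ((eqb a p ∧ eqb b (not q)) xor (eqb a′ p ∧ eqb b′ (not q))))
          ℕ.≤? bit (l ∧ (a xor a′)) + (bit (l ∧ ((eqb a p ∧ eqb a′ p) ∧ (b xor b′))) + bit (l ∧ ((eqb a p ∧ eqb a′ p) ∧ (b xor b′)))))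

      inners : ∀ p → inner p + inner (not p) ℕ.≤ others Y
      inners p = sum-+ (inn p) (inn (not p))
        (λ g → pointwise (alive g ∧ not (off g)) (X (src g)) (X (tgt g)) (crosses Y g) p)
        where
        inn : Bool → Fin m → ℕ
        inn p g = bit ((alive g ∧ not (off g)) ∧ ((eqb (X (src g)) p ∧ eqb (X (tgt g)) p) ∧ crosses Y g))
        pointwise : ∀ l a a′ c p →
          bit (l ∧ ((eqb a p ∧ eqb a′ p) ∧ c)) + bit (l ∧ ((eqb a (not p) ∧ eqb a′ (not p)) ∧ c)) ℕ.≤ bit (l ∧ c)
        pointwise = from-yes (∀-Bool? λ l → ∀-Bool? λ a → ∀-Bool? λ a′ → ∀-Bool? λ c → ∀-Bool? λ p →
          bit (l ∧ ((eqb a p ∧ eqb a′ p) ∧ c)) + bit (l ∧ ((eqb a (not p) ∧ eqb a′ (not p)) ∧ c)) ℕ.≤? bit (l ∧ c))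

      -- From `6 ≤ 3 + 2 * inner p`, rounding up.
      two≤inner : ∀ p q → 3 ℕ.≤ others (cell p q) → 3 ℕ.≤ others (cell p (not q)) → 2 ℕ.≤ inner p
      two≤inner p q c c′ with inner p | side p q
      ... | suc (suc k) | _ = s≤s (s≤s z≤n)
      ... | 0 | le = contradiction (ℕ.≤-trans (ℕ.+-mono-≤ c c′) (ℕ.≤-trans le (ℕ.+-monoˡ-≤ 0 few))) (ℕ.<⇒≱ (ℕ.m≤m+n 4 2))
      ... | 1 | le = contradiction (ℕ.≤-trans (ℕ.+-mono-≤ c c′) (ℕ.≤-trans le (ℕ.+-monoˡ-≤ 2 few))) (ℕ.<⇒≱ ℕ.≤-refl)

      impossible : ⊥
      -- The two sides of `X` need 2 + 2 edges crossing `Y`, but only 3 are available besides the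
      -- spokes.
      impossible = ℕ.<⇒≱ (s≤s Y-few) (ℕ.≤-trans (ℕ.+-mono-≤
        (two≤inner s σ bound₀ bound₁) (two≤inner (not s) σ bound₂ bound₃))
        (inners s))
        where
        s σ : Bool
        s = X (tip 0F)
        σ = Y (tip 0F)
        located : ∀ {x₁ x₂ x₃ y₁ y₂ y₃} s σ → x₁ ≡ s → x₂ ≡ not s → x₃ ≡ not s → y₁ ≡ not σ → y₂ ≡ σ → y₃ ≡ not σ →
          let K = λ p q x y → eqb x p ∧ eqb y q
              T = λ p q → bit (K p q s σ) + (bit (K p q x₁ y₁) + (bit (K p q x₂ y₂) + bit (K p q x₃ y₃))) in
          (T s σ ≡ 1 × K s σ s σ ≡ true × K s σ x₁ y₁ ≡ false) ×
          (T s (not σ) ≡ 1 × K s (not σ) x₁ y₁ ≡ true × K s (not σ) s σ ≡ false) ×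
          (T (not s) σ ≡ 1 × K (not s) σ x₂ y₂ ≡ true × K (not s) σ s σ ≡ false) ×
          (T (not s) (not σ) ≡ 1 × K (not s) (not σ) x₃ y₃ ≡ true × K (not s) (not σ) s σ ≡ false)
        located true  true  refl refl refl refl refl refl = (refl , refl , refl) , (refl , refl , refl) , (refl , refl , refl) , (refl , refl , refl)
        located true  false refl refl refl refl refl refl = (refl , refl , refl) , (refl , refl , refl) , (refl , refl , refl) , (refl , refl , refl)
        located false true  refl refl refl refl refl refl = (refl , refl , refl) , (refl , refl , refl) , (refl , refl , refl) , (refl , refl , refl)
        located false false refl refl refl refl refl refl = (refl , refl , refl) , (refl , refl , refl) , (refl , refl , refl) , (refl , refl , refl)
        place = located s σ t₀₁ t₀₂ (trans t₂₃ t₀₂) y₀₁ y₀₂ (trans y₁₃ y₀₁)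
        bound₀ : 3 ℕ.≤ others (cell s σ)
        bound₀ = let (one , i∈ , j∉) = proj₁ place in cell-bound s σ 0F 1F one i∈ j∉
        bound₁ : 3 ℕ.≤ others (cell s (not σ))
        bound₁ = let (one , i∈ , j∉) = proj₁ (proj₂ place) in cell-bound s (not σ) 1F 0F one i∈ j∉
        bound₂ : 3 ℕ.≤ others (cell (not s) σ)
        bound₂ = let (one , i∈ , j∉) = proj₁ (proj₂ (proj₂ place)) in cell-bound (not s) σ 2F 0F one i∈ j∉
        bound₃ : 3 ℕ.≤ others (cell (not s) (not σ))
        bound₃ = let (one , i∈ , j∉) = proj₂ (proj₂ (proj₂ place)) in cell-bound (not s) (not σ) 3F 0F one i∈ j∉

private
  π : Fin 4 → Fin 4
  π 0F = 0F
  π 1F = 2F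
  π 2F = 1F
  π 3F = 3F

  π-involutive : ∀ i → π (π i) ≡ i
  π-involutive 0F = refl
  π-involutive 1F = refl
  π-involutive 2F = refl
  π-involutive 3F = refl

-- Exchanging spokes 1 and 2 gives the second pairing.
re-pair : ∀ {n m} {N : Net n m} {v} → Star N v → Star N v
re-pair S = record
  { spoke = spoke ∘ π ; tip = tip ∘ π
  ; spoke-inj = λ {i} {j} eq → trans (sym (π-involutive i)) (trans (cong π (spoke-inj eq)) (π-involutive j))
  ; spokes = spokes ∘ π ; tip≢v = tip≢v ∘ π
  ; cover = λ j → let (i , eq) = cover j in π i , trans eq (cong spoke (sym (π-involutive i))) }
  where open Star S

module _ {n m} (N : Net n m) {r v : Fin n} (v∈W : Net.W N v ≡ true) (v≢r : v ≢ r) (cut4 : Net.Cut4 N r) where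

  Reducible : Star N v → Set
  Reducible S = Net.Cut4 (Splitting-off.reduced N v∈W v≢r S) r

  reducible : Star N v → ∃ Reducible
  reducible S with Net.cut4? (Splitting-off.reduced N v∈W v≢r S) r
                 | Net.cut4? (Splitting-off.reduced N v∈W v≢r (re-pair S)) r
  ... | inj₁ c | _      = S , c
  ... | _      | inj₁ c = re-pair S , c
  ... | inj₂ X | inj₂ Y = ⊥-elim (Crossing.impossible S off-spoke off⇒ (bad S off-spoke off⇒ X) B.X B.few B.t₀₁ B.t₂₃ B.t₀₂)
    where
    open Star S
    off : Fin m → Bool
    off g = does (Fin.any? (λ i → g Fin.≟ spoke i))
    open Pairing N v∈W v≢r cut4 off
    off-spoke : ∀ i → off (spoke i) ≡ true
    off-spoke i = dec-true (Fin.any? (λ j → spoke i Fin.≟ spoke j)) (i , refl)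
    off⇒ : ∀ g → off g ≡ true → ∃ λ i → g ≡ spoke i
    off⇒ g = from-does (Fin.any? (λ i → g Fin.≟ spoke i))
    off⇒-π : ∀ g → off g ≡ true → ∃ λ i → g ≡ spoke (π i)
    off⇒-π g p = let (i , eq) = off⇒ g p in π i , trans eq (cong spoke (sym (π-involutive i)))
    module B = Bad (bad (re-pair S) (off-spoke ∘ π) off⇒-π Y)

decompose : ∀ {n m} (N : Net n m) {r} → Net.W N r ≡ true → Net.Cut4 N r →
            Decomposition (Net.W N) r (Net.Join N)
decompose {n} {m} N = by-size (suc (size (Net.alive N))) N (ℕ.n<1+n _)
  where
  by-size : ∀ fuel (N : Net n m) → size (Net.alive N) ℕ.< fuel → ∀ {r} → Net.W N r ≡ true → Net.Cut4 N r →
            Decomposition (Net.W N) r (Net.Join N)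
  by-size (suc fuel) N (s≤s lt) {r} r∈ cut4 with find (λ u → Net.W N u ∧ not (u == r))
  -- Only `r` is left and both exit conditions are vacuous. Once there are other live vertices,
  -- these conditions force `α r` to be least and `β r` to be greatest, so `r` is both the beginning
  -- and the end of time.
  ... | inj₁ none = record
    { α = λ _ → ℤ.+ 0 ; β = λ _ → ℤ.+ 1 ; lab = λ _ → F ; α<β = λ _ → ℤ.+<+ (s≤s z≤n) ; oneway = λ _ ()
    ; fwd = λ Y t y y∈ Y⊆ _ → empty Y t y y∈ Y⊆ ; bwd = λ Y t y y∈ Y⊆ _ → empty Y t y y∈ Y⊆ }
    where
    empty : ∀ {A : Set} {κ : Fin n → ℤ} (Y : Fin n → Bool) t y → Y y ≡ true →
            (∀ y → Y y ≡ true → Net.W N y ≡ true × y ≢ r × κ y ≡ t) → A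
    empty Y t y y∈ Y⊆ = let (w , y≢r , _) = Y⊆ y y∈ in clash (∧-intro w (cong not (==-≢ y≢r))) (none y)
  ... | inj₂ (x , p) with search (Reduction.deletable? N r cut4)
  ... | inj₁ (e , l , cut4′) = undelete N e (by-size fuel (delete N e)
    (ℕ.<-≤-trans (size-strict (λ g q → proj₂ (∧-elim {not (g == e)} q)) e
      (cong (λ b → not b ∧ Net.alive N e) (==-refl e)) l) lt) r∈ cut4′)
  ... | inj₂ blocked with Reduction.degree-four N r cut4 blocked
      (x , proj₁ (∧-elim p) , λ { refl → clash (==-refl x) (not-true (proj₂ (∧-elim {Net.W N x} p))) })
  ... | v , v∈W , v≢r , d≤4 with reducible N v∈W v≢r cut4
      (star N (λ {g} → Reduction.no-loops N r cut4 blocked {g})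
        (ℕ.≤-antisym d≤4 (cut4 (_== v) (==-≢ {i = r} {v} (v≢r ∘ sym)) v∈W (==-refl v))))
  ... | S , cut4′ = pinch pinch-at-v (by-size fuel reduced (ℕ.<-≤-trans reduced-smaller lt)
      (trans (sym (W′-old (v≢r ∘ sym))) r∈) cut4′)
    where open Splitting-off N v∈W v≢r S

-- From decompositions to spanning trees

module Trees (G : Multigraph) (r : Fin (Multigraph.n G)) where
  open Multigraph G

  private
    V E : Set
    V = Fin n
    E = Fin m

  Joins-sym : ∀ {e u w} → Joins G e u w → Joins G e w u
  Joins-sym (inj₁ p) = inj₂ p
  Joins-sym (inj₂ p) = inj₁ p

  Joins-ends : ∀ {e a b c d} → Joins G e a b → Joins G e c d → (a ≡ c × b ≡ d) ⊎ (a ≡ d × b ≡ c)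
  Joins-ends (inj₁ p) (inj₁ q) with trans (sym p) q
  ... | refl = inj₁ (refl , refl)
  Joins-ends (inj₁ p) (inj₂ q) with trans (sym p) q
  ... | refl = inj₂ (refl , refl)
  Joins-ends (inj₂ p) (inj₁ q) with trans (sym p) q
  ... | refl = inj₂ (refl , refl)
  Joins-ends (inj₂ p) (inj₂ q) with trans (sym p) q
  ... | refl = inj₁ (refl , refl)

  record Branching : Set where
    field
      t     : V → E
      p     : V → V
      joins : ∀ {x} → x ≢ r → Joins G (t x) x (p x)
      rank  : V → ℕ
      rank< : ∀ {x} → x ≢ r → rank (p x) ℕ.< rank x

  module _ (T : Branching) where
    open Branching T

    is-parent-edge? : ∀ e → Dec (∃ λ x → x ≢ r × t x ≡ e)
    is-parent-edge? e = Fin.any? λ x → ¬? (x Fin.≟ r) ×-dec (t x Fin.≟ e)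

    edge-set : Subset m
    edge-set = Vec.tabulate λ e → does (is-parent-edge? e)

    ∈-intro : ∀ {x} → x ≢ r → t x ∈ₛ edge-set
    ∈-intro {x} x≢r = Vec.lookup⇒[]= (t x) edge-set
      (trans (Vec.lookup∘tabulate _ (t x)) (dec-true (is-parent-edge? (t x)) (x , x≢r , refl)))

    ∈-elim : ∀ {e} → e ∈ₛ edge-set → ∃ λ x → x ≢ r × t x ≡ e
    ∈-elim {e} e∈ = from-does (is-parent-edge? e)
      (trans (sym (Vec.lookup∘tabulate (λ e → does (is-parent-edge? e)) e)) (Vec.[]=⇒lookup e∈))

    data Step (e : E) (u w : V) : Set where
      up   : u ≢ r → e ≡ t u → w ≡ p u → Step e u w
      down : w ≢ r → e ≡ t w → u ≡ p w → Step e u w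

    step : ∀ {e u w} → e ∈ₛ edge-set → Joins G e u w → Step e u w
    step e∈ j with ∈-elim e∈
    ... | x , x≢r , refl with Joins-ends (joins x≢r) j
    ... | inj₁ (refl , refl) = up x≢r refl refl
    ... | inj₂ (refl , refl) = down x≢r refl refl

    append : ∀ {u w z} → Walk G edge-set u w → Walk G edge-set w z → Walk G edge-set u z
    append []                  q = q
    append (e ∷⟨ e∈ , j ⟩ p) q = e ∷⟨ e∈ , j ⟩ append p q

    backwards : ∀ {u w} → Walk G edge-set u w → Walk G edge-set w u
    backwards []                  = []
    backwards (e ∷⟨ e∈ , j ⟩ p) = append (backwards p) (e ∷⟨ e∈ , Joins-sym j ⟩ [])

    to-root : ∀ fuel x → rank x ℕ.< fuel → Walk G edge-set x r
    to-root (suc fuel) x (s≤s lt) with x Fin.≟ r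
    ... | yes refl = []
    ... | no x≢r   = t x ∷⟨ ∈-intro x≢r , joins x≢r ⟩ to-root fuel (p x) (ℕ.<-≤-trans (rank< x≢r) lt)

    connected : Connected G edge-set
    connected u w = append (to-root (suc (rank u)) u (ℕ.n<1+n _)) (backwards (to-root (suc (rank w)) w (ℕ.n<1+n _)))

    -- A walk without repeated edges that has stepped down must keep descending, since climbing
    -- would reuse the edge by which the vertex was entered. It also enters its last vertex by that
    -- vertex's parent edge.
    descending : ∀ {w z} (q : Walk G edge-set w z) → w ≢ r → t w ∉ edgesW G q → Unique (edgesW G q) →
                 rank w ℕ.≤ rank z × (t z ≡ t w ⊎ t z ∈ edgesW G q)
    descending [] _ _ _ = ℕ.≤-refl , inj₁ refl
    descending (_∷⟨_,_⟩_ {w = w′} e e∈ j q) w≢r fresh (e# ∷ uniq) with step e∈ j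
    ... | up _ refl _ = contradiction (here refl) fresh
    ... | down w′≢r refl refl with descending q w′≢r (λ i → All.lookup e# i refl) uniq
    ... | le , last = ℕ.≤-trans (ℕ.<⇒≤ (rank< w′≢r)) le , inj₂ ([ here , there ]′ last)

    -- A walk that left `u` upwards has to turn down at some point to come back, and then enters `u`
    -- by its parent edge, which is already spent.
    no-return : ∀ {u w} (q : Walk G edge-set w u) → rank w ℕ.< rank u → t u ∉ edgesW G q → Unique (edgesW G q) → ⊥
    no-return [] lt _ _ = ℕ.<-irrefl refl lt
    no-return (e ∷⟨ e∈ , j ⟩ q) lt fresh (e# ∷ uniq) with step e∈ j
    ... | up w≢r refl refl = no-return q (ℕ.<-trans (rank< w≢r) lt) (fresh ∘ there) uniq
    ... | down w≢r refl refl with descending q w≢r (λ i → All.lookup e# i refl) uniq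
    ... | _ , last = fresh ([ here , there ]′ last)

    acyclic : Acyclic G edge-set
    acyclic u (e ∷⟨ e∈ , j ⟩ q) (e# ∷ uniq , _) with step e∈ j
    ... | up u≢r refl refl = no-return q (rank< u≢r) (λ i → All.lookup e# i refl) uniq
    ... | down w≢r refl refl with descending q w≢r (λ i → All.lookup e# i refl) uniq
    ... | le , _ = ℕ.<⇒≱ (rank< w≢r) le

    spanning : IsSpanningTree G edge-set
    spanning = connected , acyclic

    -- Ancestors enter only through a preorder in which parents come first. This lets the same
    -- argument run with `F₁`, `F₂`, `α` or `β`, whichever separates two given trees.
    module Paths (_≼_ : V → V → Set) (≼-refl : ∀ {x} → x ≼ x) (≼-trans : ∀ {x y z} → x ≼ y → y ≼ z → x ≼ z)
      (parent≼ : ∀ {x} → x ≢ r → p x ≼ x) where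

      path-below : ∀ {w z} (q : Walk G edge-set w z) → w ≢ r → p w ∉ vertices G q → Unique (vertices G q) →
                   z ≢ r × w ≼ z × (∀ {e} → e ∈ edgesW G q → ∃ λ x → x ≢ r × e ≡ t x × x ≼ z)
      path-below [] w≢r _ _ = w≢r , ≼-refl , λ ()
      path-below (_∷⟨_,_⟩_ {w = w′} e e∈ j q) w≢r fresh (w# ∷ uniq) with step e∈ j
      ... | up _ _ refl = contradiction (there (here refl)) fresh
      ... | down w′≢r refl refl with path-below q w′≢r (λ i → All.lookup w# i refl) uniq
      ... | z≢r , le , edges = z≢r , ≼-trans (parent≼ w′≢r) le ,
        λ { (here refl) → w′ , w′≢r , refl , le ; (there i) → edges i }

      path-edges : ∀ {v} (q : Walk G edge-set r v) → Unique (vertices G q) → ∀ {e} → e ∈ edgesW G q →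
                   v ≢ r × ∃ λ x → x ≢ r × e ≡ t x × x ≼ v
      path-edges (_∷⟨_,_⟩_ {w = w} e e∈ j q) (r# ∷ uniq) i with step e∈ j
      ... | up r≢r _ _ = contradiction refl r≢r
      ... | down w≢r refl p≡ with path-below q w≢r (λ k → All.lookup r# k p≡) uniq
      path-edges (_∷⟨_,_⟩_ {w = w} e e∈ j q) (r# ∷ uniq) (here refl) | down w≢r refl p≡ | z≢r , le , _ = z≢r , w , w≢r , refl , le
      path-edges (_∷⟨_,_⟩_ {w = w} e e∈ j q) (r# ∷ uniq) (there i)   | down w≢r refl p≡ | z≢r , _ , edges = z≢r , edges i

  module _ (T T′ : Branching) where
    private
      module T = Branching T
      module T′ = Branching T′

    record Separated : Set₁ where
      field
        _≼_ _≼′_  : V → V → Set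
        ≼-refl    : ∀ {x} → x ≼ x
        ≼′-refl   : ∀ {x} → x ≼′ x
        ≼-trans   : ∀ {x y z} → x ≼ y → y ≼ z → x ≼ z
        ≼′-trans  : ∀ {x y z} → x ≼′ y → y ≼′ z → x ≼′ z
        parent≼   : ∀ {x} → x ≢ r → T.p x ≼ x
        parent≼′  : ∀ {x} → x ≢ r → T′.p x ≼′ x
        separated : ∀ {u w v} → u ≢ r → w ≢ r → v ≢ r → T.t u ≡ T′.t w → u ≼ v → w ≼′ v → ⊥

    independent : Separated → EdgeIndependent G r (edge-set T) (edge-set T′)
    independent S v P Q P-path Q-path e i i′ = meet (P-edges P P-path i) (Q-edges Q Q-path i′)
      where
      open Separated S
      open Paths T _≼_ ≼-refl ≼-trans parent≼ renaming (path-edges to P-edges)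
      open Paths T′ _≼′_ ≼′-refl ≼′-trans parent≼′ renaming (path-edges to Q-edges)
      meet : (v ≢ r × ∃ λ u → u ≢ r × e ≡ T.t u × u ≼ v) → (v ≢ r × ∃ λ w → w ≢ r × e ≡ T′.t w × w ≼′ v) → ⊥
      meet (v≢r , u , u≢r , eq , u≼v) (_ , w , w≢r , eq′ , w≼v) =
        separated u≢r w≢r v≢r (trans (sym eq) eq′) u≼v w≼v

  independent-sym : ∀ {T T′} → EdgeIndependent G r T T′ → EdgeIndependent G r T′ T
  independent-sym ind v P Q P-path Q-path e i i′ = ind v Q P Q-path P-path e i′ i

  net : Net n m
  net = record { src = proj₁ ∘ ends ; tgt = proj₂ ∘ ends ; alive = λ _ → true ; W = λ _ → true
               ; src∈ = λ _ → refl ; tgt∈ = λ _ → refl }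

  open Net net using (Join; crosses; d)

  from-Join : ∀ {g a b} → Join g a b → Joins G g a b
  from-Join (_ , inj₁ (refl , refl)) = inj₁ refl
  from-Join (_ , inj₂ (refl , refl)) = inj₂ refl

  ∣tabulate∣ : ∀ {k} (f : Fin k → Bool) → ∣ Vec.tabulate f ∣ ≡ size f
  ∣tabulate∣ {zero}  f = refl
  ∣tabulate∣ {suc k} f with f zero
  ... | true  = cong suc (∣tabulate∣ (f ∘ suc))
  ... | false = ∣tabulate∣ (f ∘ suc)

  no-crossing : ∀ X {u w} → Walk G (∁ (Vec.tabulate (crosses X))) u w → X u ≡ X w
  no-crossing X []                      = refl
  no-crossing X (e ∷⟨ e∈ , j ⟩ q) = trans (along j) (no-crossing X q)
    where
    uncrossed : crosses X e ≡ false
    uncrossed = trans (sym (Vec.lookup∘tabulate (crosses X) e)) (not-true (trans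
      (sym (Vec.lookup-map e not (Vec.tabulate (crosses X)))) (Vec.[]=⇒lookup e∈)))
    equal : ∀ a b → a xor b ≡ false → a ≡ b
    equal true  true  _ = refl
    equal false false _ = refl
    along : ∀ {u w} → Joins G e u w → X u ≡ X w
    along (inj₁ refl) = equal _ _ uncrossed
    along (inj₂ refl) = sym (equal _ _ uncrossed)

  cut4 : EdgeConnected G 4 → Net.Cut4 net r
  cut4 (_ , conn) X r∉ {x} _ x∈ = ℕ.≮⇒≥ λ lt → clash
    (trans (no-crossing X (conn (Vec.tabulate (crosses X)) (subst (ℕ._< 4) (sym (∣tabulate∣ (crosses X))) lt) r x)) x∈) r∉

  another : ∀ {k} → 1 ℕ.< k → (i : Fin k) → ∃ λ j → j ≢ i
  another {suc zero} (s≤s ()) _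
  another {suc (suc _)} _ zero    = suc zero , λ ()
  another {suc (suc _)} _ (suc i) = zero , λ ()

  some-edge : EdgeConnected G 4 → E
  some-edge (1<n , conn) with another 1<n r
  ... | x , x≢r with conn ⊥ₛ (subst (ℕ._< 4) (sym (∣⊥∣≡0 m)) (s≤s z≤n)) r x
  ... | [] = contradiction refl x≢r
  ... | e ∷⟨ _ , _ ⟩ _ = e

  module FourTrees (D : Decomposition (λ _ → true) r Join) (e₀ : E) where
    open Decomposition D

    private
      L : Label → Link n m
      L = Usable Join lab

      module Side (κ : V → ℤ) (ℓ : Label) (exits : TwoExits (λ _ → true) r κ (L ℓ)) where
        open Growth (λ _ → true) r κ (L ℓ) (usable-isLink (Net.isLink net) lab ℓ) exits (_== r) (==-refl r)

        grown : Σ (V → Bool) λ S → Structure S × (∀ {u} → true ≡ true → S u ≡ true)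
        grown = complete e₀

        open Structure (proj₁ (proj₂ grown)) public

        everywhere : ∀ u → proj₁ grown u ≡ true
        everywhere u = proj₂ (proj₂ grown) refl

        non-root : ∀ {x} → x ≢ r → (x == r) ≡ false
        non-root x≢r = ==-≢ x≢r

        usable₁ : ∀ {x} → x ≢ r → L ℓ (t₁ x) x (p₁ x)
        usable₁ {x} x≢r = proj₁ (node₁ (everywhere x) (non-root x≢r))
        usable₂ : ∀ {x} → x ≢ r → L ℓ (t₂ x) x (p₂ x)
        usable₂ {x} x≢r = proj₁ (node₂ (everywhere x) (non-root x≢r))

        level₁ : ∀ {x} → x ≢ r → κ (p₁ x) ℤ.≤ κ x
        level₁ {x} x≢r = proj₁ (proj₂ (proj₂ (node₁ (everywhere x) (non-root x≢r))))
        level₂ : ∀ {x} → x ≢ r → κ (p₂ x) ℤ.≤ κ x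
        level₂ {x} x≢r = proj₁ (proj₂ (proj₂ (node₂ (everywhere x) (non-root x≢r))))

        below₁ : ∀ {x} → x ≢ r → F₁ (p₁ x) ℕ.< F₁ x
        below₁ {x} x≢r = proj₂ (proj₂ (proj₂ (node₁ (everywhere x) (non-root x≢r))))
        above₂ : ∀ {x} → x ≢ r → F₂ x ℕ.< F₂ (p₂ x)
        above₂ {x} x≢r = proj₂ (proj₂ (proj₂ (node₂ (everywhere x) (non-root x≢r))))

        term≤sum : ∀ x → F₂ x ℕ.≤ sum F₂
        term≤sum x = subst (F₂ x ℕ.≤_) (sym (sum-extract F₂ x)) (ℕ.m≤m+n (F₂ x) _)

        tree₁ tree₂ : Branching
        tree₁ = record { t = t₁ ; p = p₁ ; joins = λ x≢r → from-Join (proj₁ (usable₁ x≢r)) ; rank = F₁ ; rank< = below₁ }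
        tree₂ = record { t = t₂ ; p = p₂ ; joins = λ x≢r → from-Join (proj₁ (usable₂ x≢r))
                       -- `F₂` grows towards the root, so it is subtracted from an upper bound of
                       -- all its values.
                       ; rank = λ x → sum F₂ ∸ F₂ x ; rank< = λ {x} x≢r → ℕ.∸-monoʳ-< (above₂ x≢r) (term≤sum (p₂ x)) }

        independent₁₂ : EdgeIndependent G r (edge-set tree₁) (edge-set tree₂)
        independent₁₂ = independent tree₁ tree₂ record
          { _≼_ = λ x y → F₁ x ℕ.≤ F₁ y ; _≼′_ = λ x y → F₂ y ℕ.≤ F₂ x
          ; ≼-refl = ℕ.≤-refl ; ≼′-refl = ℕ.≤-refl ; ≼-trans = ℕ.≤-trans ; ≼′-trans = λ p q → ℕ.≤-trans q p
          ; parent≼ = λ x≢r → ℕ.<⇒≤ (below₁ x≢r) ; parent≼′ = λ x≢r → ℕ.<⇒≤ (above₂ x≢r)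
          ; separated = λ {u} {w} {v} u≢r w≢r _ eq u≼v w≼v → ℕ.<⇒≱ (lower (everywhere v))
              (ℕ.≤-trans w≼v (ℕ.≤-trans (shared (everywhere u) (non-root u≢r) (everywhere w) (non-root w≢r) eq) u≼v)) }

      module Fwd = Side α B fwd
      module Bwd = Side (λ u → ℤ.- β u) F bwd

      not-F-not-B : ∀ {ℓ} → ℓ ≢ B → ℓ ≢ F → ℓ ≡ O
      not-F-not-B {F} _ q = contradiction refl q
      not-F-not-B {B} p _ = contradiction refl p
      not-F-not-B {O} _ _ = refl

      -- An edge used in both directions of time must be one-way. A forward tree can leave only its
      -- later end and a backward tree only its earlier end, which settles which end is `u` and
      -- which is `w`.
      coupled : ∀ {g u p w q} → L B g u p → α p ℤ.≤ α u → L F g w q → ℤ.- β q ℤ.≤ ℤ.- β w → β w ℤ.< α u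
      coupled (j , nB) le (j′ , nF) le′
        with oneway j (not-F-not-B nB nF) | IsLink.ends (Net.isLink net) j j′
      ... | inj₁ lt | _ = contradiction (ℤ.<-≤-trans lt le) (ℤ.<-asym (α<β refl))
      ... | inj₂ lt | inj₂ (refl , refl) = lt
      ... | inj₂ lt | inj₁ (refl , refl) =
        contradiction (ℤ.≤-<-trans (ℤ.neg-cancel-≤ le′) lt) (ℤ.<-asym (α<β refl))

      across : ∀ (T T′ : Branching) →
        (∀ {x} → x ≢ r → L B (Branching.t T x) x (Branching.p T x) × α (Branching.p T x) ℤ.≤ α x) →
        (∀ {x} → x ≢ r → L F (Branching.t T′ x) x (Branching.p T′ x) × ℤ.- β (Branching.p T′ x) ℤ.≤ ℤ.- β x) →
        EdgeIndependent G r (edge-set T) (edge-set T′)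
      across T T′ node node′ = independent T T′ record
        { _≼_ = λ x y → α x ℤ.≤ α y ; _≼′_ = λ x y → β y ℤ.≤ β x
        ; ≼-refl = ℤ.≤-refl ; ≼′-refl = ℤ.≤-refl ; ≼-trans = ℤ.≤-trans ; ≼′-trans = λ p q → ℤ.≤-trans q p
        ; parent≼ = λ x≢r → proj₂ (node x≢r) ; parent≼′ = λ x≢r → ℤ.neg-cancel-≤ (proj₂ (node′ x≢r))
        ; separated = λ {u} {w} {v} u≢r w≢r _ eq u≼v w≼v →
            let (l , le) = node u≢r ; (l′ , le′) = node′ w≢r in
            -- The cycle is `β w < α u ≤ α v < β v ≤ β w`.
            ℤ.<-asym (ℤ.<-≤-trans (α<β {v} refl) w≼v)
              (ℤ.<-≤-trans (coupled l le (subst (λ g → L F g w (Branching.p T′ w)) (sym eq) l′) le′) u≼v) }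

    tree : Fin 4 → Branching
    tree 0F = Fwd.tree₁
    tree 1F = Fwd.tree₂
    tree 2F = Bwd.tree₁
    tree 3F = Bwd.tree₂

    pairwise : ∀ i j → i ≢ j → EdgeIndependent G r (edge-set (tree i)) (edge-set (tree j))
    pairwise = table
      where
      Ind : Fin 4 → Fin 4 → Set
      Ind i j = EdgeIndependent G r (edge-set (tree i)) (edge-set (tree j))
      i01 : Ind 0F 1F
      i01 = Fwd.independent₁₂
      i23 : Ind 2F 3F
      i23 = Bwd.independent₁₂
      i02 : Ind 0F 2F
      i02 = across (tree 0F) (tree 2F) (λ x≢r → Fwd.usable₁ x≢r , Fwd.level₁ x≢r) (λ x≢r → Bwd.usable₁ x≢r , Bwd.level₁ x≢r)
      i03 : Ind 0F 3F
      i03 = across (tree 0F) (tree 3F) (λ x≢r → Fwd.usable₁ x≢r , Fwd.level₁ x≢r) (λ x≢r → Bwd.usable₂ x≢r , Bwd.level₂ x≢r)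
      i12 : Ind 1F 2F
      i12 = across (tree 1F) (tree 2F) (λ x≢r → Fwd.usable₂ x≢r , Fwd.level₂ x≢r) (λ x≢r → Bwd.usable₁ x≢r , Bwd.level₁ x≢r)
      i13 : Ind 1F 3F
      i13 = across (tree 1F) (tree 3F) (λ x≢r → Fwd.usable₂ x≢r , Fwd.level₂ x≢r) (λ x≢r → Bwd.usable₂ x≢r , Bwd.level₂ x≢r)
      table : ∀ i j → i ≢ j → Ind i j
      table 0F 0F p = contradiction refl p
      table 1F 1F p = contradiction refl p
      table 2F 2F p = contradiction refl p
      table 3F 3F p = contradiction refl p
      table 0F 1F _ = i01
      table 0F 2F _ = i02
      table 0F 3F _ = i03
      table 1F 2F _ = i12
      table 1F 3F _ = i13
      table 2F 3F _ = i23
      table 1F 0F _ = independent-sym i01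
      table 2F 0F _ = independent-sym i02
      table 3F 0F _ = independent-sym i03
      table 2F 1F _ = independent-sym i12
      table 3F 1F _ = independent-sym i13
      table 3F 2F _ = independent-sym i23

theorem1 : (G : Multigraph) → (r : Fin (Multigraph.n G)) →
    EdgeConnected G 4 →
    Σ (Fin 4 → Subset (Multigraph.m G)) (λ T →
    (∀ i → IsSpanningTree G (T i)) ×
    (∀ i j → i ≢ j → EdgeIndependent G r (T i) (T j)))
theorem1 G r ec = (λ i → edge-set (tree i)) , (λ i → spanning (tree i)) , pairwise
  where
  open Trees G r
  open FourTrees (decompose net refl (cut4 ec)) (some-edge ec)
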